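{- Let $p\in\{53,71,73,89\}$. Let $\alpha$ be the unique integer with $0<\alpha<2p$ and $\alpha\equiv -3^{ -1}\pmod{2p}$, and let $\beta=\lfloor 2p/3\rfloor$. Then \[ \sum_{n=0}^{\infty}b_{9}(2pn+\alpha)q^{n}\equiv q^{\beta}\sum_{n=0}^{\infty}b_{9}(2n+1)q^{pn}\pmod 2 . \]
   Context: For an integer $t\ge 2$, a $t$-regular partition of $n$ is a partition of $n$ none of whose parts is divisible by $t$; $b_t(n)$ denotes the number of $t$-regular partitions of $n$ (with $b_t(0)=1$). Equivalently, $\sum_{n\ge0}b_t(n)q^n=f_t/f_1$, where $f_k=\prod_{j\ge1}(1-q^{jk})$. A congruence of power series modulo $2$ means coefficientwise congruence. -}

module Defs where

open import Data.Nat using (ℕ; zero; suc; _+_; _*_; _∸_; _/_)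
open import Data.Nat.Divisibility using (_∣?_)
open import Data.List using (List; map; upTo)
open import Data.Nat.ListAction using (sum)
open import Data.Bool using (if_then_else_)
open import Relation.Nullary using (does)
open import Data.Nat using (_≡ᵇ_)

-- regCount t k n = number of partitions of n all of whose parts are ≤ k
-- and none of whose parts is divisible by t.
-- Recursion on the largest allowed part size k: a part size s = suc k that
-- is allowed (t ∤ s) occurs with some multiplicity j, 0 ≤ j ≤ n / s.
regCount : ℕ → ℕ → ℕ → ℕ
regCount t zero zero = 1
regCount t zero (suc n) = 0
regCount t (suc k) n =
  if does (t ∣? suc k)
  then regCount t k n
  else sum (map (λ j → regCount t k (n ∸ j * suc k)) (upTo (suc (n / suc k))))

-- b t n : number of t-regular partitions of n (parts are ≤ n anyway).
b : ℕ → ℕ → ℕ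
b t n = regCount t n n

-- Coefficient of q^n in the power series  q^β · Σ_{m ≥ 0} a(m) q^{p m}.
-- (Only m ≤ n can contribute when p ≥ 1.)
shiftDilate : ℕ → ℕ → (ℕ → ℕ) → ℕ → ℕ
shiftDilate p β a n =
  sum (map (λ m → if (β + p * m) ≡ᵇ n then a m else 0) (upTo (suc n)))

{-# OPTIONS --safe #-}

-- Work in 𝔽₂[[q]], with fₖ = ∏ (1 − q^{jk}) and F = f₉/f₁.
--
-- The odd part of F is q L(q)² with L = f₁f₉²/f₃, so b₉(2n + 1) is the n-th coefficient of L: taking odd
-- parts in F f₁⁴ = f₉ f₁³ = f₃f₉ + q f₉⁴, it remains to know the odd part of f₃f₉, and this is read off
-- f₃³f₉³ = f₃¹² + q³f₉¹². Both identities used here, f₁³ = f₃ + q f₉³ and the last one, compare theta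
-- series furnished by Jacobi's triple product.
--
-- L is an Eisenstein series: its n-th coefficient counts the factorisations 3n + 2 = de with d ≡ 1 and
-- e ≡ 2 (mod 3) and 9 ∤ d + e. Indeed, multiplying both sides by the 3-core series f₃³/f₁ = ∑ q^{k(3k − 2)}
-- turns this into a statement about x² + de = m, and reflections of this ternary form pair off all
-- solutions except those of a binary form d² + 3X², which is counted by f₃²f₉².
--
-- If p is a prime ≡ ±1 (mod 9), moving a factor p between d and e (and exchanging d and e if p ≡ −1)
-- respects the conditions, so that pk has, modulo 2, as many such factorisations as k/p.

module Submission where

open import Defs
open import Data.Nat using (ℕ; _+_; _*_; _/_; _%_; _<_)
open import Data.Nat.Divisibility using (_∣_)
open import Data.Sum using (_⊎_)
open import Relation.Binary.PropositionalEquality using (_≡_)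

open import Algebra.Bundles using (CommutativeRing; RawRing)
open import Data.Bool using (Bool; true; false; not; _∧_; _xor_; if_then_else_)
open import Data.Bool.Properties
  using (xor-same; xor-identityʳ; xor-comm; xor-assoc; xor-∧-commutativeRing; ∧-distribʳ-xor; ∧-zeroʳ; ∧-idem; not-involutive)
open import Data.Empty using (⊥-elim)
open import Data.Integer as ℤ using (ℤ; +_; -[1+_]; 0ℤ; 1ℤ; _⊖_; _%ℕ_; _/ℕ_)
import Data.Integer.DivMod as ℤ
import Data.Integer.Divisibility.Signed as Signed
import Data.Integer.Properties as ℤ
open import Algebra.Properties.AbelianGroup ℤ.+-0-abelianGroup using (∙-cancelʳ)
open import Data.Integer.Tactic.RingSolver using () renaming (solve-∀ to solve-ℤ)
open import Data.List using (List; []; _∷_; map; filter; length; cartesianProduct; _++_; applyUpTo; upTo)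
open import Data.List.Membership.Propositional using (_∈_)
open import Data.List.Membership.Propositional.Properties
  using (∈-map⁺; ∈-map⁻; ∈-filter⁺; ∈-filter⁻; ∈-cartesianProduct⁺; ∈-cartesianProduct⁻; ∈-++⁺ˡ; ∈-++⁺ʳ; ∈-++⁻;
         ∈-applyUpTo⁺; ∈-applyUpTo⁻; ∈-upTo⁺; ∈-upTo⁻)
open import Data.List.Membership.Propositional.Properties.WithK using (unique∧set⇒bag)
open import Data.List.Properties using (length-map; length-++)
open import Data.List.Relation.Binary.BagAndSetEquality using (∼bag⇒↭)
open import Data.List.Relation.Binary.Permutation.Propositional.Properties using (↭-length)
open import Data.List.Relation.Unary.All as All using ()
import Data.List.Relation.Unary.All.Properties as All
open import Data.List.Relation.Unary.AllPairs using ([]; _∷_)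
open import Data.List.Relation.Unary.Any using (here; there)
open import Data.List.Relation.Unary.Unique.Propositional using (Unique)
import Data.List.Relation.Unary.Unique.Propositional.Properties as Unique
open import Data.Maybe using (Maybe; just; nothing)
open import Data.Nat as ℕ using (zero; suc; NonZero; _≤_; z≤n; s≤s; _∸_; _≡ᵇ_)
import Data.Nat.DivMod as ℕ
open import Data.Nat.Divisibility
  using (_∣?_; divides; divides-refl; ∣m+n∣m⇒∣n; ∣m∣n⇒∣m+n; *-cancelˡ-∣; *-monoʳ-∣; n∣m*n)
open import Data.Nat.ListAction using (sum)
open import Data.Nat.Primality using (Prime; prime?; euclidsLemma; prime⇒nonZero)
import Data.Nat.Properties as ℕ
open import Data.Nat.Tactic.RingSolver using () renaming (solve-∀ to solve-ℕ)
open import Data.Product using (_×_; _,_; proj₁; proj₂; ∃)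
open import Data.Sum using (inj₁; inj₂; [_,_])
open import Data.Unit using (⊤; tt)
open import Function using (_∘_; id; mk⇔)
open import Level using (0ℓ)
open import Relation.Binary.PropositionalEquality
  using (_≢_; refl; sym; trans; cong; cong₂; subst; subst₂; module ≡-Reasoning)
open import Relation.Nullary using (¬_; Dec; yes; no; does; ¬?; map′)
open import Relation.Nullary.Decidable using (_×-dec_; _→-dec_; dec-true; dec-false; from-yes; from-no)
open import Relation.Unary using (Decidable)
open import Tactic.RingSolver using () renaming (solve-∀ to solve-ring)
open import Tactic.RingSolver.Core.AlmostCommutativeRing using (AlmostCommutativeRing; fromCommutativeRing)

-- Parities of finite sets

-- The multiplier f₃³/f₁ is dictated by L = f₁f₉²/f₃: their product is f₃²f₉² ≡ f₆f₁₈, a product of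
-- two pentagonal theta series, and the multiplier is a theta series itself. Hence both sides of the
-- identity for L count integral points on quadratic forms. Only parities of these counts matter, so
-- bijections and involutions do all the work, and no class numbers or modular forms enter. Cubes
-- occur in the dissection of F because fᵣ³ is a theta series modulo 2, while fᵣ² is constant for
-- the derivation that extracts odd parts: the odd part of (f₃f₉)³ is (f₃f₉)² times that of f₃f₉.
-- The index in the theorem is chosen to meet the factorisations: if 2pn + α = 2i + 1, then 3i + 2 =
-- kp with k = 3n + κ and κ = 2p mod 3, and k/p has the form 3m + 2 exactly when n = β + pm. Of the
-- four primes, 73 ≡ 1 and 53, 71, 89 ≡ -1 (mod 9), so that dp + e ≡ ±d + e (mod 9), which is what
-- keeps the condition 9 ∤ d + e under control.

odd : ℕ → Bool
odd zero    = false
odd (suc n) = not (odd n)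

odd-+ : ∀ m n → odd (m + n) ≡ odd m xor odd n
odd-+ zero n = refl
odd-+ (suc m) n rewrite odd-+ m n with odd m
... | true  = not-involutive (odd n)
... | false = refl

odd-* : ∀ m n → odd (m * n) ≡ odd m ∧ odd n
odd-* zero n = refl
odd-* (suc m) n rewrite odd-+ n (m * n) | odd-* m n with odd m | odd n
... | true  | true  = refl
... | true  | false = refl
... | false | true  = refl
... | false | false = refl

record Finite {A : Set} (P : A → Set) : Set where
  field
    elements : List A
    unique   : Unique elements
    sound    : ∀ {x} → x ∈ elements → P x
    complete : ∀ {x} → P x → x ∈ elements

open Finite

parity : ∀ {A : Set} {P : A → Set} → Finite P → Bool
parity F = odd (length (elements F))

-- The maps are total on the ambient types and the laws are required only on `P` and `Q`, so that
-- solution sets are compared by plain formulas, without carrying proofs inside the elements.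
record _≅_ {A B : Set} (P : A → Set) (Q : B → Set) : Set where
  constructor bijection
  field
    to      : A → B
    from    : B → A
    to-∈    : ∀ {x} → P x → Q (to x)
    from-∈  : ∀ {y} → Q y → P (from y)
    from-to : ∀ {x} → P x → from (to x) ≡ x
    to-from : ∀ {y} → Q y → to (from y) ≡ y

module _ {A B : Set} where

  unique-map : (f : A → B) {xs : List A} → (∀ {x y} → x ∈ xs → y ∈ xs → f x ≡ f y → x ≡ y) →
               Unique xs → Unique (map f xs)
  unique-map f inj [] = []
  unique-map f {x ∷ xs} inj (x∉ ∷ u) =
    All.map⁺ (All.tabulate λ {y} y∈ eq → All.lookup x∉ y∈ (inj (here refl) (there y∈) eq))
    ∷ unique-map f (λ p q → inj (there p) (there q)) u

  transport : {P : A → Set} {Q : B → Set} → P ≅ Q → Finite P → Finite Q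
  transport {P} {Q} e F = record
    { elements = map to (elements F)
    ; unique = unique-map to
        (λ p q eq → trans (sym (from-to (sound F p))) (trans (cong from eq) (from-to (sound F q))))
        (unique F)
    ; sound = λ y∈ → let x , x∈ , eq = ∈-map⁻ to y∈ in subst Q (sym eq) (to-∈ (sound F x∈))
    ; complete = λ q → subst (_∈ _) (to-from q) (∈-map⁺ to (complete F (from-∈ q)))
    }
    where open _≅_ e

module _ {A : Set} where

  parity-irrelevant : {P : A → Set} (F G : Finite P) → parity F ≡ parity G
  parity-irrelevant F G = cong odd (↭-length (∼bag⇒↭ (unique∧set⇒bag (unique F) (unique G)
    (mk⇔ (complete G ∘ sound F) (complete F ∘ sound G)))))

parity-≅ : {A B : Set} {P : A → Set} {Q : B → Set} → P ≅ Q →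
           (F : Finite P) (G : Finite Q) → parity F ≡ parity G
parity-≅ e F G = trans (cong odd (sym (length-map (_≅_.to e) (elements F))))
                       (parity-irrelevant (transport e F) G)

≅-sym : {A B : Set} {P : A → Set} {Q : B → Set} → P ≅ Q → Q ≅ P
≅-sym (bijection t f tp fp ft tf) = bijection f t fp tp tf ft

infix 5 _∩_
_∩_ : {A : Set} → (A → Set) → (A → Set) → A → Set
(P ∩ Q) x = P x × Q x

∁ : {A : Set} → (A → Set) → A → Set
∁ P x = ¬ P x

module _ {A : Set} where

  restrict : {P D : A → Set} → Decidable D → Finite P → Finite (P ∩ D)
  restrict D? F = record
    { elements = filter D? (elements F)
    ; unique = Unique.filter⁺ D? (unique F)
    ; sound = λ x∈ → let p , d = ∈-filter⁻ D? {xs = elements F} x∈ in sound F p , d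
    ; complete = λ (p , d) → ∈-filter⁺ D? (complete F p) d
    }

  ∁? : {D : A → Set} → Decidable D → Decidable (∁ D)
  ∁? D? x = ¬? (D? x)

  private
    odd-filter : {D : A → Set} (D? : Decidable D) (xs : List A) →
      odd (length xs) ≡ odd (length (filter D? xs)) xor odd (length (filter (∁? D?) xs))
    odd-filter D? [] = refl
    odd-filter D? (x ∷ xs) with D? x | odd-filter D? xs
    ... | yes _ | eq rewrite eq with odd (length (filter D? xs))
    ...   | true  = not-involutive _
    ...   | false = refl
    odd-filter D? (x ∷ xs) | no _ | eq rewrite eq with odd (length (filter D? xs))
    ...   | true  = refl
    ...   | false = refl

  parity-split : {P D : A → Set} (D? : Decidable D) (F : Finite P) →
    parity F ≡ parity (restrict D? F) xor parity (restrict (∁? D?) F)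
  parity-split D? F = odd-filter D? (elements F)

  parity-∅ : {P : A → Set} (F : Finite P) → (∀ x → ¬ P x) → parity F ≡ false
  parity-∅ F ∄ with elements F in eq
  ... | []    = refl
  ... | x ∷ _ = ⊥-elim (∄ x (sound F (subst (x ∈_) (sym eq) (here refl))))

  parity-⊆ : {P Q : A → Set} → (∀ {x} → P x → Q x) → (∀ {x} → Q x → P x) →
             (F : Finite P) (G : Finite Q) → parity F ≡ parity G
  parity-⊆ to from = parity-≅ (bijection id id to from (λ _ → refl) (λ _ → refl))

  -- `key` replaces a test for fixed points: being negated by `φ`, it vanishes at each of them, and
  -- wherever it does not vanish its sign selects one element of every pair.
  record Involution (P : A → Set) : Set where
    constructor involution
    field
      φ      : A → A
      key    : A → ℤ
      φ-∈    : ∀ {x} → P x → P (φ x)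
      φ-φ    : ∀ {x} → P x → φ (φ x) ≡ x
      negate : ∀ x → key (φ x) ≡ ℤ.- key x

  module _ {P : A → Set} (F : Finite P) (I : Involution P) where
    open Involution I

    parity-free : (∀ {x} → P x → key x ≢ 0ℤ) → parity F ≡ false
    parity-free ≢0 = trans (parity-split (λ x → 0ℤ ℤ.<? key x) F)
      (trans (cong (parity (restrict (λ x → 0ℤ ℤ.<? key x) F) xor_)
        (sym (parity-≅ halves (restrict (λ x → 0ℤ ℤ.<? key x) F)
                              (restrict (∁? (λ x → 0ℤ ℤ.<? key x)) F))))
        (xor-same (parity (restrict (λ x → 0ℤ ℤ.<? key x) F))))
      where
      pos→neg : ∀ {k} → 0ℤ ℤ.< k → ¬ (0ℤ ℤ.< ℤ.- k)
      pos→neg {+ suc n} _ ()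
      pos→neg {+ zero} (ℤ.+<+ ()) _
      neg→pos : ∀ {k} → k ≢ 0ℤ → ¬ (0ℤ ℤ.< k) → 0ℤ ℤ.< ℤ.- k
      neg→pos {+ zero} ne _ = ⊥-elim (ne refl)
      neg→pos {+ suc n} _ np = ⊥-elim (np (ℤ.+<+ (ℕ.s≤s ℕ.z≤n)))
      neg→pos { -[1+ n ]} _ _ = ℤ.+<+ (ℕ.s≤s ℕ.z≤n)
      halves : (P ∩ λ x → 0ℤ ℤ.< key x) ≅ (P ∩ ∁ λ x → 0ℤ ℤ.< key x)
      halves = bijection φ φ
        (λ {x} (p , d) → φ-∈ p , λ d′ → pos→neg d (subst (0ℤ ℤ.<_) (negate x) d′))
        (λ {x} (p , d) → φ-∈ p , subst (0ℤ ℤ.<_) (sym (negate x)) (neg→pos (≢0 p) d))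
        (φ-φ ∘ proj₁) (φ-φ ∘ proj₁)

  -- `φ` pairs off the elements with nonzero `key`. The zeros of `key` may include points that move;
  -- it matters only that no fixed point lies elsewhere.
  parity-involution : {P : A → Set} (F : Finite P) (I : Involution P) →
    parity F ≡ parity (restrict (λ x → Involution.key I x ℤ.≟ 0ℤ) F)
  parity-involution {P} F I = trans (parity-split (λ x → key x ℤ.≟ 0ℤ) F)
    (trans (cong (parity (restrict (λ x → key x ℤ.≟ 0ℤ) F) xor_)
                 (parity-free (restrict (∁? (λ x → key x ℤ.≟ 0ℤ)) F) I′ proj₂))
           (xor-identityʳ _))
    where
    open Involution I
    neg≡0 : ∀ {k} → ℤ.- k ≡ 0ℤ → k ≡ 0ℤ
    neg≡0 {+ zero} _ = refl
    I′ : Involution (P ∩ ∁ λ x → key x ≡ 0ℤ)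
    I′ = involution φ key
      (λ {x} (p , ne) → φ-∈ p , λ eq → ne (neg≡0 (trans (sym (negate x)) eq)))
      (φ-φ ∘ proj₁) negate

module _ {A B : Set} {P : A → Set} {Q : B → Set} where

  _⊗_ : Finite P → Finite Q → Finite (λ ((x , y) : A × B) → P x × Q y)
  F ⊗ G = record
    { elements = cartesianProduct (elements F) (elements G)
    ; unique = Unique.cartesianProduct⁺ (unique F) (unique G)
    ; sound = λ xy∈ → let x∈ , y∈ = ∈-cartesianProduct⁻ (elements F) (elements G) xy∈ in
                      sound F x∈ , sound G y∈
    ; complete = λ (p , q) → ∈-cartesianProduct⁺ (complete F p) (complete G q)
    }

  parity-⊗ : (F : Finite P) (G : Finite Q) → parity (F ⊗ G) ≡ parity F ∧ parity G
  parity-⊗ F G = trans (cong odd (length-× (elements F) (elements G)))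
                       (odd-* (length (elements F)) (length (elements G)))
    where
    length-× : ∀ (xs : List A) (ys : List B) →
               length (cartesianProduct xs ys) ≡ length xs * length ys
    length-× [] ys = refl
    length-× (x ∷ xs) ys = trans (length-++ (map (x ,_) ys))
      (cong₂ ℕ._+_ (length-map (x ,_) ys) (length-× xs ys))

-- Power series over 𝔽₂

Bool-ring : AlmostCommutativeRing 0ℓ 0ℓ
Bool-ring = fromCommutativeRing xor-∧-commutativeRing λ { false → just refl ; true → nothing }

Series : Set
Series = ℕ → Bool

infix 4 _≈_ _≈[_]_
infixl 6 _⊕_
infixl 7 _·_

record _≈_ (f g : Series) : Set where
  constructor pointwise
  field coeff : ∀ n → f n ≡ g n

open _≈_ public

tail : Series → Series
tail f n = f (suc n)

_⊕_ _·_ : Series → Series → Series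
(f ⊕ g) n = f n xor g n
(f · g) zero    = f 0 ∧ g 0
(f · g) (suc n) = (f 0 ∧ g (suc n)) xor (tail f · g) n

𝟘 𝟙 : Series
𝟘 _ = false
𝟙 zero    = true
𝟙 (suc _) = false

mono : ℕ → Series
mono = _≡ᵇ_

_≈[_]_ : Series → ℕ → Series → Set
f ≈[ r ] g = ∀ {n} → n ℕ.< r → f n ≡ g n

·-cong[] : ∀ {f f′ g g′ r} → f ≈[ r ] f′ → g ≈[ r ] g′ → f · g ≈[ r ] f′ · g′
·-cong[] {r = suc r} p q {zero} n<r = cong₂ _∧_ (p n<r) (q n<r)
·-cong[] {r = suc r} p q {suc n} (ℕ.s≤s n<r) =
  cong₂ _xor_ (cong₂ _∧_ (p (ℕ.s≤s ℕ.z≤n)) (q (ℕ.s≤s n<r)))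
              (·-cong[] (λ l → p (ℕ.s≤s l)) (λ l → q (ℕ.m<n⇒m<1+n l)) n<r)

≈⇒≈[] : ∀ {f g} r → f ≈ g → f ≈[ r ] g
≈⇒≈[] r f≈g {n} _ = coeff f≈g n

private
  ·-cong : ∀ {f f′ g g′} → f ≈ f′ → g ≈ g′ → f · g ≈ f′ · g′
  ·-cong p q = pointwise λ n → ·-cong[] {r = suc n} (≈⇒≈[] _ p) (≈⇒≈[] _ q) ℕ.≤-refl

  ·-distribʳ : ∀ h f g n → ((f ⊕ g) · h) n ≡ (f · h) n xor (g · h) n
  ·-distribʳ h f g zero = lemma (f 0) (g 0) (h 0)
    where lemma : ∀ a b c → (a xor b) ∧ c ≡ (a ∧ c) xor (b ∧ c)
          lemma = solve-ring Bool-ring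
  ·-distribʳ h f g (suc n) rewrite ·-distribʳ h (tail f) (tail g) n =
    lemma (f 0) (g 0) (h (suc n)) ((tail f · h) n) ((tail g · h) n)
    where lemma : ∀ a b c d e → ((a xor b) ∧ c) xor (d xor e) ≡ ((a ∧ c) xor d) xor ((b ∧ c) xor e)
          lemma = solve-ring Bool-ring

  ·-scale : ∀ c f g n → ((λ k → c ∧ f k) · g) n ≡ c ∧ (f · g) n
  ·-scale c f g zero = lemma c (f 0) (g 0)
    where lemma : ∀ a b c → (a ∧ b) ∧ c ≡ a ∧ (b ∧ c)
          lemma = solve-ring Bool-ring
  ·-scale c f g (suc n) rewrite ·-scale c (tail f) g n = lemma c (f 0) (g (suc n)) ((tail f · g) n)
    where lemma : ∀ a b c d → ((a ∧ b) ∧ c) xor (a ∧ d) ≡ a ∧ ((b ∧ c) xor d)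
          lemma = solve-ring Bool-ring

  ·-assoc : ∀ f g h n → ((f · g) · h) n ≡ (f · (g · h)) n
  ·-assoc f g h zero = lemma (f 0) (g 0) (h 0)
    where lemma : ∀ a b c → (a ∧ b) ∧ c ≡ a ∧ (b ∧ c)
          lemma = solve-ring Bool-ring
  ·-assoc f g h (suc n)
    rewrite ·-distribʳ h (λ k → f 0 ∧ g (suc k)) (tail f · g) n
          | ·-scale (f 0) (tail g) h n | ·-assoc (tail f) g h n =
    lemma (f 0) (g 0) (h (suc n)) ((tail g · h) n) ((tail f · (g · h)) n)
    where lemma : ∀ a b c d e → ((a ∧ b) ∧ c) xor ((a ∧ d) xor e) ≡ (a ∧ ((b ∧ c) xor d)) xor e
          lemma = solve-ring Bool-ring

-- The defining recursion peels the left factor; peeling the right one instead is what gives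
-- commutativity, and both together give the coefficients of squares.
·-suc : ∀ f g n → (f · g) (suc n) ≡ (g 0 ∧ f (suc n)) xor (f · tail g) n
·-suc f g zero = lemma (f 0) (g 1) (f 1) (g 0)
  where lemma : ∀ a b c d → (a ∧ b) xor (c ∧ d) ≡ (d ∧ c) xor (a ∧ b)
        lemma = solve-ring Bool-ring
·-suc f g (suc n) rewrite ·-suc (tail f) g n =
  lemma (f 0 ∧ g (suc (suc n))) (g 0 ∧ f (suc (suc n))) ((tail f · tail g) n)
  where lemma : ∀ a b c → a xor (b xor c) ≡ b xor (a xor c)
        lemma = solve-ring Bool-ring

private
  ·-comm : ∀ f g n → (f · g) n ≡ (g · f) n
  ·-comm f g zero = lemma (f 0) (g 0)
    where lemma : ∀ a b → a ∧ b ≡ b ∧ a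
          lemma = solve-ring Bool-ring
  ·-comm f g (suc n) = sym (trans (·-suc g f n)
    (cong ((f 0 ∧ g (suc n)) xor_) (·-comm g (tail f) n)))

𝟘-· : ∀ f n → (𝟘 · f) n ≡ false
𝟘-· f zero    = refl
𝟘-· f (suc n) = 𝟘-· f n

𝟙-· : ∀ f n → (𝟙 · f) n ≡ f n
𝟙-· f zero    = refl
𝟙-· f (suc n) = trans (cong (f (suc n) xor_) (𝟘-· f n)) (xor-identityʳ _)

seriesRing : CommutativeRing 0ℓ 0ℓ
seriesRing = record
  { Carrier = Series ; _≈_ = _≈_ ; _+_ = _⊕_ ; _*_ = _·_ ; -_ = λ f → f ; 0# = 𝟘 ; 1# = 𝟙
  ; isCommutativeRing = record
    { isRing = record
      { +-isAbelianGroup = record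
        { isGroup = record
          { isMonoid = record
            { isSemigroup = record
              { isMagma = record
                { isEquivalence = record
                  { refl = pointwise λ _ → refl
                  ; sym = λ p → pointwise λ n → sym (coeff p n)
                  ; trans = λ p q → pointwise λ n → trans (coeff p n) (coeff q n) }
                ; ∙-cong = λ p q → pointwise λ n → cong₂ _xor_ (coeff p n) (coeff q n) }
              ; assoc = λ f g h → pointwise λ n → xor-assoc (f n) (g n) (h n) }
            ; identity = (λ f → pointwise λ _ → refl) , (λ f → pointwise λ n → xor-identityʳ (f n)) }
          ; inverse = (λ f → pointwise λ n → xor-same (f n)) , (λ f → pointwise λ n → xor-same (f n))
          ; ⁻¹-cong = λ p → p }
        ; comm = λ f g → pointwise λ n → xor-comm (f n) (g n) }
      ; *-cong = ·-cong
      ; *-assoc = λ f g h → pointwise (·-assoc f g h)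
      ; *-identity = (λ f → pointwise (𝟙-· f)) , (λ f → pointwise λ n → trans (·-comm f 𝟙 n) (𝟙-· f n))
      ; distrib = (λ f g h → pointwise λ n → trans (·-comm f (g ⊕ h) n)
                    (trans (·-distribʳ f g h n) (cong₂ _xor_ (·-comm g f n) (·-comm h f n))))
                , (λ h f g → pointwise (·-distribʳ h f g)) }
    ; *-comm = λ f g → pointwise (·-comm f g) } }

module R = CommutativeRing seriesRing

-- The coefficients are taken in 𝔽₂, so that normalisation knows the characteristic and cancels
-- repeated terms.
module Solver where
  import Algebra.Solver.Ring as Ring
  import Algebra.Solver.Ring.AlmostCommutativeRing as ACR
  open import Algebra.Bundles using (RawRing)

  private
    𝔽₂ : RawRing 0ℓ 0ℓ
    𝔽₂ = CommutativeRing.rawRing xor-∧-commutativeRing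

    𝕊 : ACR.AlmostCommutativeRing 0ℓ 0ℓ
    𝕊 = ACR.fromCommutativeRing seriesRing

    constant : Bool → Series
    constant b n = b ∧ 𝟙 n

    constant-· : ∀ a b → constant (a ∧ b) ≈ constant a · constant b
    constant-· true b = pointwise λ n → sym (𝟙-· (constant b) n)
    constant-· false b = pointwise λ n → sym (𝟘-· (constant b) n)

    morphism : 𝔽₂ ACR.-Raw-AlmostCommutative⟶ 𝕊
    morphism = record
      { ⟦_⟧ = constant
      ; +-homo = λ a b → pointwise λ n → ∧-distribʳ-xor (𝟙 n) a b
      ; *-homo = constant-·
      ; -‿homo = λ a → R.refl
      ; 0-homo = R.refl
      ; 1-homo = R.refl
      }

    _≟_ : ∀ a b → Maybe (constant a ≈ constant b)
    true  ≟ true  = just R.refl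
    false ≟ false = just R.refl
    _     ≟ _     = nothing

  open Ring 𝔽₂ 𝕊 morphism _≟_ public using (solve; _:=_; _:+_; _:*_; con)

open Solver

mono-< : ∀ s f {n} → n ℕ.< s → (mono s · f) n ≡ false
mono-< (suc s) f {zero} _ = refl
mono-< (suc s) f {suc n} (ℕ.s≤s l) = mono-< s f l

mono-+ : ∀ s f n → (mono s · f) (s + n) ≡ f n
mono-+ zero f n = trans (·-cong[] {r = suc n} (λ { {zero} _ → refl ; {suc _} _ → refl }) (λ _ → refl) ℕ.≤-refl) (𝟙-· f n)
mono-+ (suc s) f n = mono-+ s f n

mono-0 : mono 0 ≈ 𝟙
mono-0 = pointwise λ { zero → refl ; (suc _) → refl }

mono-· : ∀ a b → mono a · mono b ≈ mono (a + b)
mono-· zero b = R.trans (R.*-congʳ mono-0) (R.*-identityˡ _)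
mono-· (suc a) b = pointwise λ { zero → refl ; (suc n) → coeff (mono-· a b) n }

mono-≡ : ∀ n → mono n n ≡ true
mono-≡ zero = refl
mono-≡ (suc n) = mono-≡ n

mono-≢ : ∀ {m n} → m ≢ n → mono m n ≡ false
mono-≢ {zero} {zero} ne with () ← ne refl
mono-≢ {zero} {suc n} ne = refl
mono-≢ {suc m} {zero} ne = refl
mono-≢ {suc m} {suc n} ne = mono-≢ (λ eq → ne (cong suc eq))

-- Frobenius: the products f i ∧ f j and f j ∧ f i cancel, and only the diagonal survives.
square-even : ∀ f n → (f · f) (n + n) ≡ f n
square-even f zero = ∧-idem (f 0)
square-even f (suc n) rewrite ℕ.+-suc n n | ·-suc (tail f) f (n + n) =
  trans (lemma (f 0 ∧ f (suc (suc (n + n)))) _) (square-even (tail f) n)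
  where lemma : ∀ a b → a xor (a xor b) ≡ b
        lemma = solve-ring Bool-ring

-- The odd part of f, which modulo 2 is the derivation q d/dq.
D : Series → Series
D f n = odd n ∧ f n

D-cong : ∀ {f g} → f ≈ g → D f ≈ D g
D-cong p = pointwise λ n → cong (odd n ∧_) (coeff p n)

D-⊕ : ∀ f g → D (f ⊕ g) ≈ D f ⊕ D g
D-⊕ f g = pointwise λ n → lemma (odd n) (f n) (g n)
  where lemma : ∀ a b c → a ∧ (b xor c) ≡ (a ∧ b) xor (a ∧ c)
        lemma = solve-ring Bool-ring

D-· : ∀ f g → D (f · g) ≈ D f · g ⊕ f · D g
D-· f g = pointwise (go f g)
  where
  not-∧ : ∀ a b → not a ∧ b ≡ b xor (a ∧ b)
  not-∧ true  true  = refl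
  not-∧ true  false = refl
  not-∧ false true  = refl
  not-∧ false false = refl
  go : ∀ f g n → D (f · g) n ≡ (D f · g ⊕ f · D g) n
  go f g zero = sym (∧-zeroʳ (f 0))
  go f g (suc n)
    rewrite not-∧ (odd n) ((f · g) (suc n))
          | coeff (R.*-cong {x = tail (D f)} {y = tail f ⊕ D (tail f)} {u = g}
                     (pointwise λ k → not-∧ (odd k) (f (suc k))) R.refl) n
          | ·-distribʳ g (tail f) (D (tail f)) n
          | not-∧ (odd n) (g (suc n)) =
    trans (lemma₁ (odd n) (f 0) (g (suc n)) ((tail f · g) n))
      (trans (cong (λ z → ((f 0 ∧ g (suc n)) xor (tail f · g) n) xor ((odd n ∧ (f 0 ∧ g (suc n))) xor z))
                   (go (tail f) g n))
             (lemma₂ (f 0) (g (suc n)) (odd n) ((tail f · g) n) ((D (tail f) · g) n) ((tail f · D g) n)))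
    where
    lemma₁ : ∀ o a b c → ((a ∧ b) xor c) xor (o ∧ ((a ∧ b) xor c)) ≡ ((a ∧ b) xor c) xor ((o ∧ (a ∧ b)) xor (o ∧ c))
    lemma₁ = solve-ring Bool-ring
    lemma₂ : ∀ a b o c d e → ((a ∧ b) xor c) xor ((o ∧ (a ∧ b)) xor (d xor e))
             ≡ (c xor d) xor ((a ∧ (b xor (o ∧ b))) xor e)
    lemma₂ = solve-ring Bool-ring

D-square : ∀ s → D (s · s) ≈ 𝟘
D-square s = R.trans (D-· s s) (solve 2 (λ s d → d :* s :+ s :* d := con false) R.refl s (D s))

-- Squares have derivative zero in characteristic 2, so `D` is linear over them.
D-square-· : ∀ s f → D (s · s · f) ≈ s · s · D f
D-square-· s f = R.trans (D-· (s · s) f)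
  (R.trans (R.+-congʳ (R.trans (R.*-congʳ (D-square s)) (R.zeroˡ f))) (R.+-identityˡ _))

module _ (h : Series) (h₀ : h 0 ≡ true) where

  private
    annihilate : ∀ r d → h · d ≈[ r ] 𝟘 → d ≈[ r ] 𝟘
    annihilate r d eq {zero} l = trans (sym (cong (_∧ d 0) h₀)) (eq l)
    annihilate (suc r) d eq {suc n} (ℕ.s≤s l) = annihilate r (tail d) tail-eq l
      where
      d₀ : d 0 ≡ false
      d₀ = annihilate (suc r) d eq {zero} (ℕ.s≤s ℕ.z≤n)
      tail-eq : h · tail d ≈[ r ] 𝟘
      tail-eq {k} k<r = trans (sym (trans (·-suc h d k) (cong (λ b → (b ∧ h (suc k)) xor (h · tail d) k) d₀)))
                              (eq (ℕ.s≤s k<r))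

  -- A series with constant term 1 is not a zero divisor, even modulo q^r: the coefficients of the
  -- difference vanish one after the other. This replaces division, quotients of products being
  -- compared after cross-multiplication.
  cancel[] : ∀ r {f g} → h · f ≈[ r ] h · g → f ≈[ r ] g
  cancel[] r {f} {g} eq {n} l = xor-≡ (annihilate r (f ⊕ g)
    (λ {k} l′ → trans (coeff (R.distribˡ h f g) k)
                      (trans (cong (_xor (h · g) k) (eq l′)) (xor-same ((h · g) k)))) l)
    where
    xor-≡ : ∀ {a b} → a xor b ≡ false → a ≡ b
    xor-≡ {true} {true} _ = refl
    xor-≡ {false} {false} _ = refl

  cancel : ∀ {f g} → h · f ≈ h · g → f ≈ g
  cancel eq = pointwise λ n → cancel[] (suc n) (≈⇒≈[] _ eq) ℕ.≤-refl

-- Series counting the elements of a graded set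

module ≈-Reasoning where
  open import Relation.Binary.Reasoning.Setoid (CommutativeRing.setoid seriesRing) public

module _ {A : Set} where

  finite-⊆ : {P Q : A → Set} → Decidable P → (∀ {x} → P x → Q x) → Finite Q → Finite P
  finite-⊆ P? P⊆Q F = transport (bijection id id proj₂ (λ p → P⊆Q p , p) (λ _ → refl) (λ _ → refl)) (restrict P? F)

  finite-∪ : {P Q : A → Set} → Finite P → Finite Q → (∀ {x} → P x → ¬ Q x) → Finite (λ x → P x ⊎ Q x)
  finite-∪ F G disjoint = record
    { elements = elements F ++ elements G
    ; unique = Unique.++⁺ (unique F) (unique G) (λ (p , q) → disjoint (sound F p) (sound G q))
    ; sound = λ x∈ → [ inj₁ ∘ sound F , inj₂ ∘ sound G ] (∈-++⁻ (elements F) x∈)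
    ; complete = [ ∈-++⁺ˡ ∘ complete F , ∈-++⁺ʳ (elements F) ∘ complete G ]
    }

finite-ℕ : ∀ n → Finite (_≤ n)
finite-ℕ n = record
  { elements = upTo (suc n)
  ; unique = Unique.upTo⁺ (suc n)
  ; sound = λ x∈ → ℕ.≤-pred (∈-upTo⁻ x∈)
  ; complete = λ l → ∈-upTo⁺ (s≤s l)
  }

∣⊖∣≤ : ∀ i n → i < suc (n + n) → ℤ.∣ i ⊖ n ∣ ≤ n
∣⊖∣≤ i n l with ℕ.≤-total n i
... | inj₁ n≤i rewrite ℤ.⊖-≥ n≤i = ℕ.m≤n+o⇒m∸n≤o i n (ℕ.≤-pred l)
... | inj₂ i≤n rewrite ℤ.∣⊖∣-≤ i≤n = ℕ.m∸n≤m n i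

finite-ℤ : ∀ n → Finite (λ k → ℤ.∣ k ∣ ≤ n)
finite-ℤ n = record
  { elements = applyUpTo (_⊖ n) (suc (n + n))
  ; unique = Unique.applyUpTo⁺₁ _ _ (λ {i} {j} i<j _ eq → ℕ.<⇒≢ i<j (⊖-injectiveˡ i j eq))
  ; sound = λ x∈ → let i , i< , eq = ∈-applyUpTo⁻ (_⊖ n) x∈ in
                   subst (λ k → ℤ.∣ k ∣ ≤ n) (sym eq) (∣⊖∣≤ i n i<)
  ; complete = λ {k} l → subst (_∈ _) (index k l) (∈-applyUpTo⁺ (_⊖ n) (bound k l))
  }
  where
  shift : ∀ i → i ⊖ n ℤ.+ + n ≡ + i
  shift i = trans (cong (ℤ._+ + n) (sym (ℤ.m-n≡m⊖n i n)))
    (trans (ℤ.+-assoc (+ i) (ℤ.- (+ n)) (+ n))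
           (trans (cong (λ k → + i ℤ.+ k) (ℤ.+-inverseˡ (+ n))) (ℤ.+-identityʳ (+ i))))
  ⊖-injectiveˡ : ∀ i j → i ⊖ n ≡ j ⊖ n → i ≡ j
  ⊖-injectiveˡ i j eq = ℤ.+-injective (trans (sym (shift i)) (trans (cong (ℤ._+ + n) eq) (shift j)))
  position : ℤ → ℕ
  position (+ k)    = n + k
  position -[1+ k ] = n ℕ.∸ suc k
  bound : ∀ k → ℤ.∣ k ∣ ≤ n → position k < suc (n + n)
  bound (+ k)    l = s≤s (ℕ.+-monoʳ-≤ n l)
  bound -[1+ k ] l = s≤s (ℕ.≤-trans (ℕ.m∸n≤m n (suc k)) (ℕ.m≤m+n n n))
  index : ∀ k → ℤ.∣ k ∣ ≤ n → position k ⊖ n ≡ k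
  index (+ k) l = trans (ℤ.⊖-≥ (ℕ.m≤m+n n k)) (cong +_ (ℕ.m+n∸m≡n n k))
  index -[1+ k ] l = trans (ℤ.⊖-≤ (ℕ.m∸n≤m n (suc k))) (cong (λ j → ℤ.- (+ j)) (ℕ.m∸[m∸n]≡n l))

record Family : Set₁ where
  field
    {Index}  : Set
    Member   : Index → Set
    exponent : Index → ℕ
    finite   : ∀ n → Finite (λ i → Member i × exponent i ≡ n)

open Family

generate : Family → Series
generate 𝓐 n = parity (finite 𝓐 n)

module _ (𝓐 𝓑 : Family) where

  Pair : ℕ → Index 𝓐 × Index 𝓑 → Set
  Pair n (i , j) = (Member 𝓐 i × Member 𝓑 j) × exponent 𝓐 i + exponent 𝓑 j ≡ n

  private
    bounded : ∀ (𝓒 : Family) n → Finite (λ i → Member 𝓒 i × exponent 𝓒 i ≤ n)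
    bounded 𝓒 zero = transport (bijection id id
      (λ (m , eq) → m , ℕ.≤-reflexive eq) (λ (m , l) → m , ℕ.n≤0⇒n≡0 l) (λ _ → refl) (λ _ → refl)) (finite 𝓒 0)
    bounded 𝓒 (suc n) = transport (bijection id id
      [ (λ (m , l) → m , ℕ.m≤n⇒m≤1+n l) , (λ (m , eq) → m , ℕ.≤-reflexive eq) ]
      (λ (m , l) → [ (λ l → inj₁ (m , ℕ.≤-pred l)) , (λ eq → inj₂ (m , eq)) ] (ℕ.m≤n⇒m<n∨m≡n l))
      (λ _ → refl) (λ _ → refl))
      (finite-∪ (bounded 𝓒 n) (finite 𝓒 (suc n)) (λ (_ , l) (_ , eq) → ℕ.<-irrefl refl (subst (_≤ n) eq l)))

  finite-pair : ∀ n → Finite (Pair n)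
  finite-pair n = transport (bijection id id
    (λ { (((m , _) , (m′ , _)) , eq) → (m , m′) , eq })
    (λ { {i , j} ((m , m′) , eq) → ((m , ℕ.≤-trans (ℕ.m≤m+n _ (exponent 𝓑 j)) (ℕ.≤-reflexive eq)) ,
                             (m′ , ℕ.≤-trans (ℕ.m≤n+m _ (exponent 𝓐 i)) (ℕ.≤-reflexive eq))) , eq })
    (λ _ → refl) (λ _ → refl))
    (restrict (λ (i , j) → exponent 𝓐 i + exponent 𝓑 j ℕ.≟ n) (bounded 𝓐 n ⊗ bounded 𝓑 n))

  private
    -- The recursion of `_·_` drops leading coefficients of the left factor; bounding the first
    -- exponent below by c is the counterpart for pairs, and each step splits off the pairs where it
    -- equals c.
    From : ℕ → ℕ → Index 𝓐 × Index 𝓑 → Set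
    From c n (i , j) = (Member 𝓐 i × Member 𝓑 j) × c ≤ exponent 𝓐 i × exponent 𝓐 i + exponent 𝓑 j ≡ c + n

    first : ∀ c n → (From c n ∩ λ (i , j) → exponent 𝓐 i ≡ c) ≅
                    (λ ((i , j) : Index 𝓐 × Index 𝓑) →
                       (Member 𝓐 i × exponent 𝓐 i ≡ c) × (Member 𝓑 j × exponent 𝓑 j ≡ n))
    first c n = bijection id id
      (λ { {i , j} (((m , m′) , _ , eq) , e) → (m , e) ,
           (m′ , ℕ.+-cancelˡ-≡ c _ n (trans (cong (ℕ._+ exponent 𝓑 j) (sym e)) eq)) })
      (λ ((m , e) , (m′ , e′)) → ((m , m′) , ℕ.≤-reflexive (sym e) , cong₂ ℕ._+_ e e′) , e)
      (λ _ → refl) (λ _ → refl)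

    go : ∀ n c (G : Finite (From c n)) → ((λ k → generate 𝓐 (c + k)) · generate 𝓑) n ≡ parity G
    go zero c G = trans (cong (λ k → generate 𝓐 k ∧ generate 𝓑 0) (ℕ.+-identityʳ c))
      (trans (sym (parity-⊗ (finite 𝓐 c) (finite 𝓑 0)))
             (parity-⊆
               (λ ((m , e) , (m′ , e′)) → (m , m′) , ℕ.≤-reflexive (sym e) , cong₂ ℕ._+_ e e′)
               (λ { {i , j} ((m , m′) , l , eq) →
                 let e : exponent 𝓐 i ≡ c
                     e = ℕ.≤-antisym (ℕ.≤-trans (ℕ.m≤m+n _ (exponent 𝓑 j)) (ℕ.≤-reflexive (trans eq (ℕ.+-identityʳ c)))) l
                 in (m , e) , (m′ , ℕ.+-cancelˡ-≡ c _ 0 (trans (cong (ℕ._+ exponent 𝓑 j) (sym e)) eq)) })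
               (finite 𝓐 c ⊗ finite 𝓑 0) G))
    go (suc n) c G = sym (trans (parity-split here? G) (cong₂ _xor_
      (trans (parity-≅ (first c (suc n)) (restrict here? G) (finite 𝓐 c ⊗ finite 𝓑 (suc n)))
        (trans (parity-⊗ (finite 𝓐 c) (finite 𝓑 (suc n)))
               (cong (λ k → generate 𝓐 k ∧ generate 𝓑 (suc n)) (sym (ℕ.+-identityʳ c)))))
      (trans (parity-⊆ proj₁′ proj₁″ (restrict (∁? here?) G) G′)
        (trans (sym (go n (suc c) G′))
          (·-cong[] {g = generate 𝓑} {r = suc n} (λ {k} _ → cong (generate 𝓐) (sym (ℕ.+-suc c k))) (λ _ → refl) ℕ.≤-refl)))))
      where
      here? : Decidable (λ ((i , j) : Index 𝓐 × Index 𝓑) → exponent 𝓐 i ≡ c)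
      here? (i , j) = exponent 𝓐 i ℕ.≟ c
      proj₁′ : ∀ {x} → (From c (suc n) ∩ ∁ λ (i , j) → exponent 𝓐 i ≡ c) x → From (suc c) n x
      proj₁′ ((mm , l , eq) , ne) = mm , ℕ.≤∧≢⇒< l (ne ∘ sym) , trans eq (ℕ.+-suc c n)
      proj₁″ : ∀ {x} → From (suc c) n x → (From c (suc n) ∩ ∁ λ (i , j) → exponent 𝓐 i ≡ c) x
      proj₁″ (mm , l , eq) = (mm , ℕ.<⇒≤ l , trans eq (sym (ℕ.+-suc c n))) , λ e → ℕ.<-irrefl (sym e) l
      G′ : Finite (From (suc c) n)
      G′ = transport (bijection id id proj₁′ proj₁″ (λ _ → refl) (λ _ → refl)) (restrict (∁? here?) G)

  generate-· : ∀ {n} (G : Finite (Pair n)) → (generate 𝓐 · generate 𝓑) n ≡ parity G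
  generate-· {n} G = trans (go n 0 G₀) (parity-⊆ (λ (mm , _ , eq) → mm , eq) (λ (mm , eq) → mm , z≤n , eq) G₀ G)
    where
    G₀ : Finite (From 0 n)
    G₀ = transport (bijection id id (λ (mm , eq) → mm , z≤n , eq) (λ (mm , _ , eq) → mm , eq) (λ _ → refl) (λ _ → refl)) G

-- Theta series and infinite products

tri : ℕ → ℕ
tri zero    = 0
tri (suc k) = tri k + k

-- (a + b) k (k − 1) / 2 + a k
θ-exponent : ℕ → ℕ → ℤ → ℕ
θ-exponent a b (+ k)    = (a + b) * tri k + a * k
θ-exponent a b -[1+ k ] = (a + b) * tri (suc k) + b * suc k

-- Needed twice: it makes the level sets of the exponent finite, and in the triple product it
-- guarantees that a Gaussian coefficient is close enough to its limit wherever its term is visible.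
∣-∣≤θ-exponent : ∀ a b .{{_ : NonZero a}} .{{_ : NonZero b}} k → ℤ.∣ k ∣ ≤ θ-exponent a b k
∣-∣≤θ-exponent a b (+ k)    = ℕ.≤-trans (ℕ.m≤n*m k a) (ℕ.m≤n+m _ _)
∣-∣≤θ-exponent a b -[1+ k ] = ℕ.≤-trans (ℕ.m≤n*m (suc k) b) (ℕ.m≤n+m _ _)

-- Ramanujan's theta function f(q^a, q^b).
θ : ∀ a b .{{_ : NonZero a}} .{{_ : NonZero b}} → Family
θ a b = record
  { Member = λ _ → ⊤
  ; exponent = θ-exponent a b
  ; finite = λ n → finite-⊆ (λ k → map′ (tt ,_) proj₂ (θ-exponent a b k ℕ.≟ n))
      (λ { {k} (_ , refl) → ∣-∣≤θ-exponent a b k }) (finite-ℤ n)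
  }

-- (−q^a ; q^m)_N, with the sign immaterial modulo 2
factors : ℕ → ℕ → ℕ → Series
factors m a zero    = 𝟙
factors m a (suc N) = (𝟙 ⊕ mono a) · factors m (a + m) N

factors-last : ∀ m a N → factors m a (suc N) ≈ factors m a N · (𝟙 ⊕ mono (a + m * N))
factors-last m a zero = R.trans (R.*-comm _ _) (R.*-congˡ (R.+-congˡ {x = 𝟙} (R.reflexive (cong mono eq))))
  where eq : a ≡ a + m * 0
        eq = sym (trans (cong (a ℕ.+_) (ℕ.*-zeroʳ m)) (ℕ.+-identityʳ a))
factors-last m a (suc N) = R.trans (R.*-congˡ (factors-last m (a + m) N))
  (R.trans (R.sym (R.*-assoc _ _ _)) (R.*-congˡ {x = factors m a (suc N)} (R.+-congˡ {x = 𝟙} (R.reflexive (cong mono (eq a m N))))))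
  where eq : ∀ a m N → a + m + m * N ≡ a + m * suc N
        eq = solve-ℕ

-- (−q^a ; q^m)_∞: for a, m ≥ 1 the coefficient of q^n is already that of the first n factors
∏ : ℕ → ℕ → Series
∏ m a n = factors m a n n

module _ (m a : ℕ) .{{_ : NonZero m}} .{{_ : NonZero a}} where

  private
    stable : ∀ k {n N} → n ≤ N → factors m a (k + N) n ≡ factors m a N n
    stable zero _ = refl
    stable (suc k) {n} {N} l = trans (coeff (factors-last m a (k + N)) n)
      (trans (coeff (R.distribˡ f 𝟙 (mono e)) n)
      (trans (cong₂ _xor_ (coeff (R.*-identityʳ f) n)
                          (trans (coeff (R.*-comm f (mono e)) n) (mono-< e f n<e)))
      (trans (xor-identityʳ _) (stable k l))))
      where
      e = a + m * (k + N)
      f = factors m a (k + N)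
      n<e : n < e
      n<e = ℕ.+-mono-≤ {1} (ℕ.>-nonZero⁻¹ a) (ℕ.≤-trans l (ℕ.≤-trans (ℕ.m≤n+m N k) (ℕ.m≤n*m _ m)))

  factors≈∏ : ∀ N → factors m a N ≈[ suc N ] ∏ m a
  factors≈∏ N {n} (s≤s l) = trans (cong (λ M → factors m a M n) (sym (ℕ.m∸n+n≡m l))) (stable (N ℕ.∸ n) ℕ.≤-refl)

-- Jacobi's triple product

mono-·-· : ∀ x y f {z} → x + y ≡ z → mono x · (mono y · f) ≈ mono z · f
mono-·-· x y f refl = R.trans (R.sym (R.*-assoc _ _ _)) (R.*-congʳ (mono-· x y))

antidiagonal : (ℕ → ℕ → Series) → ℕ → Series
antidiagonal F zero    = F 0 0
antidiagonal F (suc M) = F 0 (suc M) ⊕ antidiagonal (λ j → F (suc j)) M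

antidiagonal-cong : ∀ {F G} M → (∀ j l → F j l ≈ G j l) → antidiagonal F M ≈ antidiagonal G M
antidiagonal-cong zero eq = eq 0 0
antidiagonal-cong (suc M) eq = R.+-cong (eq 0 (suc M)) (antidiagonal-cong M (λ j → eq (suc j)))

antidiagonal-scale : ∀ s F M → s · antidiagonal F M ≈ antidiagonal (λ j l → s · F j l) M
antidiagonal-scale s F zero = R.refl
antidiagonal-scale s F (suc M) = R.trans (R.distribˡ s (F 0 (suc M)) (antidiagonal (λ j → F (suc j)) M))
    (R.+-congˡ {s · F 0 (suc M)} (antidiagonal-scale s (λ j → F (suc j)) M))

private
  -- The antidiagonal sum of `B` with its term j = 0 removed.
  rest : (ℕ → ℕ → Series) → ℕ → Series
  rest B zero    = 𝟘
  rest B (suc M) = antidiagonal (λ j → B (suc j)) M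

  rest-antidiagonal : ∀ B M → B 0 M ⊕ rest B M ≈ antidiagonal B M
  rest-antidiagonal B zero    = R.+-identityʳ _
  rest-antidiagonal B (suc M) = R.refl

  antidiagonal-shift : ∀ A B F M → (∀ j → F j 0 ≈ A j 0) → (∀ j l → F j (suc l) ≈ A j (suc l) ⊕ B (suc j) l) →
    antidiagonal F M ≈ antidiagonal A M ⊕ rest B M
  antidiagonal-shift A B F zero e₀ e₁ = R.trans (e₀ 0) (R.sym (R.+-identityʳ _))
  antidiagonal-shift A B F (suc M) e₀ e₁ =
    R.trans (R.+-cong (e₁ 0 M) (antidiagonal-shift (λ j → A (suc j)) (λ j → B (suc j)) (λ j → F (suc j)) M
                                  (λ j → e₀ (suc j)) (λ j → e₁ (suc j))))
    (R.trans (solve 4 (λ a b c d → (a :+ b) :+ (c :+ d) := (a :+ c) :+ (b :+ d)) R.refl (A 0 (suc M)) (B 1 M) (antidiagonal (λ j → A (suc j)) M) (rest (λ j → B (suc j)) M))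
             (R.+-congˡ {antidiagonal A (suc M)} (rest-antidiagonal (λ j → B (suc j)) M)))

-- Pascal's rule in summed form: an entry of the next antidiagonal receives `A` from the neighbour
-- with smaller j and `B` from the neighbour with smaller l, and the two border entries receive one
-- of them only.
antidiagonal-suc : ∀ A B F M → (∀ l → F 0 (suc l) ≈ B 0 l) → (∀ j → F (suc j) 0 ≈ A j 0) →
  (∀ j l → F (suc j) (suc l) ≈ A j (suc l) ⊕ B (suc j) l) →
  antidiagonal F (suc M) ≈ antidiagonal A M ⊕ antidiagonal B M
antidiagonal-suc A B F M e₀ e₁ e₂ =
  R.trans (R.+-cong (e₀ M) (antidiagonal-shift A B (λ j → F (suc j)) M e₁ e₂))
  (R.trans (solve 3 (λ a b c → a :+ (b :+ c) := b :+ (a :+ c)) R.refl (B 0 M) (antidiagonal A M) (rest B M))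
           (R.+-congˡ {antidiagonal A M} (rest-antidiagonal B M)))

-- gauss m j l is the Gaussian binomial coefficient [j + l choose j] in base q^m
gauss : ℕ → ℕ → ℕ → Series
gauss m zero    l       = 𝟙
gauss m (suc j) zero    = 𝟙
gauss m (suc j) (suc l) = gauss m j (suc l) ⊕ mono (m * suc j) · gauss m (suc j) l

module _ (m : ℕ) where

  private
    gauss-0 : ∀ j → gauss m j 0 ≈ 𝟙
    gauss-0 zero    = R.refl
    gauss-0 (suc j) = R.refl

    Q : ℕ → Series
    Q = factors m m

  -- The quotient formula for Gaussian binomials with denominators cleared. The induction turns on
  -- (1 + x) + x (1 + y) = 1 + xy, where x = q^(m(j + 1)) and y = q^(m(l + 1)).
  gauss-factors : ∀ j l → gauss m j l · (Q j · Q l) ≈ Q (j + l)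
  gauss-factors zero l = solve 1 (λ q → con true :* (con true :* q) := q) R.refl _
  gauss-factors (suc j) zero = R.trans (solve 1 (λ q → con true :* (q :* con true) := q) R.refl _)
    (R.reflexive (cong Q (sym (ℕ.+-identityʳ (suc j)))))
  gauss-factors (suc j) (suc l) = begin
    (G₁ ⊕ x · G₂) · (Q (suc j) · Q (suc l))
      ≈⟨ R.*-congˡ (R.*-cong (last j) (last l)) ⟩
    (G₁ ⊕ x · G₂) · (Q j · (𝟙 ⊕ x) · (Q l · (𝟙 ⊕ y)))
      ≈⟨ solve 6 (λ g₁ g₂ x y p q → (g₁ :+ x :* g₂) :* (p :* (con true :+ x) :* (q :* (con true :+ y)))
           := (con true :+ x) :* (g₁ :* (p :* (q :* (con true :+ y)))) :+ x :* (con true :+ y) :* (g₂ :* (p :* (con true :+ x) :* q)))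
           R.refl G₁ G₂ x y (Q j) (Q l) ⟩
    (𝟙 ⊕ x) · (G₁ · (Q j · (Q l · (𝟙 ⊕ y)))) ⊕ x · (𝟙 ⊕ y) · (G₂ · (Q j · (𝟙 ⊕ x) · Q l))
      ≈⟨ R.+-cong (R.*-congˡ (R.*-congˡ (R.*-congˡ (R.sym (last l))))) (R.*-congˡ (R.*-congˡ (R.*-congʳ (R.sym (last j))))) ⟩
    (𝟙 ⊕ x) · (G₁ · (Q j · Q (suc l))) ⊕ x · (𝟙 ⊕ y) · (G₂ · (Q (suc j) · Q l))
      ≈⟨ R.+-cong (R.*-congˡ (R.trans (gauss-factors j (suc l)) (R.reflexive (cong Q (ℕ.+-suc j l))))) (R.*-congˡ (gauss-factors (suc j) l)) ⟩
    (𝟙 ⊕ x) · Q (suc (j + l)) ⊕ x · (𝟙 ⊕ y) · Q (suc (j + l))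
      ≈⟨ solve 3 (λ x y q → (con true :+ x) :* q :+ x :* (con true :+ y) :* q := q :* (con true :+ x :* y)) R.refl x y (Q (suc (j + l))) ⟩
    Q (suc (j + l)) · (𝟙 ⊕ x · y)
      ≈⟨ R.*-congˡ {x = Q (suc (j + l))} (R.+-congˡ {x = 𝟙} (R.trans (mono-· (m * suc j) (m * suc l)) (R.reflexive (cong mono (eq m j l))))) ⟩
    Q (suc (j + l)) · (𝟙 ⊕ mono (m * suc (suc (j + l))))
      ≈⟨ R.sym (last (suc (j + l))) ⟩
    Q (suc (suc (j + l)))
      ≈⟨ R.reflexive (cong Q (sym (ℕ.+-suc (suc j) l))) ⟩
    Q (suc j + suc l) ∎
    where
    open ≈-Reasoning
    G₁ = gauss m j (suc l)
    G₂ = gauss m (suc j) l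
    x = mono (m * suc j)
    y = mono (m * suc l)
    last : ∀ k → Q (suc k) ≈ Q k · (𝟙 ⊕ mono (m * suc k))
    last k = R.trans (factors-last m m k)
      (R.*-congˡ {x = Q k} (R.+-congˡ {x = 𝟙} (R.reflexive (cong mono (sym (ℕ.*-suc m k))))))
    eq : ∀ m j l → m * suc j + m * suc l ≡ m * suc (suc (j + l))
    eq = solve-ℕ

  module _ (c : ℕ) where

    -- The homogeneous product of q^c + q^(a + mi) over i < M. The power q^c takes the place of the
    -- negative powers of q in the usual passage from the q-binomial theorem to the triple product.
    binomials : ℕ → ℕ → Series
    binomials a zero    = 𝟙
    binomials a (suc M) = (mono c ⊕ mono a) · binomials (a + m) M

    term : ℕ → ℕ → ℕ → Series
    term a j l = mono (m * tri j + a * j + c * l) · gauss m j l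

    -- The q-binomial theorem: from the first factor either q^a is chosen, which increases j, or
    -- q^c, which increases l; the remaining factors start at a + m.
    q-binomial : ∀ a M → binomials a M ≈ antidiagonal (term a) M
    q-binomial a zero = R.trans (R.sym (mono-0)) (R.trans (R.reflexive (cong mono (eq m a c))) (R.sym (R.*-identityʳ _)))
      where eq : ∀ m a c → 0 ≡ m * 0 + a * 0 + c * 0
            eq = solve-ℕ
    q-binomial a (suc M) = begin
      (mono c ⊕ mono a) · binomials (a + m) M
        ≈⟨ R.*-congˡ (q-binomial (a + m) M) ⟩
      (mono c ⊕ mono a) · antidiagonal (term (a + m)) M
        ≈⟨ solve 3 (λ c a s → (c :+ a) :* s := a :* s :+ c :* s) R.refl (mono c) (mono a) _ ⟩
      mono a · antidiagonal (term (a + m)) M ⊕ mono c · antidiagonal (term (a + m)) M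
        ≈⟨ R.+-cong (antidiagonal-scale (mono a) _ M) (antidiagonal-scale (mono c) _ M) ⟩
      antidiagonal A M ⊕ antidiagonal B M
        ≈⟨ R.sym (antidiagonal-suc A B (term a) M e₀ e₁ e₂) ⟩
      antidiagonal (term a) (suc M) ∎
      where
      open ≈-Reasoning
      A B : ℕ → ℕ → Series
      A j l = mono a · term (a + m) j l
      B j l = mono c · term (a + m) j l
      e₀ : ∀ l → term a 0 (suc l) ≈ B 0 l
      e₀ l = R.sym (mono-·-· c _ 𝟙 (eq m a c l))
        where eq : ∀ m a c l → c + (m * 0 + (a + m) * 0 + c * l) ≡ m * 0 + a * 0 + c * suc l
              eq = solve-ℕ
      e₁ : ∀ j → term a (suc j) 0 ≈ A j 0
      e₁ j = R.sym (R.trans (mono-·-· a _ (gauss m j 0) (eq m a c (tri j) j)) (R.*-congˡ (gauss-0 j)))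
        where eq : ∀ m a c t j → a + (m * t + (a + m) * j + c * 0) ≡ m * (t + j) + a * suc j + c * 0
              eq = solve-ℕ
      e₂ : ∀ j l → term a (suc j) (suc l) ≈ A j (suc l) ⊕ B (suc j) l
      e₂ j l = R.trans (R.distribˡ (mono (m * tri (suc j) + a * suc j + c * suc l)) (gauss m j (suc l)) (mono (m * suc j) · gauss m (suc j) l)) (R.+-cong
        (R.sym (mono-·-· a _ (gauss m j (suc l)) (eqA m a c (tri j) j l)))
        (R.trans (mono-·-· (m * tri (suc j) + a * suc j + c * suc l) (m * suc j) (gauss m (suc j) l) (eqB m a c (tri (suc j)) j l)) (R.sym (mono-·-· c _ (gauss m (suc j) l) refl))))
        where eqA : ∀ m a c t j l → a + (m * t + (a + m) * j + c * suc l) ≡ m * (t + j) + a * suc j + c * suc l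
              eqA = solve-ℕ
              eqB : ∀ m a c t j l → m * t + a * suc j + c * suc l + m * suc j ≡ c + (m * t + (a + m) * suc j + c * l)
              eqB = solve-ℕ

    binomials-+ : ∀ a M N → binomials a (M + N) ≈ binomials a M · binomials (a + m * M) N
    binomials-+ a zero N = R.trans (R.reflexive (cong (λ a → binomials a N) (eq a m))) (R.sym (R.*-identityˡ _))
      where eq : ∀ a m → a ≡ a + m * 0
            eq = solve-ℕ
    binomials-+ a (suc M) N = R.trans (R.*-congˡ (binomials-+ (a + m) M N))
      (R.trans (R.sym (R.*-assoc _ _ _)) (R.*-congˡ (R.reflexive (cong (λ a → binomials a N) (eq a m M)))))
      where eq : ∀ a m M → a + m + m * M ≡ a + m * suc M
            eq = solve-ℕ

    -- Here q^(a + mi) is the lower power and is taken out of each factor. The hypothesis states c =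
    -- a + b + m(N - 1) without subtraction, so the cofactors 1 + q^(c - a - mi) run backwards
    -- through the product that starts at b.
    binomials-low : ∀ a b N → c + m ≡ a + b + m * N →
      binomials a N ≈ mono (a * N + m * tri N) · factors m b N
    binomials-low a b zero _ = R.sym (R.trans (R.*-identityʳ _) (R.trans (R.reflexive (cong mono (eq a m))) mono-0))
      where eq : ∀ a m → a * 0 + m * 0 ≡ 0
            eq = solve-ℕ
    binomials-low a b (suc N) c+m = begin
      (mono c ⊕ mono a) · binomials (a + m) N
        ≈⟨ R.*-cong (R.+-congʳ {x = mono a} (R.trans (R.reflexive (cong mono c≡)) (R.sym (mono-· a (b + m * N)))))
                    (binomials-low (a + m) b N (trans c+m (eq₂ a b m N))) ⟩
      (mono a · z ⊕ mono a) · (mono e · factors m b N)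
        ≈⟨ solve 4 (λ a z e f → (a :* z :+ a) :* (e :* f) := a :* (e :* (f :* (con true :+ z)))) R.refl (mono a) z (mono e) (factors m b N) ⟩
      mono a · (mono e · (factors m b N · (𝟙 ⊕ z)))
        ≈⟨ mono-·-· a e _ (eq₃ a m N (tri N)) ⟩
      mono (a * suc N + m * tri (suc N)) · (factors m b N · (𝟙 ⊕ z))
        ≈⟨ R.*-congˡ (R.sym (factors-last m b N)) ⟩
      mono (a * suc N + m * tri (suc N)) · factors m b (suc N) ∎
      where
      open ≈-Reasoning
      z = mono (b + m * N)
      e = (a + m) * N + m * tri N
      eq₁ : ∀ a b m N → a + b + m * suc N ≡ a + (b + m * N) + m
      eq₁ = solve-ℕ
      c≡ : c ≡ a + (b + m * N)
      c≡ = ℕ.+-cancelʳ-≡ m c _ (trans c+m (eq₁ a b m N))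
      eq₂ : ∀ a b m N → a + b + m * suc N ≡ a + m + b + m * N
      eq₂ = solve-ℕ
      eq₃ : ∀ a m N t → a + ((a + m) * N + m * t) ≡ a * suc N + m * (t + N)
      eq₃ = solve-ℕ

    binomials-high : ∀ a N → binomials (a + c) N ≈ mono (c * N) · factors m a N
    binomials-high a zero = R.sym (R.trans (R.*-identityʳ _) (R.trans (R.reflexive (cong mono (ℕ.*-zeroʳ c))) mono-0))
    binomials-high a (suc N) = begin
      (mono c ⊕ mono (a + c)) · binomials (a + c + m) N
        ≈⟨ R.*-cong (R.+-congˡ {x = mono c} (R.sym (mono-· a c)))
             (R.trans (R.reflexive (cong (λ a → binomials a N) (eq a c m))) (binomials-high (a + m) N)) ⟩
      (mono c ⊕ mono a · mono c) · (mono (c * N) · factors m (a + m) N)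
        ≈⟨ solve 4 (λ c a e f → (c :+ a :* c) :* (e :* f) := c :* (e :* ((con true :+ a) :* f))) R.refl (mono c) (mono a) (mono (c * N)) (factors m (a + m) N) ⟩
      mono c · (mono (c * N) · factors m a (suc N))
        ≈⟨ mono-·-· c (c * N) _ (sym (ℕ.*-suc c N)) ⟩
      mono (c * suc N) · factors m a (suc N) ∎
      where
      open ≈-Reasoning
      eq : ∀ a c m → a + c + m ≡ a + m + c
      eq = solve-ℕ

xor-upTo : (ℕ → Bool) → ℕ → Bool
xor-upTo p zero    = p 0
xor-upTo p (suc M) = p 0 xor xor-upTo (p ∘ suc) M

odd-filter-upTo : ∀ {A : Set} {P : A → Set} (P? : Decidable P) f M →
  odd (length (filter P? (applyUpTo f (suc M)))) ≡ xor-upTo (λ j → does (P? (f j))) M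
odd-filter-upTo P? f zero with does (P? (f 0))
... | true  = refl
... | false = refl
odd-filter-upTo P? f (suc M) with does (P? (f 0)) | odd-filter-upTo P? (f ∘ suc) M
... | true  | eq = cong not eq
... | false | eq = eq

antidiagonal-coeff : ∀ F p M n → (∀ j l → j + l ≡ M → F j l n ≡ p j) → antidiagonal F M n ≡ xor-upTo p M
antidiagonal-coeff F p zero n eq = eq 0 0 refl
antidiagonal-coeff F p (suc M) n eq = cong₂ _xor_ (eq 0 (suc M) refl)
  (antidiagonal-coeff (λ j → F (suc j)) (p ∘ suc) M n (λ j l e → eq (suc j) l (cong suc e)))

-- If e > n, both sides vanish; otherwise only the coefficient of g in degree n - e is seen. A
-- single hypothesis with truncated subtraction covers both cases.
mono-truncate : ∀ e g {n} → g ≈[ suc (n ℕ.∸ e) ] 𝟙 → (mono e · g) n ≡ (e ≡ᵇ n)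
mono-truncate e g {n} g≈𝟙 with e ℕ.≤? n
... | yes e≤n = trans (cong (mono e · g) (sym (ℕ.m+[n∸m]≡n e≤n)))
      (trans (mono-+ e g (n ℕ.∸ e)) (trans (g≈𝟙 ℕ.≤-refl) (trans (sym (mono-+ e 𝟙 (n ℕ.∸ e)))
        (trans (coeff (R.*-identityʳ (mono e)) _) (cong (mono e) (ℕ.m+[n∸m]≡n e≤n))))))
... | no e≰n = trans (mono-< e g (ℕ.≰⇒> e≰n)) (sym (mono-≢ {e} {n} (λ { refl → e≰n ℕ.≤-refl })))

module _ (a b : ℕ) .{{_ : NonZero a}} .{{_ : NonZero b}} where

  private
    m : ℕ
    m = a + b

    instance
      m≢0 : NonZero m
      m≢0 = ℕ.>-nonZero (ℕ.≤-trans (ℕ.>-nonZero⁻¹ a) (ℕ.m≤m+n a b))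

    Q : Series
    Q = ∏ m m

    -- After one more multiplication by `Q`, the factor Q · Q agrees up to degree r with the two
    -- finite products in `gauss-factors`, whose value again agrees with `Q`; then `Q` is cancelled.
    gauss-limit : ∀ {r} j l → r ≤ j → r ≤ l → Q · gauss m j l ≈[ suc r ] 𝟙
    gauss-limit {r} j l r≤j r≤l = cancel[] Q refl (suc r) λ {n} n<r → begin
      (Q · (Q · gauss m j l)) n
        ≡⟨ coeff (solve 2 (λ q g → q :* (q :* g) := g :* (q :* q)) R.refl Q (gauss m j l)) n ⟩
      (gauss m j l · (Q · Q)) n
        ≡⟨ ·-cong[] {gauss m j l} {gauss m j l} {factors m m j · factors m m l} {Q · Q} {suc r} (λ _ → refl)
             (·-cong[] {factors m m j} {Q} {factors m m l} {Q} {suc r} (near j r≤j) (near l r≤l)) n<r ⟨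
      (gauss m j l · (factors m m j · factors m m l)) n
        ≡⟨ coeff (gauss-factors m j l) n ⟩
      factors m m (j + l) n
        ≡⟨ near (j + l) (ℕ.≤-trans r≤j (ℕ.m≤m+n j l)) n<r ⟩
      Q n
        ≡⟨ coeff (R.*-identityʳ Q) n ⟨
      (Q · 𝟙) n ∎
      where
      open ≡-Reasoning
      near : ∀ i → r ≤ i → factors m m i ≈[ suc r ] Q
      near i r≤i l = factors≈∏ m m i (ℕ.≤-trans l (s≤s r≤i))

    -- The power of q taken out of the 2N factors, which is also the exponent of the middle term j =
    -- l = N.
    offset : ℕ → ℕ
    offset N = m * N * N + (a * N + m * tri N)

    power : ℕ → ℕ → ℕ → ℕ
    power N j l = m * tri j + a * j + m * N * l

    finite-product : ∀ N → mono (offset N) · (factors m b N · factors m a N) ≈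
                           antidiagonal (term m (m * N) a) (N + N)
    finite-product N = begin
      mono (offset N) · (factors m b N · factors m a N)
        ≈⟨ R.*-congʳ (R.sym (mono-· (m * N * N) (a * N + m * tri N))) ⟩
      mono (m * N * N) · mono (a * N + m * tri N) · (factors m b N · factors m a N)
        ≈⟨ solve 4 (λ x y f g → x :* y :* (f :* g) := y :* f :* (x :* g)) R.refl (mono (m * N * N)) (mono (a * N + m * tri N)) (factors m b N) (factors m a N) ⟩
      mono (a * N + m * tri N) · factors m b N · (mono (m * N * N) · factors m a N)
        ≈⟨ R.sym (R.*-cong (binomials-low m (m * N) a b N (eq a b N)) (binomials-high m (m * N) a N)) ⟩
      binomials m (m * N) a N · binomials m (m * N) (a + m * N) N
        ≈⟨ R.sym (binomials-+ m (m * N) a N N) ⟩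
      binomials m (m * N) a (N + N)
        ≈⟨ q-binomial m (m * N) a (N + N) ⟩
      antidiagonal (term m (m * N) a) (N + N) ∎
      where
      open ≈-Reasoning
      eq : ∀ a b N → (a + b) * N + (a + b) ≡ a + b + (a + b) * N
      eq = solve-ℕ

    tri-+ : ∀ x y → tri (x + y) ≡ tri x + tri y + x * y
    tri-+ zero y = sym (ℕ.+-identityʳ _)
    tri-+ (suc x) y rewrite tri-+ x y = eq (tri x) (tri y) x y
      where eq : ∀ s t x y → s + t + x * y + (x + y) ≡ s + x + t + (y + x * y)
            eq = solve-ℕ

    tri-double : ∀ k → tri k + tri k + k ≡ k * k
    tri-double zero = refl
    tri-double (suc k) = trans (eq₁ (tri k) k) (trans (cong (λ z → z + (k + k + 1)) (tri-double k)) (eq₂ k))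
      where eq₁ : ∀ t k → t + k + (t + k) + suc k ≡ t + t + k + (k + k + 1)
            eq₁ = solve-ℕ
            eq₂ : ∀ k → k * k + (k + k + 1) ≡ suc k * suc k
            eq₂ = solve-ℕ

    -- With k = j - N, the witness r is min(j, l) = N - |k|, the degree up to which the Gaussian
    -- coefficient has reached its limit. Since |k| is at most the theta exponent, this reaches
    -- degree N after the shift by that exponent.
    Central : ℕ → ℕ → ℕ → Set
    Central N j l = power N j l ≡ offset N + θ-exponent a b (j ⊖ N)
                  × (∃ λ r → r ≤ j × r ≤ l × N ℕ.∸ θ-exponent a b (j ⊖ N) ≤ r)

    central⁺ : ∀ k l → Central (l + k) (l + k + k) l
    central⁺ k l rewrite ℤ.⊖-≥ (ℕ.m≤m+n (l + k) k) | ℕ.m+n∸m≡n (l + k) k =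
      degree , l , ℕ.≤-trans (ℕ.m≤m+n l k) (ℕ.m≤m+n (l + k) k) , ℕ.≤-refl ,
      ℕ.≤-trans (ℕ.∸-monoʳ-≤ (l + k) (∣-∣≤θ-exponent a b (+ k))) (ℕ.≤-reflexive (ℕ.m+n∸n≡m l k))
      where
      eq : ∀ a m l k t s → m * (t + s + (l + k) * k) + a * (l + k + k) + m * (l + k) * l
         ≡ m * (l + k) * (l + k) + (a * (l + k) + m * t) + (m * s + a * k)
      eq = solve-ℕ
      degree : power (l + k) (l + k + k) l ≡ offset (l + k) + θ-exponent a b (+ k)
      degree rewrite tri-+ (l + k) k = eq a m l k (tri (l + k)) (tri k)

    central⁻ : ∀ k j → Central (j + suc k) j (j + suc k + suc k)
    central⁻ k j rewrite ℤ.⊖-< (ℕ.m<m+n j {suc k} (s≤s z≤n)) | ℕ.m+n∸m≡n j (suc k) =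
      degree , j , ℕ.≤-refl , ℕ.≤-trans (ℕ.m≤m+n j (suc k)) (ℕ.m≤m+n (j + suc k) (suc k)) ,
      ℕ.≤-trans (ℕ.∸-monoʳ-≤ (j + suc k) (∣-∣≤θ-exponent a b -[1+ k ])) (ℕ.≤-reflexive (ℕ.m+n∸n≡m j (suc k)))
      where
      eq₁ : ∀ a b j k t → (a + b) * t + a * j + (a + b) * (j + k) * (j + k + k)
         ≡ (a + b) * (j + k) * (j + k) + (a * j + (a + b) * (t + j * k + k * k))
      eq₁ = solve-ℕ
      eq₂ : ∀ a b j k t s → (a + b) * (j + k) * (j + k) + (a * j + (a + b) * (t + j * k + (s + s + k)))
         ≡ (a + b) * (j + k) * (j + k) + (a * (j + k) + (a + b) * (t + s + j * k)) + ((a + b) * s + b * k)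
      eq₂ = solve-ℕ
      degree : power (j + suc k) j (j + suc k + suc k) ≡ offset (j + suc k) + θ-exponent a b -[1+ k ]
      degree = trans (eq₁ a b j (suc k) (tri j))
        (trans (cong (λ z → m * (j + suc k) * (j + suc k) + (a * j + m * (tri j + j * suc k + z)))
                     (sym (tri-double (suc k))))
        (trans (eq₂ a b j (suc k) (tri j) (tri (suc k)))
               (cong (λ z → m * (j + suc k) * (j + suc k) + (a * (j + suc k) + m * z) + (m * tri (suc k) + b * suc k))
                     (sym (tri-+ j (suc k))))))

    central : ∀ N j l → j + l ≡ N + N → Central N j l
    central N j l eq with ℕ.≤-total N j
    ... | inj₁ N≤j = subst₂ (λ N j → Central N j l) l+k≡N (trans (cong (ℕ._+ k) l+k≡N) N+k≡j) (central⁺ k l)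
      where
      k = j ℕ.∸ N
      N+k≡j : N + k ≡ j
      N+k≡j = ℕ.m+[n∸m]≡n N≤j
      l+k≡N : l + k ≡ N
      l+k≡N = ℕ.+-cancelˡ-≡ N _ _ (trans (lemma N k l) (trans (cong (ℕ._+ l) N+k≡j) eq))
        where lemma : ∀ N k l → N + (l + k) ≡ N + k + l
              lemma = solve-ℕ
    ... | inj₂ j≤N with N ℕ.∸ j | ℕ.m+[n∸m]≡n j≤N
    ...   | zero  | refl = subst (Central (j + 0) j) l≡
              (subst (λ i → Central (j + 0) i j) (trans (ℕ.+-identityʳ _) (ℕ.+-identityʳ j)) (central⁺ 0 j))
      where
      l≡ : j ≡ l
      l≡ = ℕ.+-cancelˡ-≡ j _ _ (trans (lemma j) (sym eq))
        where lemma : ∀ j → j + j ≡ j + 0 + (j + 0)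
              lemma = solve-ℕ
    ...   | suc k | refl = subst (λ l → Central (j + suc k) j l) l≡ (central⁻ k j)
      where
      l≡ : j + suc k + suc k ≡ l
      l≡ = ℕ.+-cancelˡ-≡ j _ _ (trans (lemma j (suc k)) (sym eq))
        where lemma : ∀ j k → j + (j + k + k) ≡ j + k + (j + k)
              lemma = solve-ℕ

  jacobi-triple-product : generate (θ a b) ≈ ∏ m m · (∏ m a · ∏ m b)
  jacobi-triple-product = pointwise λ n → sym (begin
    (Q · (∏ m a · ∏ m b)) n
      ≡⟨ ·-cong[] {Q} {Q} {∏ m a · ∏ m b} {factors m b n · factors m a n} {suc n} (λ _ → refl)
           (λ {i} l → trans (coeff (R.*-comm (∏ m a) (∏ m b)) i)
             (sym (·-cong[] {factors m b n} {∏ m b} {factors m a n} {∏ m a} {suc n} (factors≈∏ m b n) (factors≈∏ m a n) l))) ℕ.≤-refl ⟩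
    -- Degree n is read from the product with n factors of each kind; multiplication by q^offset
    -- clears the negative exponents of the Laurent form.
    (Q · (factors m b n · factors m a n)) n
      ≡⟨ mono-+ (offset n) (Q · (factors m b n · factors m a n)) n ⟨
    (mono (offset n) · (Q · (factors m b n · factors m a n))) (offset n + n)
      ≡⟨ coeff (R.trans (solve 3 (λ x q f → x :* (q :* f) := q :* (x :* f)) R.refl (mono (offset n)) Q (factors m b n · factors m a n))
           (R.trans (R.*-congˡ (finite-product n)) (antidiagonal-scale Q (term m (m * n) a) (n + n)))) (offset n + n) ⟩
    antidiagonal (λ j l → Q · term m (m * n) a j l) (n + n) (offset n + n)
      ≡⟨ antidiagonal-coeff _ (λ j → θ-exponent a b (j ⊖ n) ≡ᵇ n) (n + n) (offset n + n) (coefficient n) ⟩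
    xor-upTo (λ j → θ-exponent a b (j ⊖ n) ≡ᵇ n) (n + n)
      ≡⟨ odd-filter-upTo D? (_⊖ n) (n + n) ⟨
    odd (length (filter D? (applyUpTo (_⊖ n) (suc (n + n)))))
      ≡⟨ cong odd (length-map id (filter D? (applyUpTo (_⊖ n) (suc (n + n))))) ⟨
    generate (θ a b) n ∎)
    where
    open ≡-Reasoning
    D? : ∀ {n} → Decidable (λ k → ⊤ × θ-exponent a b k ≡ n)
    D? {n} k = map′ (tt ,_) proj₂ (θ-exponent a b k ℕ.≟ n)
    coefficient : ∀ n j l → j + l ≡ n + n →
      (Q · term m (m * n) a j l) (offset n + n) ≡ (θ-exponent a b (j ⊖ n) ≡ᵇ n)
    coefficient n j l eq with central n j l eq
    ... | deg , r , r≤j , r≤l , n∸e≤r = trans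
      (coeff (R.trans (solve 3 (λ q x g → q :* (x :* g) := x :* (q :* g)) R.refl Q (mono (power n j l)) (gauss m j l))
        (R.trans (R.*-congʳ (R.reflexive (cong mono deg)))
                 (R.sym (mono-·-· (offset n) e (Q · gauss m j l) refl)))) (offset n + n))
      (trans (mono-+ (offset n) (mono e · (Q · gauss m j l)) n)
             (mono-truncate e (Q · gauss m j l) (λ l → gauss-limit j _ r≤j r≤l (ℕ.≤-trans l (s≤s n∸e≤r)))))
      where e = θ-exponent a b (j ⊖ n)

-- Splitting and squaring infinite products

module _ (m a : ℕ) .{{_ : NonZero m}} .{{_ : NonZero a}} where

  private
    instance
      m+m≢0 : NonZero (m + m)
      m+m≢0 = ℕ.>-nonZero (ℕ.≤-trans (ℕ.>-nonZero⁻¹ m) (ℕ.m≤m+n m m))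
      a+m≢0 : NonZero (a + m)
      a+m≢0 = ℕ.>-nonZero (ℕ.≤-trans (ℕ.>-nonZero⁻¹ a) (ℕ.m≤m+n a m))
      a+a≢0 : NonZero (a + a)
      a+a≢0 = ℕ.>-nonZero (ℕ.≤-trans (ℕ.>-nonZero⁻¹ a) (ℕ.m≤m+n a a))
      3m≢0 : NonZero (m + m + m)
      3m≢0 = ℕ.>-nonZero (ℕ.≤-trans (ℕ.>-nonZero⁻¹ m) (ℕ.m≤n+m m (m + m)))
      a+2m≢0 : NonZero (a + m + m)
      a+2m≢0 = ℕ.>-nonZero (ℕ.≤-trans (ℕ.>-nonZero⁻¹ m) (ℕ.m≤n+m m (a + m)))

  ∏-split₂ : ∏ m a ≈ ∏ (m + m) a · ∏ (m + m) (a + m)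
  ∏-split₂ = pointwise λ n → trans (sym (factors≈∏ m a (n + n) (s≤s (ℕ.m≤m+n n n)))) (trans (coeff (partial a n) n)
    (·-cong[] {factors (m + m) a n} {g = factors (m + m) (a + m) n} {r = suc n}
      (factors≈∏ (m + m) a n) (factors≈∏ (m + m) (a + m) n) ℕ.≤-refl))
    where
    partial : ∀ a N → factors m a (N + N) ≈ factors (m + m) a N · factors (m + m) (a + m) N
    partial a zero = R.sym (R.*-identityʳ _)
    partial a (suc N) rewrite ℕ.+-suc N N = R.trans (R.*-congˡ (R.*-congˡ (partial (a + m + m) N)))
      (R.trans (R.*-congˡ (R.*-congˡ (R.*-cong
        (R.reflexive (cong (λ a → factors (m + m) a N) (ℕ.+-assoc a m m)))
        (R.reflexive (cong (λ a → factors (m + m) a N) (eq a m))))))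
      (solve 4 (λ x y f g → x :* (y :* (f :* g)) := x :* f :* (y :* g)) R.refl
        (𝟙 ⊕ mono a) (𝟙 ⊕ mono (a + m)) (factors (m + m) (a + (m + m)) N) (factors (m + m) (a + m + (m + m)) N)))
      where eq : ∀ a m → a + m + m + m ≡ a + m + (m + m)
            eq = solve-ℕ

  ∏-split₃ : ∏ m a ≈ ∏ (m + m + m) a · (∏ (m + m + m) (a + m) · ∏ (m + m + m) (a + m + m))
  ∏-split₃ = pointwise λ n → trans (sym (factors≈∏ m a (n + n + n) (s≤s (ℕ.m≤n+m n (n + n))))) (trans (coeff (partial a n) n)
    (·-cong[] {factors 3m a n} {g = factors 3m (a + m) n · factors 3m (a + m + m) n} {r = suc n}
      (factors≈∏ 3m a n)
      (·-cong[] {factors 3m (a + m) n} {g = factors 3m (a + m + m) n} {r = suc n}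
        (factors≈∏ 3m (a + m) n) (factors≈∏ 3m (a + m + m) n)) ℕ.≤-refl))
    where
    3m = m + m + m
    partial : ∀ a N → factors m a (N + N + N) ≈ factors 3m a N · (factors 3m (a + m) N · factors 3m (a + m + m) N)
    partial a zero = solve 0 (con true := con true :* (con true :* con true)) R.refl
    partial a (suc N) rewrite ℕ.+-suc (N + suc N) N | ℕ.+-suc N N = R.trans (R.*-congˡ (R.*-congˡ (R.*-congˡ (partial (a + m + m + m) N))))
      (R.trans (R.*-congˡ (R.*-congˡ (R.*-congˡ (R.*-cong
        (R.reflexive (cong (λ a → factors 3m a N) (eq₀ a m)))
        (R.*-cong (R.reflexive (cong (λ a → factors 3m a N) (eq₁ a m)))
                  (R.reflexive (cong (λ a → factors 3m a N) (eq₂ a m))))))))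
      (solve 6 (λ x y z f g h → x :* (y :* (z :* (f :* (g :* h)))) := x :* f :* (y :* g :* (z :* h))) R.refl
        (𝟙 ⊕ mono a) (𝟙 ⊕ mono (a + m)) (𝟙 ⊕ mono (a + m + m))
        (factors 3m (a + 3m) N) (factors 3m (a + m + 3m) N) (factors 3m (a + m + m + 3m) N)))
      where eq₀ : ∀ a m → a + m + m + m ≡ a + (m + m + m)
            eq₀ = solve-ℕ
            eq₁ : ∀ a m → a + m + m + m + m ≡ a + m + (m + m + m)
            eq₁ = solve-ℕ
            eq₂ : ∀ a m → a + m + m + m + m + m ≡ a + m + m + (m + m + m)
            eq₂ = solve-ℕ

  -- Frobenius in each factor: (1 + q^e)² = 1 + q^(2e).
  ∏-square : ∏ (m + m) (a + a) ≈ ∏ m a · ∏ m a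
  ∏-square = pointwise λ n → trans (coeff (partial a n) n)
    (·-cong[] {factors m a n} {g = factors m a n} {r = suc n} (factors≈∏ m a n) (factors≈∏ m a n) ℕ.≤-refl)
    where
    partial : ∀ a N → factors (m + m) (a + a) N ≈ factors m a N · factors m a N
    partial a zero = R.sym (R.*-identityʳ _)
    partial a (suc N) = R.trans
      (R.*-cong (R.+-congˡ {𝟙} (R.sym (mono-· a a)))
        (R.trans (R.reflexive (cong (λ a → factors (m + m) a N) (eq a m))) (partial (a + m) N)))
      (solve 2 (λ x f → (con true :+ x :* x) :* (f :* f) := (con true :+ x) :* f :* ((con true :+ x) :* f)) R.refl
        (mono a) (factors m (a + m) N))
      where eq : ∀ a m → a + a + (m + m) ≡ a + m + (a + m)
            eq = solve-ℕ

-- Theta series with product evaluations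

cube : Series → Series
cube f = f · (f · f)

module _ (r : ℕ) .{{_ : NonZero r}} where

  private
    instance
      2r≢0 : NonZero (r + r)
      2r≢0 = ℕ.>-nonZero (ℕ.≤-trans (ℕ.>-nonZero⁻¹ r) (ℕ.m≤m+n r r))
      3r≢0 : NonZero (r + (r + r))
      3r≢0 = ℕ.>-nonZero (ℕ.≤-trans (ℕ.>-nonZero⁻¹ r) (ℕ.m≤m+n r (r + r)))

    f = ∏ r r

  -- Euler's pentagonal number theorem: the classes r, 2r and 3r modulo 3r exhaust the multiples of
  -- r.
  pentagonal : generate (θ r (r + r)) ≈ f
  pentagonal = R.trans (jacobi-triple-product r (r + r)) (R.trans
    (solve 3 (λ a b c → a :* (b :* c) := b :* (c :* a)) R.refl _ _ _)
    (R.trans (R.reflexive (cong₂ (λ m a → ∏ m r · (∏ m (r + r) · ∏ a a)) (sym (ℕ.+-assoc r r r)) (sym (ℕ.+-assoc r r r))))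
             (R.sym (∏-split₃ r r))))

  -- Gauss's series for triangular numbers is f₂ᵣ²/fᵣ, and f₂ᵣ ≡ fᵣ². The extra factor f² supplies
  -- the f₂ᵣ that completes the odd multiples of r to all multiples.
  triangular : generate (θ r (r + (r + r))) ≈ cube f
  triangular = cancel (f · f) refl (begin
    f · f · generate (θ r (r + (r + r)))
      ≈⟨ R.*-cong (R.sym (∏-square r r)) (jacobi-triple-product r (r + (r + r))) ⟩
    ∏ 2r 2r · (∏ (r + (r + 2r)) (r + (r + 2r)) · (∏ (r + (r + 2r)) r · ∏ (r + (r + 2r)) (r + 2r)))
      ≈⟨ R.*-congˡ (R.reflexive (cong (λ m → ∏ m m · (∏ m r · ∏ m (r + 2r))) (sym (ℕ.+-assoc r r 2r)))) ⟩
    ∏ 2r 2r · (∏ (2r + 2r) (2r + 2r) · (∏ (2r + 2r) r · ∏ (2r + 2r) (r + 2r)))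
      ≈⟨ R.*-congˡ {∏ 2r 2r} (R.*-cong (R.trans (∏-square 2r 2r) (R.*-cong (∏-square r r) (∏-square r r))) (R.sym (∏-split₂ 2r r))) ⟩
    ∏ 2r 2r · (f · f · (f · f) · ∏ 2r r)
      ≈⟨ solve 3 (λ a b f → a :* (f :* f :* (f :* f) :* b) := f :* f :* (f :* f) :* (b :* a)) R.refl (∏ 2r 2r) (∏ 2r r) f ⟩
    f · f · (f · f) · (∏ 2r r · ∏ 2r 2r)
      ≈⟨ R.*-congˡ (R.sym (∏-split₂ r r)) ⟩
    f · f · (f · f) · f
      ≈⟨ solve 1 (λ f → f :* f :* (f :* f) :* f := f :* f :* (f :* (f :* f))) R.refl f ⟩
    f · f · cube f ∎)
    where
    open ≈-Reasoning
    2r = r + r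

-- Modulo 2 this is the generating function f₃³/f₁ of the 3-core partitions.
three-core : generate (θ 1 5) · ∏ 1 1 ≈ cube (∏ 3 3)
three-core = cancel (g · (f · f)) refl (begin
  -- The factor g supplies the product over the exponents 3 modulo 6, missing from 1 and 5, and f ·
  -- f ≡ f₂ the even exponents; together they rebuild f₁.
  g · (f · f) · (generate (θ 1 5) · f)
    ≈⟨ R.*-cong (R.*-cong (∏-split₂ 3 3) (R.sym (∏-square 1 1))) (R.*-congʳ (jacobi-triple-product 1 5)) ⟩
  ∏ 6 3 · ∏ 6 6 · ∏ 2 2 · (∏ 6 6 · (∏ 6 1 · ∏ 6 5) · f)
    ≈⟨ solve 6 (λ a b c d e f → a :* b :* c :* (b :* (d :* e) :* f) := b :* b :* (d :* (a :* e) :* c) :* f) R.refl (∏ 6 3) (∏ 6 6) (∏ 2 2) (∏ 6 1) (∏ 6 5) f ⟩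
  ∏ 6 6 · ∏ 6 6 · (∏ 6 1 · (∏ 6 3 · ∏ 6 5) · ∏ 2 2) · f
    ≈⟨ R.*-congʳ {f} (R.*-cong (R.*-cong (∏-square 3 3) (∏-square 3 3)) (R.trans (R.*-congʳ {∏ 2 2} (R.sym (∏-split₃ 2 1))) (R.sym (∏-split₂ 1 1)))) ⟩
  g · g · (g · g) · f · f
    ≈⟨ solve 2 (λ g f → g :* g :* (g :* g) :* f :* f := g :* (f :* f) :* (g :* (g :* g))) R.refl g f ⟩
  g · (f · f) · cube g ∎)
  where
  open ≈-Reasoning
  f = ∏ 1 1
  g = ∏ 3 3

-- The generating function of 9-regular partitions modulo 2

module _ (ρ : ℕ → ℕ) (k : ℕ) where

  private
    s = suc k

    total : ℕ → ℕ
    total n = sum (map (λ j → ρ (n ∸ j * s)) (upTo (suc (n / s))))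

    odd-sum : ∀ (φ : ℕ → ℕ) f M → odd (sum (map φ (applyUpTo f (suc M)))) ≡ xor-upTo (λ j → odd (φ (f j))) M
    odd-sum φ f zero = trans (odd-+ (φ (f 0)) 0) (xor-identityʳ _)
    odd-sum φ f (suc M) = trans (odd-+ (φ (f 0)) _) (cong (odd (φ (f 0)) xor_) (odd-sum φ (f ∘ suc) M))

    xor-upTo-cong : ∀ {p q} M → (∀ j → p j ≡ q j) → xor-upTo p M ≡ xor-upTo q M
    xor-upTo-cong zero eq = eq 0
    xor-upTo-cong (suc M) eq = cong₂ _xor_ (eq 0) (xor-upTo-cong M (eq ∘ suc))

    total-< : ∀ {n} → n < s → odd (total n) ≡ odd (ρ n)
    total-< {n} n<s rewrite ℕ.m<n⇒m/n≡0 n<s = cong odd (ℕ.+-identityʳ (ρ n))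

    total-+ : ∀ n → odd (total (s + n)) ≡ odd (ρ (s + n)) xor odd (total n)
    total-+ n rewrite ℕ.m/n≡1+[m∸n]/n {s + n} {s} (ℕ.m≤m+n s n) | ℕ.m+n∸m≡n s n =
      trans (odd-sum (λ j → ρ (s + n ∸ j * s)) id (suc (n / s)))
        (cong (odd (ρ (s + n)) xor_) (trans
          (xor-upTo-cong (n / s) (λ j → cong (odd ∘ ρ) (ℕ.[m+n]∸[m+o]≡n∸o s n (j * s))))
          (sym (odd-sum (λ j → ρ (n ∸ j * s)) id (n / s)))))

  -- Summation over the multiplicity of the part s is division by 1 - q^s: the sum for s + n is one
  -- new term followed by the sum for n.
  geometric-sum : (odd ∘ total) · (𝟙 ⊕ mono s) ≈ odd ∘ ρ
  geometric-sum = pointwise λ n → trans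
    (coeff (solve 2 (λ t x → t :* (con true :+ x) := t :+ x :* t) R.refl (odd ∘ total) (mono s)) n) (go n)
    where
    cancel-xor : ∀ x y → (x xor y) xor y ≡ x
    cancel-xor true  true  = refl
    cancel-xor true  false = refl
    cancel-xor false true  = refl
    cancel-xor false false = refl
    go : ∀ n → odd (total n) xor (mono s · (odd ∘ total)) n ≡ odd (ρ n)
    go n with n ℕ.<? s
    ... | yes n<s = trans (cong₂ _xor_ (total-< n<s) (mono-< s (odd ∘ total) n<s)) (xor-identityʳ _)
    ... | no n≮s with n ∸ s | ℕ.m+[n∸m]≡n (ℕ.≮⇒≥ n≮s)
    ...   | n′ | refl = trans (cong₂ _xor_ (total-+ n′) (mono-+ s (odd ∘ total) n′)) (cancel-xor _ _)

module _ where

  private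
    R₉ : ℕ → Series
    R₉ k n = odd (regCount 9 k n)

    -- The factors of f₁ sorted by whether 9 divides the exponent: the partition series inverts
    -- `allowed`, and `banned` grows into f₉.
    allowed banned : ℕ → Series
    allowed zero = 𝟙
    allowed (suc k) = if does (9 ∣? suc k) then allowed k else (𝟙 ⊕ mono (suc k)) · allowed k
    banned zero = 𝟙
    banned (suc k) = if does (9 ∣? suc k) then (𝟙 ⊕ mono (suc k)) · banned k else banned k

    R₉-allowed : ∀ k → R₉ k · allowed k ≈ 𝟙
    R₉-allowed zero = R.trans (R.*-identityʳ _) (pointwise λ { zero → refl ; (suc n) → refl })
    R₉-allowed (suc k) with does (9 ∣? suc k)
    ... | true  = R₉-allowed k
    ... | false = R.trans (R.sym (R.*-assoc _ _ _)) (R.trans (R.*-congʳ (geometric-sum (regCount 9 k) k)) (R₉-allowed k))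

    allowed-banned : ∀ k → allowed k · banned k ≈ factors 1 1 k
    allowed-banned zero = R.*-identityʳ _
    allowed-banned (suc k) = R.trans step (R.trans (R.*-congʳ {𝟙 ⊕ mono (suc k)} (allowed-banned k))
      (R.trans (R.*-congˡ {factors 1 1 k} (R.+-congˡ {𝟙} (R.reflexive (cong (mono ∘ suc) (sym (ℕ.+-identityʳ k))))))
               (R.sym (factors-last 1 1 k))))
      where
      step : allowed (suc k) · banned (suc k) ≈ allowed k · banned k · (𝟙 ⊕ mono (suc k))
      step with does (9 ∣? suc k)
      ... | true  = solve 3 (λ a b x → a :* (x :* b) := a :* b :* x) R.refl (allowed k) (banned k) (𝟙 ⊕ mono (suc k))
      ... | false = solve 3 (λ a b x → x :* a :* b := a :* b :* x) R.refl (allowed k) (banned k) (𝟙 ⊕ mono (suc k))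

    banned-keep : ∀ k → 9 ∣ suc k → banned (suc k) ≡ (𝟙 ⊕ mono (suc k)) · banned k
    banned-keep k d rewrite dec-true (9 ∣? suc k) d = refl

    banned-skip : ∀ i N → ¬ (9 ∣ suc i) → banned (suc i + N * 9) ≡ banned (i + N * 9)
    banned-skip i N ¬d rewrite dec-false (9 ∣? suc (i + N * 9)) (λ d → ¬d (∣m+n∣m⇒∣n
      (subst (9 ∣_) (ℕ.+-comm (suc i) (N * 9)) d) (divides-refl N))) = refl

    banned-∏ : ∀ N → banned (N * 9) ≈ factors 9 9 N
    banned-∏ zero = R.refl
    banned-∏ (suc N) = R.trans (R.reflexive (trans (banned-keep (8 + N * 9) (divides-refl (suc N)))
        (cong ((𝟙 ⊕ mono (9 + N * 9)) ·_)
          (trans (banned-skip 7 N (from-no (9 ∣? 8))) (trans (banned-skip 6 N (from-no (9 ∣? 7)))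
          (trans (banned-skip 5 N (from-no (9 ∣? 6))) (trans (banned-skip 4 N (from-no (9 ∣? 5)))
          (trans (banned-skip 3 N (from-no (9 ∣? 4))) (trans (banned-skip 2 N (from-no (9 ∣? 3)))
          (trans (banned-skip 1 N (from-no (9 ∣? 2))) (banned-skip 0 N (from-no (9 ∣? 1)))))))))))))
      (R.trans (R.*-cong (R.+-congˡ {𝟙} (R.reflexive (cong (λ k → mono (9 + k)) (ℕ.*-comm N 9)))) (banned-∏ N))
      (R.trans (R.*-comm (𝟙 ⊕ mono (9 + 9 * N)) (factors 9 9 N)) (R.sym (factors-last 9 9 N))))

    -- A part larger than n cannot occur in a partition of n, so the bound n in the definition of
    -- `b` may be replaced by any larger one.
    R₉-stable : ∀ i n → R₉ (i + n) n ≡ R₉ n n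
    R₉-stable zero n = refl
    R₉-stable (suc i) n = trans step (R₉-stable i n)
      where
      step : R₉ (suc (i + n)) n ≡ R₉ (i + n) n
      step with does (9 ∣? suc (i + n)) | geometric-sum (regCount 9 (i + n)) (i + n)
      ... | true  | _ = refl
      ... | false | geo = trans (sym (trans (coeff (R.distribˡ _ 𝟙 (mono (suc (i + n)))) n)
            (trans (cong₂ _xor_ (coeff (R.*-identityʳ _) n)
               (trans (coeff (R.*-comm _ (mono (suc (i + n)))) n) (mono-< (suc (i + n)) _ (s≤s (ℕ.m≤n+m n i)))))
               (xor-identityʳ _)))) (coeff geo n)

  b₉ : Series
  b₉ n = odd (b 9 n)

  b₉-product : b₉ · ∏ 1 1 ≈ ∏ 9 9
  -- K is at least n, so nothing is lost up to degree n, and it is a multiple of 9, so `banned K` is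
  -- a full partial product of f₉.
  b₉-product = pointwise λ n → let K = n * 9 in begin
    (b₉ · ∏ 1 1) n
      ≡⟨ ·-cong[] {R₉ K} {b₉} {factors 1 1 K} {∏ 1 1} {suc n}
           (λ {i} i≤n → trans (cong (λ k → R₉ k i) (sym (ℕ.m∸n+n≡m (ℕ.≤-trans (ℕ.≤-pred i≤n) (ℕ.m≤m*n n 9))))) (R₉-stable (K ∸ i) i))
           (λ i≤n → factors≈∏ 1 1 K (ℕ.≤-trans i≤n (s≤s (ℕ.m≤m*n n 9)))) ℕ.≤-refl ⟨
    (R₉ K · factors 1 1 K) n
      ≡⟨ coeff (R.trans (R.*-congˡ (R.sym (allowed-banned K)))
           (R.trans (R.sym (R.*-assoc _ _ _)) (R.trans (R.*-congʳ (R₉-allowed K)) (R.trans (R.*-identityˡ _) (banned-∏ n))))) n ⟩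
    factors 9 9 n n ∎
    where open ≡-Reasoning

-- Sums over residue classes and quadratic exponents

module _ {m : ℕ} where

  divℕ-unique : ∀ {r r′} i i′ → r < m → r′ < m →
    + r ℤ.+ i ℤ.* + m ≡ + r′ ℤ.+ i′ ℤ.* + m → r ≡ r′ × i ≡ i′
  divℕ-unique {r} {r′} i i′ r< r′< eq = r≡ , i≡
    where
    difference : (i ℤ.- i′) ℤ.* + m ≡ r′ ⊖ r
    difference = trans (lemma₁ (+ r) i i′ (+ m)) (trans (cong (ℤ._- (+ r ℤ.+ i′ ℤ.* + m)) eq)
      (trans (lemma₂ (+ r) (+ r′) i′ (+ m)) (ℤ.m-n≡m⊖n r′ r)))
      where
      lemma₁ : ∀ r i i′ m → (i ℤ.- i′) ℤ.* m ≡ r ℤ.+ i ℤ.* m ℤ.- (r ℤ.+ i′ ℤ.* m)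
      lemma₁ = solve-ℤ
      lemma₂ : ∀ r r′ i′ m → r′ ℤ.+ i′ ℤ.* m ℤ.- (r ℤ.+ i′ ℤ.* m) ≡ r′ ℤ.- r
      lemma₂ = solve-ℤ
    small : ℤ.∣ i ℤ.- i′ ∣ * m < 1 * m
    small = ℕ.≤-<-trans (ℕ.≤-reflexive (trans (sym (ℤ.abs-* (i ℤ.- i′) (+ m))) (cong ℤ.∣_∣ difference)))
      (ℕ.≤-<-trans (ℤ.∣m⊝n∣≤m⊔n r′ r) (ℕ.<-≤-trans (ℕ.⊔-lub r′< r<) (ℕ.≤-reflexive (sym (ℕ.*-identityˡ m)))))
    i≡ : i ≡ i′
    i≡ = ℤ.i-j≡0⇒i≡j i i′ (ℤ.∣i∣≡0⇒i≡0 (ℕ.n<1⇒n≡0 (ℕ.*-cancelʳ-< m _ 1 small)))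
    r≡ : r ≡ r′
    r≡ = ℤ.+-injective (∙-cancelʳ (i′ ℤ.* + m) (+ r) (+ r′) (trans (cong (λ i → + r ℤ.+ i ℤ.* + m) (sym i≡)) eq))

module _ (m : ℕ) .{{_ : NonZero m}} {B : Set} (P : ℤ × B → Set) where

  -- The class k ≡ r (mod m) reindexed by the quotient of k; `B` carries the other coordinates
  -- along.
  Residue : ℕ → ℤ × B → Set
  Residue r (i , y) = P (+ r ℤ.+ i ℤ.* + m , y)

  residue≅ : ∀ {r} → r < m → Residue r ≅ (P ∩ λ (k , _) → k %ℕ m ≡ r)
  residue≅ {r} r<m = bijection (λ (i , y) → + r ℤ.+ i ℤ.* + m , y) (λ (k , y) → k /ℕ m , y)
    (λ {(i , y)} p → p , proj₁ (uniqueness i))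
    (λ {(k , y)} (p , k%m≡r) → subst (λ k → P (k , y)) (recompose k k%m≡r) p)
    (λ {(i , y)} _ → cong (_, y) (proj₂ (uniqueness i)))
    (λ {(k , y)} (_ , k%m≡r) → cong (_, y) (sym (recompose k k%m≡r)))
    where
    recompose : ∀ k → k %ℕ m ≡ r → k ≡ + r ℤ.+ (k /ℕ m) ℤ.* + m
    recompose k eq = trans (ℤ.a≡a%ℕn+[a/ℕn]*n k m) (cong (λ r → + r ℤ.+ (k /ℕ m) ℤ.* + m) eq)
    uniqueness : ∀ i → let k = + r ℤ.+ i ℤ.* + m in k %ℕ m ≡ r × k /ℕ m ≡ i
    uniqueness i = let k = + r ℤ.+ i ℤ.* + m in
      divℕ-unique (k /ℕ m) i (ℤ.n%ℕd<d k m) r<m (sym (ℤ.a≡a%ℕn+[a/ℕn]*n k m))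

  residue : Finite P → ∀ {r} → r < m → Finite (Residue r)
  residue F {r} r<m = transport (≅-sym (residue≅ r<m)) (restrict (λ (k , _) → k %ℕ m ℕ.≟ r) F)

module _ {B : Set} {P : ℤ × B → Set} (F : Finite P) where

  parity-mod2 : parity F ≡ parity (residue 2 P F {0} (s≤s z≤n)) xor parity (residue 2 P F {1} (s≤s (s≤s z≤n)))
  parity-mod2 = trans (parity-split r? F) (cong₂ _xor_
    (sym (parity-≅ (residue≅ 2 P (s≤s z≤n)) (residue 2 P F {0} (s≤s z≤n)) (restrict r? F)))
    (trans (parity-⊆ (λ {(k , _)} (p , ≢0) → p , ≢0⇒≡1 ≢0 (ℤ.n%ℕd<d k 2))
                     (λ { (p , eq) → p , λ eq′ → ℕ.0≢1+n (trans (sym eq′) eq) })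
                     (restrict (∁? r?) F) (restrict (λ (k , _) → k %ℕ 2 ℕ.≟ 1) F))
           (sym (parity-≅ (residue≅ 2 P (s≤s (s≤s z≤n))) (residue 2 P F {1} (s≤s (s≤s z≤n))) (restrict (λ (k , _) → k %ℕ 2 ℕ.≟ 1) F)))))
    where
    r? : Decidable (λ ((k , _) : ℤ × B) → k %ℕ 2 ≡ 0)
    r? (k , _) = k %ℕ 2 ℕ.≟ 0
    ≢0⇒≡1 : ∀ {r} → r ≢ 0 → r < 2 → r ≡ 1
    ≢0⇒≡1 {0} ne _ = ⊥-elim (ne refl)
    ≢0⇒≡1 {1} _ _ = refl
    ≢0⇒≡1 {suc (suc _)} _ (s≤s (s≤s ()))

  parity-mod3 : parity F ≡ parity (residue 3 P F {0} (s≤s z≤n))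
    xor (parity (residue 3 P F {1} (s≤s (s≤s z≤n))) xor parity (residue 3 P F {2} (s≤s (s≤s (s≤s z≤n)))))
  parity-mod3 = trans (parity-split (r? 0) F) (cong₂ _xor_
    (sym (parity-≅ (residue≅ 3 P (s≤s z≤n)) (residue 3 P F {0} (s≤s z≤n)) (restrict (r? 0) F)))
    (trans (parity-split (r? 1) (restrict (∁? (r? 0)) F)) (cong₂ _xor_
      (trans (parity-⊆ (λ ((p , _) , eq) → p , eq) (λ (p , eq) → (p , λ eq′ → ℕ.0≢1+n (trans (sym eq′) eq)) , eq)
                       (restrict (r? 1) (restrict (∁? (r? 0)) F)) (restrict (r? 1) F))
             (sym (parity-≅ (residue≅ 3 P (s≤s (s≤s z≤n))) (residue 3 P F {1} (s≤s (s≤s z≤n))) (restrict (r? 1) F))))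
      (trans (parity-⊆ (λ {(k , _)} ((p , ≢0) , ≢1) → p , ≡2 ≢0 ≢1 (ℤ.n%ℕd<d k 3))
                       (λ (p , eq) → (p , λ eq′ → ℕ.0≢1+n (trans (sym eq′) eq)) , λ eq′ → ℕ.0≢1+n (ℕ.suc-injective (trans (sym eq′) eq)))
                       (restrict (∁? (r? 1)) (restrict (∁? (r? 0)) F)) (restrict (r? 2) F))
             (sym (parity-≅ (residue≅ 3 P (s≤s (s≤s (s≤s z≤n)))) (residue 3 P F {2} (s≤s (s≤s (s≤s z≤n)))) (restrict (r? 2) F)))))))
    where
    r? : ∀ r → Decidable (λ ((k , _) : ℤ × B) → k %ℕ 3 ≡ r)
    r? r (k , _) = k %ℕ 3 ℕ.≟ r
    ≡2 : ∀ {r} → r ≢ 0 → r ≢ 1 → r < 3 → r ≡ 2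
    ≡2 {0} ne _ _ = ⊥-elim (ne refl)
    ≡2 {1} _ ne _ = ⊥-elim (ne refl)
    ≡2 {2} _ _ _ = refl
    ≡2 {suc (suc (suc _))} _ _ (s≤s (s≤s (s≤s ())))

tri-quadratic : ∀ k → + 2 ℤ.* + tri k ≡ + k ℤ.* + k ℤ.- + k
tri-quadratic zero = refl
tri-quadratic (suc k) = trans (cong (+ 2 ℤ.*_) (ℤ.pos-+ (tri k) k))
  (trans (ℤ.*-distribˡ-+ (+ 2) (+ tri k) (+ k)) (trans (cong (ℤ._+ + 2 ℤ.* + k) (tri-quadratic k)) (eq (+ k))))
  where eq : ∀ k → k ℤ.* k ℤ.- k ℤ.+ + 2 ℤ.* k ≡ (+ 1 ℤ.+ k) ℤ.* (+ 1 ℤ.+ k) ℤ.- (+ 1 ℤ.+ k)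
        eq = solve-ℤ

θ-quadratic : ∀ a b k → + 2 ℤ.* + θ-exponent a b k ≡ (+ a ℤ.+ + b) ℤ.* (k ℤ.* k) ℤ.+ (+ a ℤ.- + b) ℤ.* k
θ-quadratic a b (+ k) = trans (cong (+ 2 ℤ.*_) (trans (ℤ.pos-+ _ (a * k)) (cong₂ ℤ._+_ (ℤ.pos-* (a + b) (tri k)) (ℤ.pos-* a k))))
  (trans (eq₁ (+ (a + b)) (+ tri k) (+ a) (+ k)) (trans (cong (λ t → + (a + b) ℤ.* t ℤ.+ + 2 ℤ.* (+ a ℤ.* + k)) (tri-quadratic k))
    (trans (cong (λ m → m ℤ.* (+ k ℤ.* + k ℤ.- + k) ℤ.+ + 2 ℤ.* (+ a ℤ.* + k)) (ℤ.pos-+ a b)) (eq₂ (+ a) (+ b) (+ k)))))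
  where
  eq₁ : ∀ m t a k → + 2 ℤ.* (m ℤ.* t ℤ.+ a ℤ.* k) ≡ m ℤ.* (+ 2 ℤ.* t) ℤ.+ + 2 ℤ.* (a ℤ.* k)
  eq₁ = solve-ℤ
  eq₂ : ∀ a b k → (a ℤ.+ b) ℤ.* (k ℤ.* k ℤ.- k) ℤ.+ + 2 ℤ.* (a ℤ.* k) ≡ (a ℤ.+ b) ℤ.* (k ℤ.* k) ℤ.+ (a ℤ.- b) ℤ.* k
  eq₂ = solve-ℤ
θ-quadratic a b -[1+ k ] = trans (cong (+ 2 ℤ.*_) (trans (ℤ.pos-+ _ (b * suc k)) (cong₂ ℤ._+_ (ℤ.pos-* (a + b) (tri (suc k))) (ℤ.pos-* b (suc k)))))
  (trans (eq₁ (+ (a + b)) (+ tri (suc k)) (+ b) (+ suc k)) (trans (cong (λ t → + (a + b) ℤ.* t ℤ.+ + 2 ℤ.* (+ b ℤ.* + suc k)) (tri-quadratic (suc k)))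
    (trans (cong (λ m → m ℤ.* (+ suc k ℤ.* + suc k ℤ.- + suc k) ℤ.+ + 2 ℤ.* (+ b ℤ.* + suc k)) (ℤ.pos-+ a b)) (eq₂ (+ a) (+ b) (+ suc k)))))
  where
  eq₁ : ∀ m t a k → + 2 ℤ.* (m ℤ.* t ℤ.+ a ℤ.* k) ≡ m ℤ.* (+ 2 ℤ.* t) ℤ.+ + 2 ℤ.* (a ℤ.* k)
  eq₁ = solve-ℤ
  eq₂ : ∀ a b k → (a ℤ.+ b) ℤ.* (k ℤ.* k ℤ.- k) ℤ.+ + 2 ℤ.* (b ℤ.* k) ≡ (a ℤ.+ b) ℤ.* ((ℤ.- k) ℤ.* (ℤ.- k)) ℤ.+ (a ℤ.- b) ℤ.* (ℤ.- k)
  eq₂ = solve-ℤ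

halve : ∀ {x y} → + 2 ℤ.* x ≡ + 2 ℤ.* y → x ≡ y
halve {x} {y} = ℤ.*-cancelˡ-≡ (+ 2) x y

mono-generate : ∀ s 𝓐 {n} (G : Finite (λ i → Member 𝓐 i × s + exponent 𝓐 i ≡ n)) →
                (mono s · generate 𝓐) n ≡ parity G
mono-generate s 𝓐 {n} G with n ℕ.<? s
... | yes n<s = trans (mono-< s (generate 𝓐) n<s) (sym (parity-∅ G (λ i (_ , eq) →
      ℕ.<⇒≱ n<s (ℕ.≤-trans (ℕ.m≤m+n s _) (ℕ.≤-reflexive eq)))))
... | no n≮s with n ℕ.∸ s | ℕ.m+[n∸m]≡n (ℕ.≮⇒≥ n≮s)
...   | n′ | refl = trans (mono-+ s (generate 𝓐) n′) (parity-⊆ (λ (p , eq) → p , cong (s ℕ.+_) eq)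
          (λ (p , eq) → p , ℕ.+-cancelˡ-≡ s _ n′ eq) (finite 𝓐 n′) G)

θ-triangular : ∀ r k → + θ-exponent r (r + (r + r)) k ≡ + r ℤ.* (+ 2 ℤ.* (k ℤ.* k) ℤ.- k)
θ-triangular r k = halve (trans (θ-quadratic r (r + (r + r)) k)
  (trans (cong (λ z → (+ r ℤ.+ z) ℤ.* (k ℤ.* k) ℤ.+ (+ r ℤ.- z) ℤ.* k) 3r) (eq (+ r) k)))
  where
  3r : + (r + (r + r)) ≡ + r ℤ.+ (+ r ℤ.+ + r)
  3r = trans (ℤ.pos-+ r (r + r)) (cong (λ z → + r ℤ.+ z) (ℤ.pos-+ r r))
  eq : ∀ r k → (r ℤ.+ (r ℤ.+ (r ℤ.+ r))) ℤ.* (k ℤ.* k) ℤ.+ (r ℤ.- (r ℤ.+ (r ℤ.+ r))) ℤ.* k ≡ + 2 ℤ.* (r ℤ.* (+ 2 ℤ.* (k ℤ.* k) ℤ.- k))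
  eq = solve-ℤ

θ-pentagonal : ∀ r k → + 2 ℤ.* + θ-exponent r (r + r) k ≡ + r ℤ.* (+ 3 ℤ.* (k ℤ.* k) ℤ.- k)
θ-pentagonal r k = trans (θ-quadratic r (r + r) k)
  (trans (cong (λ z → (+ r ℤ.+ z) ℤ.* (k ℤ.* k) ℤ.+ (+ r ℤ.- z) ℤ.* k) (ℤ.pos-+ r r)) (eq (+ r) k))
  where
  eq : ∀ r k → (r ℤ.+ (r ℤ.+ r)) ℤ.* (k ℤ.* k) ℤ.+ (r ℤ.- (r ℤ.+ r)) ℤ.* k ≡ r ℤ.* (+ 3 ℤ.* (k ℤ.* k) ℤ.- k)
  eq = solve-ℤ

≡-via-+ : ∀ {x y p q} → + x ≡ p → + y ≡ q → p ≡ q → x ≡ y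
≡-via-+ x≡ y≡ p≡q = ℤ.+-injective (trans x≡ (trans p≡q (sym y≡)))

-- Triangular numbers k(2k − 1) by the residue of k modulo 3.
triangular-dissection : generate (θ 1 3) ≈ generate (θ 3 6) ⊕ mono 1 · generate (θ 9 27)
triangular-dissection = pointwise λ n → trans (parity-≅ attach (finite (θ 1 3) n) (U n)) (trans (parity-mod3 (U n))
  (trans (cong₂ _xor_
     (parity-⊆ (λ {(i , _)} p → trans (sym (E₀ i)) p) (λ {(i , _)} p → trans (E₀ i) p) (residue 3 _ (U n) {0} (s≤s z≤n)) (residue 2 _ (V n) {0} (s≤s z≤n)))
     (cong₂ _xor_
       (trans (parity-≅ (negation n) (residue 3 _ (U n) {1} (s≤s (s≤s z≤n))) (W n)) (sym (mono-generate 1 (θ 9 27) (W n))))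
       (parity-≅ (reflection n) (residue 3 _ (U n) {2} (s≤s (s≤s (s≤s z≤n)))) (residue 2 _ (V n) {1} (s≤s (s≤s z≤n))))))
  (trans (rearrange (parity (residue 2 _ (V n) {0} (s≤s z≤n))) ((mono 1 · generate (θ 9 27)) n) _)
  (cong (_xor (mono 1 · generate (θ 9 27)) n) (trans (sym (parity-mod2 (V n))) (sym (parity-≅ attach (finite (θ 3 6) n) (V n))))))))
  where
  rearrange : ∀ a b c → a xor (b xor c) ≡ (a xor c) xor b
  rearrange true  true  true  = refl
  rearrange true  true  false = refl
  rearrange true  false c = xor-comm false _
  rearrange false b c = xor-comm b c
  Level : ℕ → ℕ → ℕ → ℤ × ⊤ → Set
  Level a b n (k , _) = θ-exponent a b k ≡ n
  attach : ∀ {a b n} → (λ k → ⊤ × θ-exponent a b k ≡ n) ≅ Level a b n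
  attach = bijection (_, tt) proj₁ proj₂ (tt ,_) (λ _ → refl) (λ _ → refl)
  U : ∀ n → Finite (Level 1 3 n)
  U n = transport attach (finite (θ 1 3) n)
  V : ∀ n → Finite (Level 3 6 n)
  V n = transport attach (finite (θ 3 6) n)
  -- k = 3i gives three times the pentagonal number of index 2i, and k = 3i + 2 that of index -2i -
  -- 1 (`E₂`), so these two classes fill `θ 3 6`. The class k = 3i + 1 gives 1 plus nine times a
  -- triangular number (`E₁`).
  E₀ : ∀ i → θ-exponent 1 3 (+ 0 ℤ.+ i ℤ.* + 3) ≡ θ-exponent 3 6 (+ 0 ℤ.+ i ℤ.* + 2)
  E₀ i = ℤ.+-injective (halve (trans (cong (+ 2 ℤ.*_) (θ-triangular 1 (+ 0 ℤ.+ i ℤ.* + 3)))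
    (trans (eq i) (sym (θ-pentagonal 3 (+ 0 ℤ.+ i ℤ.* + 2))))))
    where
    eq : ∀ i → + 2 ℤ.* (+ 1 ℤ.* (+ 2 ℤ.* ((+ 0 ℤ.+ i ℤ.* + 3) ℤ.* (+ 0 ℤ.+ i ℤ.* + 3)) ℤ.- (+ 0 ℤ.+ i ℤ.* + 3)))
       ≡ + 3 ℤ.* (+ 3 ℤ.* ((+ 0 ℤ.+ i ℤ.* + 2) ℤ.* (+ 0 ℤ.+ i ℤ.* + 2)) ℤ.- (+ 0 ℤ.+ i ℤ.* + 2))
    eq = solve-ℤ
  E₁ : ∀ i → θ-exponent 1 3 (+ 1 ℤ.+ i ℤ.* + 3) ≡ 1 + θ-exponent 9 27 (ℤ.- i)
  E₁ i = ≡-via-+ (θ-triangular 1 (+ 1 ℤ.+ i ℤ.* + 3)) (cong (λ z → + 1 ℤ.+ z) (θ-triangular 9 (ℤ.- i))) (eq i)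
    where
    eq : ∀ i → + 1 ℤ.* (+ 2 ℤ.* ((+ 1 ℤ.+ i ℤ.* + 3) ℤ.* (+ 1 ℤ.+ i ℤ.* + 3)) ℤ.- (+ 1 ℤ.+ i ℤ.* + 3))
       ≡ + 1 ℤ.+ + 9 ℤ.* (+ 2 ℤ.* ((ℤ.- i) ℤ.* (ℤ.- i)) ℤ.- (ℤ.- i))
    eq = solve-ℤ
  reflect : ℤ → ℤ
  reflect i = -[1+ 0 ] ℤ.- i
  reflect² : ∀ i → -[1+ 0 ] ℤ.- (-[1+ 0 ] ℤ.- i) ≡ i
  reflect² = solve-ℤ
  E₂ : ∀ i → θ-exponent 1 3 (+ 2 ℤ.+ i ℤ.* + 3) ≡ θ-exponent 3 6 (+ 1 ℤ.+ reflect i ℤ.* + 2)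
  E₂ i = ℤ.+-injective (halve (trans (cong (+ 2 ℤ.*_) (θ-triangular 1 (+ 2 ℤ.+ i ℤ.* + 3)))
    (trans (eq i) (sym (θ-pentagonal 3 (+ 1 ℤ.+ reflect i ℤ.* + 2))))))
    where
    eq : ∀ i → + 2 ℤ.* (+ 1 ℤ.* (+ 2 ℤ.* ((+ 2 ℤ.+ i ℤ.* + 3) ℤ.* (+ 2 ℤ.+ i ℤ.* + 3)) ℤ.- (+ 2 ℤ.+ i ℤ.* + 3)))
       ≡ + 3 ℤ.* (+ 3 ℤ.* ((+ 1 ℤ.+ (-[1+ 0 ] ℤ.- i) ℤ.* + 2) ℤ.* (+ 1 ℤ.+ (-[1+ 0 ] ℤ.- i) ℤ.* + 2)) ℤ.- (+ 1 ℤ.+ (-[1+ 0 ] ℤ.- i) ℤ.* + 2))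
    eq = solve-ℤ
  reflection : ∀ n → Residue 3 (Level 1 3 n) 2 ≅ Residue 2 (Level 3 6 n) 1
  reflection n = bijection (λ (i , t) → reflect i , t) (λ (i , t) → reflect i , t)
    (λ {(i , _)} p → trans (sym (E₂ i)) p)
    (λ {(i , _)} p → trans (E₂ (reflect i)) (trans (cong (λ i → θ-exponent 3 6 (+ 1 ℤ.+ i ℤ.* + 2)) (reflect² i)) p))
    (λ {(i , _)} _ → cong (_, tt) (reflect² i)) (λ {(i , _)} _ → cong (_, tt) (reflect² i))
  negation : ∀ n → Residue 3 (Level 1 3 n) 1 ≅ (λ i → ⊤ × 1 + θ-exponent 9 27 i ≡ n)
  negation n = bijection (λ (i , _) → ℤ.- i) (λ i → ℤ.- i , tt)
    (λ {(i , _)} p → tt , trans (sym (E₁ i)) p)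
    (λ {i} (_ , p) → trans (E₁ (ℤ.- i)) (trans (cong (λ i → 1 + θ-exponent 9 27 i) (ℤ.neg-involutive i)) p))
    (λ {(i , _)} _ → cong (_, tt) (ℤ.neg-involutive i)) (λ {i} _ → ℤ.neg-involutive i)
  W : ∀ n → Finite (λ i → ⊤ × 1 + θ-exponent 9 27 i ≡ n)
  W n = transport (negation n) (residue 3 _ (U n) {1} (s≤s (s≤s z≤n)))

-- On the sublattice X ≡ Y (mod 2) the form X² + 3Y² has extra reflections; they pair off all terms
-- except those on their axes.
triangular-product : generate (θ 3 9) · generate (θ 9 27) ≈ generate (θ 12 36) ⊕ mono 3 · generate (θ 36 108)
triangular-product = pointwise λ n → trans (generate-· (θ 3 9) (θ 9 27) (finite-pair (θ 3 9) (θ 9 27) n))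
  (trans (parity-≅ (shear n) (finite-pair (θ 3 9) (θ 9 27) n) (F n)) (trans (parity-mod2 (F n)) (cong₂ _xor_
    (trans (parity-involution (F₀ n) (I₀ n))
      (parity-≅ (fixed₀ n) (restrict _ (F₀ n)) (finite (θ 12 36) n)))
    (trans (parity-involution (F₁ n) (I₁ n))
      (trans (parity-≅ (fixed₁ n) (restrict _ (F₁ n)) (G n)) (sym (mono-generate 3 (θ 36 108) (G n))))))))
  where
  energy : ℤ → ℤ → ℕ
  energy k l = θ-exponent 3 9 k + θ-exponent 9 27 l
  quadratic : ℤ → ℤ → ℤ
  quadratic k l = + 3 ℤ.* (+ 2 ℤ.* (k ℤ.* k) ℤ.- k) ℤ.+ + 9 ℤ.* (+ 2 ℤ.* (l ℤ.* l) ℤ.- l)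
  energy≡ : ∀ k l → + energy k l ≡ quadratic k l
  energy≡ k l = trans (ℤ.pos-+ (θ-exponent 3 9 k) _) (cong₂ ℤ._+_ (θ-triangular 3 k) (θ-triangular 9 l))
  transfer : ∀ k l k′ l′ → quadratic k l ≡ quadratic k′ l′ → energy k l ≡ energy k′ l′
  transfer k l k′ l′ = ≡-via-+ (energy≡ k l) (energy≡ k′ l′)
  Level : ℕ → ℤ × ℤ → Set
  Level n (c , l) = energy (c ℤ.+ l) l ≡ n
  cancel₁ : ∀ k l → k ℤ.- l ℤ.+ l ≡ k
  cancel₁ = solve-ℤ
  cancel₂ : ∀ k l → k ℤ.+ l ℤ.- l ≡ k
  cancel₂ = solve-ℤ
  shear : ∀ n → Pair (θ 3 9) (θ 9 27) n ≅ Level n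
  shear n = bijection (λ (k , l) → k ℤ.- l , l) (λ (c , l) → c ℤ.+ l , l)
    (λ {(k , l)} (_ , p) → trans (cong (λ k → energy k l) (cancel₁ k l)) p) (λ p → (tt , tt) , p)
    (λ {(k , l)} _ → cong (_, l) (cancel₁ k l)) (λ {(c , l)} _ → cong (_, l) (cancel₂ c l))
  F : ∀ n → Finite (Level n)
  F n = transport (shear n) (finite-pair (θ 3 9) (θ 9 27) n)
  F₀ : ∀ n → Finite (Residue 2 (Level n) 0)
  F₀ n = residue 2 _ (F n) (s≤s z≤n)
  F₁ : ∀ n → Finite (Residue 2 (Level n) 1)
  F₁ n = residue 2 _ (F n) (s≤s (s≤s z≤n))
  -- Put k = c + l, X = 4k - 1 and Y = 4l - 1; the exponent is 3(X² + 3Y² - 4)/8. For c even, the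
  -- map is (X, Y) ↦ ((3Y - X)/2, (X + Y)/2), with axis X = Y.
  I₀ : ∀ n → Involution (Residue 2 (Level n) 0)
  I₀ n = involution (λ (j , l) → ℤ.- j , l ℤ.+ j) proj₁
    (λ {(j , l)} p → trans (transfer (+ 0 ℤ.+ (ℤ.- j) ℤ.* + 2 ℤ.+ (l ℤ.+ j)) (l ℤ.+ j) (+ 0 ℤ.+ j ℤ.* + 2 ℤ.+ l) l (eq j l)) p)
    (λ {(j , l)} _ → cong₂ _,_ (ℤ.neg-involutive j) (cancel₂ l j)) (λ _ → refl)
    where
    eq : ∀ j l → quadratic (+ 0 ℤ.+ (ℤ.- j) ℤ.* + 2 ℤ.+ (l ℤ.+ j)) (l ℤ.+ j) ≡ quadratic (+ 0 ℤ.+ j ℤ.* + 2 ℤ.+ l) l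
    eq = expanded
      where
      expanded : ∀ j l → + 3 ℤ.* (+ 2 ℤ.* ((+ 0 ℤ.+ (ℤ.- j) ℤ.* + 2 ℤ.+ (l ℤ.+ j)) ℤ.* (+ 0 ℤ.+ (ℤ.- j) ℤ.* + 2 ℤ.+ (l ℤ.+ j))) ℤ.- (+ 0 ℤ.+ (ℤ.- j) ℤ.* + 2 ℤ.+ (l ℤ.+ j)))
          ℤ.+ + 9 ℤ.* (+ 2 ℤ.* ((l ℤ.+ j) ℤ.* (l ℤ.+ j)) ℤ.- (l ℤ.+ j))
        ≡ + 3 ℤ.* (+ 2 ℤ.* ((+ 0 ℤ.+ j ℤ.* + 2 ℤ.+ l) ℤ.* (+ 0 ℤ.+ j ℤ.* + 2 ℤ.+ l)) ℤ.- (+ 0 ℤ.+ j ℤ.* + 2 ℤ.+ l))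
          ℤ.+ + 9 ℤ.* (+ 2 ℤ.* (l ℤ.* l) ℤ.- l)
      expanded = solve-ℤ
  fixed₀ : ∀ n → (Residue 2 (Level n) 0 ∩ λ (j , _) → j ≡ 0ℤ) ≅ (λ l → ⊤ × θ-exponent 12 36 l ≡ n)
  fixed₀ n = bijection proj₂ (0ℤ ,_)
    (λ { {(j , l)} (p , refl) → tt , trans (sym (eq l)) p }) (λ {l} (_ , p) → trans (eq l) p , refl)
    (λ { (_ , refl) → refl }) (λ _ → refl)
    where
    eq : ∀ l → energy (+ 0 ℤ.+ 0ℤ ℤ.* + 2 ℤ.+ l) l ≡ θ-exponent 12 36 l
    eq l = ≡-via-+ (energy≡ (+ 0 ℤ.+ 0ℤ ℤ.* + 2 ℤ.+ l) l) (θ-triangular 12 l) (expanded l)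
      where
      expanded : ∀ l → + 3 ℤ.* (+ 2 ℤ.* ((+ 0 ℤ.+ 0ℤ ℤ.* + 2 ℤ.+ l) ℤ.* (+ 0 ℤ.+ 0ℤ ℤ.* + 2 ℤ.+ l)) ℤ.- (+ 0 ℤ.+ 0ℤ ℤ.* + 2 ℤ.+ l))
          ℤ.+ + 9 ℤ.* (+ 2 ℤ.* (l ℤ.* l) ℤ.- l) ≡ + 12 ℤ.* (+ 2 ℤ.* (l ℤ.* l) ℤ.- l)
      expanded = solve-ℤ
  -- For c odd, the same reflection followed by -1, the sign that keeps X and Y congruent to -1
  -- modulo 4; the axis is X = -3Y.
  I₁ : ∀ n → Involution (Residue 2 (Level n) 1)
  I₁ n = involution (λ (j , l) → j , ℤ.- l ℤ.- j) (λ (j , l) → j ℤ.+ + 2 ℤ.* l)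
    (λ {(j , l)} p → trans (transfer (+ 1 ℤ.+ j ℤ.* + 2 ℤ.+ (ℤ.- l ℤ.- j)) (ℤ.- l ℤ.- j) (+ 1 ℤ.+ j ℤ.* + 2 ℤ.+ l) l (eq j l)) p)
    (λ {(j , l)} _ → cong (j ,_) (back l j)) (λ (j , l) → negate j l)
    where
    back : ∀ l j → ℤ.- (ℤ.- l ℤ.- j) ℤ.- j ≡ l
    back = solve-ℤ
    negate : ∀ j l → j ℤ.+ + 2 ℤ.* (ℤ.- l ℤ.- j) ≡ ℤ.- (j ℤ.+ + 2 ℤ.* l)
    negate = solve-ℤ
    eq : ∀ j l → quadratic (+ 1 ℤ.+ j ℤ.* + 2 ℤ.+ (ℤ.- l ℤ.- j)) (ℤ.- l ℤ.- j) ≡ quadratic (+ 1 ℤ.+ j ℤ.* + 2 ℤ.+ l) l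
    eq = expanded
      where
      expanded : ∀ j l → + 3 ℤ.* (+ 2 ℤ.* ((+ 1 ℤ.+ j ℤ.* + 2 ℤ.+ (ℤ.- l ℤ.- j)) ℤ.* (+ 1 ℤ.+ j ℤ.* + 2 ℤ.+ (ℤ.- l ℤ.- j))) ℤ.- (+ 1 ℤ.+ j ℤ.* + 2 ℤ.+ (ℤ.- l ℤ.- j)))
          ℤ.+ + 9 ℤ.* (+ 2 ℤ.* ((ℤ.- l ℤ.- j) ℤ.* (ℤ.- l ℤ.- j)) ℤ.- (ℤ.- l ℤ.- j))
        ≡ + 3 ℤ.* (+ 2 ℤ.* ((+ 1 ℤ.+ j ℤ.* + 2 ℤ.+ l) ℤ.* (+ 1 ℤ.+ j ℤ.* + 2 ℤ.+ l)) ℤ.- (+ 1 ℤ.+ j ℤ.* + 2 ℤ.+ l))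
          ℤ.+ + 9 ℤ.* (+ 2 ℤ.* (l ℤ.* l) ℤ.- l)
      expanded = solve-ℤ
  fixed₁ : ∀ n → (Residue 2 (Level n) 1 ∩ λ (j , l) → j ℤ.+ + 2 ℤ.* l ≡ 0ℤ) ≅ (λ l → ⊤ × 3 + θ-exponent 36 108 l ≡ n)
  fixed₁ n = bijection proj₂ (λ l → -[1+ 1 ] ℤ.* l , l)
    (λ {(j , l)} (p , key) → tt , trans (sym (eq l)) (subst (λ j → energy (+ 1 ℤ.+ j ℤ.* + 2 ℤ.+ l) l ≡ n) (solved j l key) p))
    (λ {l} (_ , p) → trans (eq l) p , zero-key l)
    (λ {(j , l)} (_ , key) → cong (_, l) (sym (solved j l key))) (λ _ → refl)
    where
    zero-key : ∀ l → -[1+ 1 ] ℤ.* l ℤ.+ + 2 ℤ.* l ≡ 0ℤ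
    zero-key = solve-ℤ
    rewritten : ∀ j l → j ≡ j ℤ.+ + 2 ℤ.* l ℤ.+ -[1+ 1 ] ℤ.* l
    rewritten = solve-ℤ
    solved : ∀ j l → j ℤ.+ + 2 ℤ.* l ≡ 0ℤ → j ≡ -[1+ 1 ] ℤ.* l
    solved j l key = trans (rewritten j l) (trans (cong (ℤ._+ -[1+ 1 ] ℤ.* l) key) (ℤ.+-identityˡ _))
    eq : ∀ l → energy (+ 1 ℤ.+ (-[1+ 1 ] ℤ.* l) ℤ.* + 2 ℤ.+ l) l ≡ 3 + θ-exponent 36 108 l
    eq l = ≡-via-+ (energy≡ (+ 1 ℤ.+ (-[1+ 1 ] ℤ.* l) ℤ.* + 2 ℤ.+ l) l) (cong (λ z → + 3 ℤ.+ z) (θ-triangular 36 l)) (expanded l)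
      where
      expanded : ∀ l → + 3 ℤ.* (+ 2 ℤ.* ((+ 1 ℤ.+ (-[1+ 1 ] ℤ.* l) ℤ.* + 2 ℤ.+ l) ℤ.* (+ 1 ℤ.+ (-[1+ 1 ] ℤ.* l) ℤ.* + 2 ℤ.+ l)) ℤ.- (+ 1 ℤ.+ (-[1+ 1 ] ℤ.* l) ℤ.* + 2 ℤ.+ l))
          ℤ.+ + 9 ℤ.* (+ 2 ℤ.* (l ℤ.* l) ℤ.- l) ≡ + 3 ℤ.+ + 36 ℤ.* (+ 2 ℤ.* (l ℤ.* l) ℤ.- l)
      expanded = solve-ℤ
  G : ∀ n → Finite (λ l → ⊤ × 3 + θ-exponent 36 108 l ≡ n)
  G n = transport (fixed₁ n) (restrict (λ (j , l) → j ℤ.+ + 2 ℤ.* l ℤ.≟ 0ℤ) (F₁ n))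

-- The ternary form x² + de

3∣_ : ℤ → Set
3∣ x = + 3 Signed.∣ x

infix 4 3∣_

-- The certificate x = u y + 3 v transfers divisibility by 3 from y to x.
∤-transfer : ∀ {x y} u v → x ≡ y ℤ.* u ℤ.+ v ℤ.* + 3 → ¬ 3∣ x → ¬ 3∣ y
∤-transfer {x} u v eq ¬x (Signed.divides q refl) = ¬x (Signed.divides (q ℤ.* u ℤ.+ v) (trans eq (lemma q u v)))
  where lemma : ∀ q u v → q ℤ.* + 3 ℤ.* u ℤ.+ v ℤ.* + 3 ≡ (q ℤ.* u ℤ.+ v) ℤ.* + 3
        lemma = solve-ℤ

0≤_ : ℤ → Set
0≤ x = 0ℤ ℤ.≤ x

infix 4 0≤_

0≰⇒ : ∀ {x} → ¬ 0≤ x → 0≤ -[1+ 0 ] ℤ.- x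
0≰⇒ {+ n} ≰ = ⊥-elim (≰ (ℤ.+≤+ z≤n))
0≰⇒ { -[1+ n ]} _ = ℤ.+≤+ z≤n

0≤⇒0≰ : ∀ {x} → 0≤ x → ¬ 0≤ -[1+ 0 ] ℤ.- x
0≤⇒0≰ {+ zero} _ ()
0≤⇒0≰ {+ suc n} _ ()

0≤-+ : ∀ {x y} → 0≤ x → 0≤ y → 0≤ x ℤ.+ y
0≤-+ = ℤ.+-mono-≤

0≤-antisym : ∀ {x} → 0≤ x → 0≤ ℤ.- x → x ≡ 0ℤ
0≤-antisym {+ zero} _ _ = refl
0≤-antisym {+ suc n} _ ()
0≤-antisym { -[1+ n ]} () _

-- (3a + 1)(3b + 2) runs over the factorisations de = 3n + 2 with d ≡ 1 and e ≡ 2 (mod 3); Member says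
-- that 9 ∤ d + e.
𝓛 : Family
𝓛 = record
  { Index = ℕ × ℕ
  ; Member = λ (a , b) → ¬ 3∣ + a ℤ.+ + b ℤ.+ 1ℤ
  ; exponent = λ (a , b) → 3 * (a * b) + 2 * a + b
  ; finite = λ n → finite-⊆
      (λ (a , b) → ¬? (+ 3 Signed.∣? + a ℤ.+ + b ℤ.+ 1ℤ) ×-dec (3 * (a * b) + 2 * a + b ℕ.≟ n))
      (λ { {a , b} (_ , refl) →
           ℕ.≤-trans (ℕ.m≤n*m a 2) (ℕ.≤-trans (ℕ.m≤n+m (2 * a) (3 * (a * b))) (ℕ.m≤m+n _ b)) , ℕ.m≤n+m b _ })
      (finite-ℕ n ⊗ finite-ℕ n)
  }

module Ternary (n : ℕ) where

  N : ℤ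
  N = + n

  -- x² + de = 3n + 3 with x = 3ξ + 1, d = 3δ + 1, e = 3ε + 2.
  S : ℤ × (ℤ × ℤ) → Set
  S (ξ , (δ , ε)) = (0≤ δ × 0≤ ε × ¬ 3∣ δ ℤ.+ ε ℤ.+ 1ℤ) × + 3 ℤ.* (ξ ℤ.* ξ) ℤ.+ + 2 ℤ.* ξ ℤ.+ + 3 ℤ.* (δ ℤ.* ε) ℤ.+ + 2 ℤ.* δ ℤ.+ ε ≡ N

  -- x² + de = 3n + 3 with x = 3X, d = D, e = 3G.
  U : ℤ × (ℤ × ℤ) → Set
  U (D , (X , G)) = (0≤ D ℤ.- 1ℤ × 0≤ G ℤ.- 1ℤ × ¬ 3∣ D × ¬ 3∣ G ℤ.+ X) × + 3 ℤ.* (X ℤ.* X) ℤ.+ D ℤ.* G ≡ N ℤ.+ 1ℤ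

  -- For r = 1 and r = 2 this is the class D = 3δ + r of `U`, where D ≥ 1 amounts to δ ≥ 0 and 3 ∤ D
  -- is automatic.
  T : ℕ → ℤ × (ℤ × ℤ) → Set
  T r (δ , (X , G)) = (0≤ δ × 0≤ G ℤ.- 1ℤ × ¬ 3∣ G ℤ.+ X) × + 3 ℤ.* (X ℤ.* X) ℤ.+ (+ r ℤ.+ δ ℤ.* + 3) ℤ.* G ≡ N ℤ.+ 1ℤ

  -- G - 2X - δ - 1 is the coordinate ε (for `T 1`) or δ (for `T 2`) of the point of `S` that the
  -- translations `ahead` and `behind` would carry here; it must be nonnegative.
  Near : ℤ × (ℤ × ℤ) → Set
  Near (δ , (X , G)) = 0≤ G ℤ.- + 2 ℤ.* X ℤ.- δ ℤ.- 1ℤ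

  Near? : Decidable Near
  Near? (δ , (X , G)) = 0ℤ ℤ.≤? G ℤ.- + 2 ℤ.* X ℤ.- δ ℤ.- 1ℤ

  -- The reflection fixing G in the form with coefficients 3δ + r, 6X, −3G acts exactly on the complement
  -- of Near, and its axis 2X = G is excluded by 3 ∤ G + X.
  parity-T : ∀ {r} (F : Finite (T r)) → parity F ≡ parity (restrict Near? F)
  parity-T {r} F = trans (parity-split Near? F)
    (trans (cong (parity (restrict Near? F) xor_) (parity-free (restrict (∁? Near?) F) reflection (λ {x} → free {x}))) (xor-identityʳ _))
    where
    e₁ : ∀ δ X G → -[1+ 0 ] ℤ.- (G ℤ.- + 2 ℤ.* X ℤ.- δ ℤ.- 1ℤ)
      ≡ δ ℤ.+ + 2 ℤ.* X ℤ.- G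
    e₁ = solve-ℤ

    e₂ : ∀ δ X G → -[1+ 0 ] ℤ.- δ
      ≡ G ℤ.- + 2 ℤ.* (G ℤ.- X) ℤ.- (δ ℤ.+ + 2 ℤ.* X ℤ.- G) ℤ.- 1ℤ
    e₂ = solve-ℤ

    e₃ : ∀ G X → G ℤ.+ X
      ≡ (G ℤ.+ (G ℤ.- X)) ℤ.* -[1+ 0 ] ℤ.+ G ℤ.* + 3
    e₃ = solve-ℤ

    e₄ : ∀ r δ X G → + 3 ℤ.* ((G ℤ.- X) ℤ.* (G ℤ.- X)) ℤ.+ (r ℤ.+ (δ ℤ.+ + 2 ℤ.* X ℤ.- G) ℤ.* + 3) ℤ.* G
      ≡ + 3 ℤ.* (X ℤ.* X) ℤ.+ (r ℤ.+ δ ℤ.* + 3) ℤ.* G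
    e₄ = solve-ℤ

    e₅ : ∀ δ X G → δ ℤ.+ + 2 ℤ.* X ℤ.- G ℤ.+ + 2 ℤ.* (G ℤ.- X) ℤ.- G
      ≡ δ
    e₅ = solve-ℤ

    e₆ : ∀ X G → G ℤ.- (G ℤ.- X)
      ≡ X
    e₆ = solve-ℤ

    e₇ : ∀ X G → + 2 ℤ.* (G ℤ.- X) ℤ.- G
      ≡ ℤ.- (+ 2 ℤ.* X ℤ.- G)
    e₇ = solve-ℤ

    e₈ : ∀ X G → G ℤ.+ X
      ≡ X ℤ.* + 3 ℤ.- (+ 2 ℤ.* X ℤ.- G)
    e₈ = solve-ℤ

    reflection : Involution (T r ∩ ∁ Near)
    reflection = involution (λ (δ , (X , G)) → δ ℤ.+ + 2 ℤ.* X ℤ.- G , (G ℤ.- X , G)) (λ (δ , (X , G)) → + 2 ℤ.* X ℤ.- G)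
      (λ {(δ , (X , G))} (((0≤δ , 0<G , 3∤) , eq) , far) →
        ((subst 0≤_ (e₁ δ X G) (0≰⇒ far) , 0<G , ∤-transfer -[1+ 0 ] G (e₃ G X) 3∤) , trans (e₄ (+ r) δ X G) eq) ,
        λ near → 0≤⇒0≰ 0≤δ (subst 0≤_ (sym (e₂ δ X G)) near))
      (λ {(δ , (X , G))} _ → cong₂ _,_ (e₅ δ X G) (cong (_, G) (e₆ X G)))
      (λ (δ , (X , G)) → e₇ X G)
    free : ∀ {x} → (T r ∩ ∁ Near) x → Involution.key reflection x ≢ 0ℤ
    free {(δ , (X , G))} (((_ , _ , 3∤) , _) , _) key = 3∤ (Signed.divides X
      (trans (e₈ X G) (trans (cong (λ z → X ℤ.* + 3 ℤ.- z) key) (ℤ.+-identityʳ _))))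

  -- The sign of e + 2x − d. Translating x to x − d or to x + e, according to this sign, makes x divisible
  -- by 3 and reaches the solutions in T 1 or T 2 that are Near.
  Ahead Behind : ℤ × (ℤ × ℤ) → Set
  Ahead  (ξ , (δ , ε)) = 0≤ ε ℤ.+ + 2 ℤ.* ξ ℤ.- δ
  Behind (ξ , (δ , ε)) = 0≤ δ ℤ.- + 2 ℤ.* ξ ℤ.- ε ℤ.- + 2

  Ahead? : Decidable Ahead
  Ahead? (ξ , (δ , ε)) = 0ℤ ℤ.≤? ε ℤ.+ + 2 ℤ.* ξ ℤ.- δ

  Behind? : Decidable Behind
  Behind? (ξ , (δ , ε)) = 0ℤ ℤ.≤? δ ℤ.- + 2 ℤ.* ξ ℤ.- ε ℤ.- + 2

  ahead : (S ∩ Ahead) ≅ (T 1 ∩ Near)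
  ahead = bijection
    (λ (ξ , (δ , ε)) → δ , (ξ ℤ.- δ , ε ℤ.+ + 2 ℤ.* ξ ℤ.- δ ℤ.+ 1ℤ))
    (λ (δ , (X , G)) → X ℤ.+ δ , (δ , G ℤ.- + 2 ℤ.* X ℤ.- δ ℤ.- 1ℤ))
    (λ {(ξ , (δ , ε))} (((0≤δ , 0≤ε , 3∤) , eq) , a) →
      ((0≤δ , subst 0≤_ (e₁ ξ δ ε) a , ∤-transfer 1ℤ (δ ℤ.- ξ) (e₂ ξ δ ε) 3∤) ,
       trans (e₃ ξ δ ε) (cong (ℤ._+ 1ℤ) eq)) , subst 0≤_ (e₄ ξ δ ε) 0≤ε)
    (λ {(δ , (X , G))} (((0≤δ , 0<G , 3∤) , eq) , near) →
      ((0≤δ , near , ∤-transfer 1ℤ X (e₅ δ X G) 3∤) , ∙-cancelʳ 1ℤ _ N (trans (e₆ δ X G) eq)) , subst 0≤_ (e₇ δ X G) 0<G)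
    (λ {(ξ , (δ , ε))} _ → cong₂ (λ ξ ε → ξ , (δ , ε)) (e₈ ξ δ) (e₉ ξ δ ε))
    (λ {(δ , (X , G))} _ → cong₂ (λ X G → δ , (X , G)) (e₁₀ X δ) (e₁₁ δ X G))
    where
    e₁ : ∀ ξ δ ε → ε ℤ.+ + 2 ℤ.* ξ ℤ.- δ
      ≡ (ε ℤ.+ + 2 ℤ.* ξ ℤ.- δ ℤ.+ 1ℤ) ℤ.- 1ℤ
    e₁ = solve-ℤ

    e₂ : ∀ ξ δ ε → δ ℤ.+ ε ℤ.+ 1ℤ
      ≡ ((ε ℤ.+ + 2 ℤ.* ξ ℤ.- δ ℤ.+ 1ℤ) ℤ.+ (ξ ℤ.- δ)) ℤ.* 1ℤ ℤ.+ (δ ℤ.- ξ) ℤ.* + 3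
    e₂ = solve-ℤ

    e₃ : ∀ ξ δ ε → + 3 ℤ.* ((ξ ℤ.- δ) ℤ.* (ξ ℤ.- δ)) ℤ.+ (+ 1 ℤ.+ δ ℤ.* + 3) ℤ.* (ε ℤ.+ + 2 ℤ.* ξ ℤ.- δ ℤ.+ 1ℤ)
      ≡ + 3 ℤ.* (ξ ℤ.* ξ) ℤ.+ + 2 ℤ.* ξ ℤ.+ + 3 ℤ.* (δ ℤ.* ε) ℤ.+ + 2 ℤ.* δ ℤ.+ ε ℤ.+ 1ℤ
    e₃ = solve-ℤ

    e₄ : ∀ ξ δ ε → ε
      ≡ (ε ℤ.+ + 2 ℤ.* ξ ℤ.- δ ℤ.+ 1ℤ) ℤ.- + 2 ℤ.* (ξ ℤ.- δ) ℤ.- δ ℤ.- 1ℤ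
    e₄ = solve-ℤ

    e₅ : ∀ δ X G → G ℤ.+ X
      ≡ (δ ℤ.+ (G ℤ.- + 2 ℤ.* X ℤ.- δ ℤ.- 1ℤ) ℤ.+ 1ℤ) ℤ.* 1ℤ ℤ.+ X ℤ.* + 3
    e₅ = solve-ℤ

    e₆ : ∀ δ X G → + 3 ℤ.* ((X ℤ.+ δ) ℤ.* (X ℤ.+ δ)) ℤ.+ + 2 ℤ.* (X ℤ.+ δ) ℤ.+ + 3 ℤ.* (δ ℤ.* (G ℤ.- + 2 ℤ.* X ℤ.- δ ℤ.- 1ℤ)) ℤ.+ + 2 ℤ.* δ ℤ.+ (G ℤ.- + 2 ℤ.* X ℤ.- δ ℤ.- 1ℤ) ℤ.+ 1ℤ
      ≡ + 3 ℤ.* (X ℤ.* X) ℤ.+ (+ 1 ℤ.+ δ ℤ.* + 3) ℤ.* G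
    e₆ = solve-ℤ

    e₇ : ∀ δ X G → G ℤ.- 1ℤ
      ≡ (G ℤ.- + 2 ℤ.* X ℤ.- δ ℤ.- 1ℤ) ℤ.+ + 2 ℤ.* (X ℤ.+ δ) ℤ.- δ
    e₇ = solve-ℤ

    e₈ : ∀ ξ δ → ξ ℤ.- δ ℤ.+ δ
      ≡ ξ
    e₈ = solve-ℤ

    e₉ : ∀ ξ δ ε → (ε ℤ.+ + 2 ℤ.* ξ ℤ.- δ ℤ.+ 1ℤ) ℤ.- + 2 ℤ.* (ξ ℤ.- δ) ℤ.- δ ℤ.- 1ℤ
      ≡ ε
    e₉ = solve-ℤ

    e₁₀ : ∀ X δ → X ℤ.+ δ ℤ.- δ
      ≡ X
    e₁₀ = solve-ℤ

    e₁₁ : ∀ δ X G → (G ℤ.- + 2 ℤ.* X ℤ.- δ ℤ.- 1ℤ) ℤ.+ + 2 ℤ.* (X ℤ.+ δ) ℤ.- δ ℤ.+ 1ℤ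
      ≡ G
    e₁₁ = solve-ℤ

  behind : (S ∩ Behind) ≅ (T 2 ∩ Near)
  behind = bijection
    -- Here 3X = -(x + e) and 3G = d - 2x - e. The sign of X is the one for which G + X ≡ δ + ε + 1
    -- (mod 3).
    (λ (ξ , (δ , ε)) → ε , (-[1+ 0 ] ℤ.- ξ ℤ.- ε , δ ℤ.- + 2 ℤ.* ξ ℤ.- ε ℤ.- 1ℤ))
    (λ (ε , (X , G)) → -[1+ 0 ] ℤ.- X ℤ.- ε , (G ℤ.- + 2 ℤ.* X ℤ.- ε ℤ.- 1ℤ , ε))
    (λ {(ξ , (δ , ε))} (((0≤δ , 0≤ε , 3∤) , eq) , a) →
      ((0≤ε , subst 0≤_ (e₁ ξ δ ε) a , ∤-transfer 1ℤ (ξ ℤ.+ ε ℤ.+ 1ℤ) (e₂ ξ δ ε) 3∤) ,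
       trans (e₃ ξ δ ε) (cong (ℤ._+ 1ℤ) eq)) , subst 0≤_ (e₄ ξ δ ε) 0≤δ)
    (λ {(ε , (X , G))} (((0≤ε , 0<G , 3∤) , eq) , near) →
      ((near , 0≤ε , ∤-transfer 1ℤ X (e₅ ε X G) 3∤) , ∙-cancelʳ 1ℤ _ N (trans (e₆ ε X G) eq)) , subst 0≤_ (e₇ ε X G) 0<G)
    (λ {(ξ , (δ , ε))} _ → cong₂ (λ ξ δ → ξ , (δ , ε)) (e₈ ξ ε) (e₉ ξ δ ε))
    (λ {(ε , (X , G))} _ → cong₂ (λ X G → ε , (X , G)) (e₈ X ε) (e₁₁ ε X G))
    where
    e₁ : ∀ ξ δ ε → δ ℤ.- + 2 ℤ.* ξ ℤ.- ε ℤ.- + 2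
      ≡ (δ ℤ.- + 2 ℤ.* ξ ℤ.- ε ℤ.- 1ℤ) ℤ.- 1ℤ
    e₁ = solve-ℤ

    e₂ : ∀ ξ δ ε → δ ℤ.+ ε ℤ.+ 1ℤ
      ≡ ((δ ℤ.- + 2 ℤ.* ξ ℤ.- ε ℤ.- 1ℤ) ℤ.+ (-[1+ 0 ] ℤ.- ξ ℤ.- ε)) ℤ.* 1ℤ ℤ.+ (ξ ℤ.+ ε ℤ.+ 1ℤ) ℤ.* + 3
    e₂ = solve-ℤ

    e₃ : ∀ ξ δ ε → + 3 ℤ.* ((-[1+ 0 ] ℤ.- ξ ℤ.- ε) ℤ.* (-[1+ 0 ] ℤ.- ξ ℤ.- ε)) ℤ.+ (+ 2 ℤ.+ ε ℤ.* + 3) ℤ.* (δ ℤ.- + 2 ℤ.* ξ ℤ.- ε ℤ.- 1ℤ)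
      ≡ + 3 ℤ.* (ξ ℤ.* ξ) ℤ.+ + 2 ℤ.* ξ ℤ.+ + 3 ℤ.* (δ ℤ.* ε) ℤ.+ + 2 ℤ.* δ ℤ.+ ε ℤ.+ 1ℤ
    e₃ = solve-ℤ

    e₄ : ∀ ξ δ ε → δ
      ≡ (δ ℤ.- + 2 ℤ.* ξ ℤ.- ε ℤ.- 1ℤ) ℤ.- + 2 ℤ.* (-[1+ 0 ] ℤ.- ξ ℤ.- ε) ℤ.- ε ℤ.- 1ℤ
    e₄ = solve-ℤ

    e₅ : ∀ ε X G → G ℤ.+ X
      ≡ ((G ℤ.- + 2 ℤ.* X ℤ.- ε ℤ.- 1ℤ) ℤ.+ ε ℤ.+ 1ℤ) ℤ.* 1ℤ ℤ.+ X ℤ.* + 3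
    e₅ = solve-ℤ

    e₆ : ∀ ε X G → + 3 ℤ.* ((-[1+ 0 ] ℤ.- X ℤ.- ε) ℤ.* (-[1+ 0 ] ℤ.- X ℤ.- ε)) ℤ.+ + 2 ℤ.* (-[1+ 0 ] ℤ.- X ℤ.- ε) ℤ.+ + 3 ℤ.* ((G ℤ.- + 2 ℤ.* X ℤ.- ε ℤ.- 1ℤ) ℤ.* ε) ℤ.+ + 2 ℤ.* (G ℤ.- + 2 ℤ.* X ℤ.- ε ℤ.- 1ℤ) ℤ.+ ε ℤ.+ 1ℤ
      ≡ + 3 ℤ.* (X ℤ.* X) ℤ.+ (+ 2 ℤ.+ ε ℤ.* + 3) ℤ.* G
    e₆ = solve-ℤ

    e₇ : ∀ ε X G → G ℤ.- 1ℤ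
      ≡ (G ℤ.- + 2 ℤ.* X ℤ.- ε ℤ.- 1ℤ) ℤ.- + 2 ℤ.* (-[1+ 0 ] ℤ.- X ℤ.- ε) ℤ.- ε ℤ.- + 2
    e₇ = solve-ℤ

    e₈ : ∀ ξ ε → -[1+ 0 ] ℤ.- (-[1+ 0 ] ℤ.- ξ ℤ.- ε) ℤ.- ε
      ≡ ξ
    e₈ = solve-ℤ

    e₉ : ∀ ξ δ ε → (δ ℤ.- + 2 ℤ.* ξ ℤ.- ε ℤ.- 1ℤ) ℤ.- + 2 ℤ.* (-[1+ 0 ] ℤ.- ξ ℤ.- ε) ℤ.- ε ℤ.- 1ℤ
      ≡ δ
    e₉ = solve-ℤ

    e₁₁ : ∀ ε X G → (G ℤ.- + 2 ℤ.* X ℤ.- ε ℤ.- 1ℤ) ℤ.- + 2 ℤ.* (-[1+ 0 ] ℤ.- X ℤ.- ε) ℤ.- ε ℤ.- 1ℤ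
      ≡ G
    e₁₁ = solve-ℤ

  -- What remains is e + 2x = d. The map x ↦ -x - 1, (d, e) ↦ (e - 1, d + 1) changes x² + de by e +
  -- 2x - d = 0. It has no fixed point because 2ξ + 1 is odd.
  level : (F : Finite ((S ∩ ∁ Ahead) ∩ ∁ Behind)) → parity F ≡ false
  level F = parity-free F swap λ {(ξ , _)} _ → odd≢0 ξ
    where
    odd≢0 : ∀ ξ → + 2 ℤ.* ξ ℤ.+ 1ℤ ≢ 0ℤ
    odd≢0 (+ zero) ()
    odd≢0 (+ suc n) ()
    odd≢0 -[1+ zero ] ()
    odd≢0 -[1+ suc n ] ()
    balance : ∀ {ξ δ ε} → ¬ Ahead (ξ , (δ , ε)) → ¬ Behind (ξ , (δ , ε)) → ε ℤ.+ + 2 ℤ.* ξ ℤ.- δ ℤ.+ 1ℤ ≡ 0ℤ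
    balance {ξ} {δ} {ε} ¬a ¬b = 0≤-antisym (subst 0≤_ (e₁ ξ δ ε) (0≰⇒ ¬b)) (subst 0≤_ (e₂ ξ δ ε) (0≰⇒ ¬a))
      where
      e₁ : ∀ ξ δ ε → -[1+ 0 ] ℤ.- (δ ℤ.- + 2 ℤ.* ξ ℤ.- ε ℤ.- + 2)
        ≡ ε ℤ.+ + 2 ℤ.* ξ ℤ.- δ ℤ.+ 1ℤ
      e₁ = solve-ℤ

      e₂ : ∀ ξ δ ε → -[1+ 0 ] ℤ.- (ε ℤ.+ + 2 ℤ.* ξ ℤ.- δ)
        ≡ ℤ.- (ε ℤ.+ + 2 ℤ.* ξ ℤ.- δ ℤ.+ 1ℤ)
      e₂ = solve-ℤ

    e₃ : ∀ ξ δ ε → δ ℤ.+ ε ℤ.+ 1ℤ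
      ≡ (ε ℤ.+ δ ℤ.+ 1ℤ) ℤ.* 1ℤ ℤ.+ 0ℤ ℤ.* + 3
    e₃ = solve-ℤ

    e₄ : ∀ ξ δ ε → + 3 ℤ.* ((-[1+ 0 ] ℤ.- ξ) ℤ.* (-[1+ 0 ] ℤ.- ξ)) ℤ.+ + 2 ℤ.* (-[1+ 0 ] ℤ.- ξ) ℤ.+ + 3 ℤ.* (ε ℤ.* δ) ℤ.+ + 2 ℤ.* ε ℤ.+ δ
      ≡ + 3 ℤ.* (ξ ℤ.* ξ) ℤ.+ + 2 ℤ.* ξ ℤ.+ + 3 ℤ.* (δ ℤ.* ε) ℤ.+ + 2 ℤ.* δ ℤ.+ ε ℤ.+ (ε ℤ.+ + 2 ℤ.* ξ ℤ.- δ ℤ.+ 1ℤ)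
    e₄ = solve-ℤ

    e₅ : ∀ ξ δ ε → δ ℤ.+ + 2 ℤ.* (-[1+ 0 ] ℤ.- ξ) ℤ.- ε
      ≡ -[1+ 0 ] ℤ.+ ℤ.- (ε ℤ.+ + 2 ℤ.* ξ ℤ.- δ ℤ.+ 1ℤ)
    e₅ = solve-ℤ

    e₆ : ∀ ξ δ ε → ε ℤ.- + 2 ℤ.* (-[1+ 0 ] ℤ.- ξ) ℤ.- δ ℤ.- + 2
      ≡ -[1+ 0 ] ℤ.+ (ε ℤ.+ + 2 ℤ.* ξ ℤ.- δ ℤ.+ 1ℤ)
    e₆ = solve-ℤ

    e₇ : ∀ ξ → -[1+ 0 ] ℤ.- (-[1+ 0 ] ℤ.- ξ)
      ≡ ξ
    e₇ = solve-ℤ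

    e₈ : ∀ ξ → + 2 ℤ.* (-[1+ 0 ] ℤ.- ξ) ℤ.+ 1ℤ
      ≡ ℤ.- (+ 2 ℤ.* ξ ℤ.+ 1ℤ)
    e₈ = solve-ℤ

    -1≱0 : ∀ {x} → x ≡ -[1+ 0 ] → ¬ 0≤ x
    -1≱0 refl ()
    swap : Involution ((S ∩ ∁ Ahead) ∩ ∁ Behind)
    swap = involution (λ (ξ , (δ , ε)) → -[1+ 0 ] ℤ.- ξ , (ε , δ)) (λ (ξ , _) → + 2 ℤ.* ξ ℤ.+ 1ℤ)
      (λ {(ξ , (δ , ε))} ((((0≤δ , 0≤ε , 3∤) , eq) , ¬a) , ¬b) → let z = balance {ξ} {δ} {ε} ¬a ¬b in
        (((0≤ε , 0≤δ , ∤-transfer 1ℤ 0ℤ (e₃ ξ δ ε) 3∤) ,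
          trans (e₄ ξ δ ε) (trans (cong₂ ℤ._+_ eq z) (ℤ.+-identityʳ N))) ,
         -1≱0 (trans (e₅ ξ δ ε) (cong (λ z → -[1+ 0 ] ℤ.+ ℤ.- z) z))) ,
        -1≱0 (trans (e₆ ξ δ ε) (cong (λ z → -[1+ 0 ] ℤ.+ z) z)))
      (λ {(ξ , (δ , ε))} _ → cong (_, (δ , ε)) (e₇ ξ)) (λ (ξ , _) → e₈ ξ)

  finite-U : Finite U
  finite-U = finite-⊆ U? (λ {x} → bounded {x}) (finite-ℤ (suc n) ⊗ (finite-ℤ (suc n) ⊗ finite-ℤ (suc n)))
    where
    U? : Decidable U
    U? (D , (X , G)) = ((0ℤ ℤ.≤? D ℤ.- 1ℤ) ×-dec (0ℤ ℤ.≤? G ℤ.- 1ℤ) ×-dec ¬? (+ 3 Signed.∣? D) ×-dec ¬? (+ 3 Signed.∣? G ℤ.+ X))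
                       ×-dec (_ ℤ.≟ N ℤ.+ 1ℤ)
    x*x : ∀ X → X ℤ.* X ≡ + (ℤ.∣ X ∣ * ℤ.∣ X ∣)
    x*x X = square X
      where
      square : ∀ X → X ℤ.* X ≡ + (ℤ.∣ X ∣ * ℤ.∣ X ∣)
      square (+ k) = ℤ.+◃n≡+n (k * k)
      square -[1+ k ] = refl
    bounded : ∀ {x} → U x → let (D , (X , G)) = x in ℤ.∣ D ∣ ≤ suc n × (ℤ.∣ X ∣ ≤ suc n × ℤ.∣ G ∣ ≤ suc n)
    bounded {+ zero , (X , G)} ((() , _) , _)
    bounded { -[1+ _ ] , (X , G)} ((() , _) , _)
    bounded {+ suc d , (X , + zero)} ((_ , () , _) , _)
    bounded {+ suc d , (X , -[1+ _ ])} ((_ , () , _) , _)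
    bounded {+ suc d , (X , + suc g)} (_ , eq) =
      ℕ.≤-trans (ℕ.m≤m*n (suc d) (suc g)) dg , ℕ.≤-trans (x≤x*x x) xx , ℕ.≤-trans (ℕ.m≤n*m (suc g) (suc d)) dg
      where
      x = ℤ.∣ X ∣
      x≤x*x : ∀ x → x ≤ x * x
      x≤x*x zero = z≤n
      x≤x*x (suc x) = ℕ.m≤m*n (suc x) (suc x)
      eqℕ : 3 * (x * x) + suc d * suc g ≡ suc n
      eqℕ = ℤ.+-injective (trans (trans (ℤ.pos-+ (3 * (x * x)) (suc d * suc g))
        (cong₂ ℤ._+_ (trans (ℤ.pos-* 3 (x * x)) (cong (λ z → + 3 ℤ.* z) (sym (x*x X)))) (ℤ.pos-* (suc d) (suc g))))
        (trans eq (cong +_ (ℕ.+-comm n 1))))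
      dg : suc d * suc g ≤ suc n
      dg = ℕ.≤-trans (ℕ.m≤n+m _ (3 * (x * x))) (ℕ.≤-reflexive eqℕ)
      xx : x * x ≤ suc n
      xx = ℕ.≤-trans (ℕ.m≤n*m (x * x) 3) (ℕ.≤-trans (ℕ.m≤m+n _ _) (ℕ.≤-reflexive eqℕ))

  ∤-residue : ∀ r δ → ¬ 3∣ + r → ¬ 3∣ + r ℤ.+ δ ℤ.* + 3
  ∤-residue r δ = ∤-transfer 1ℤ (ℤ.- δ) (eq (+ r) δ)
    where
    eq : ∀ r δ → r
      ≡ (r ℤ.+ δ ℤ.* + 3) ℤ.* 1ℤ ℤ.+ (ℤ.- δ) ℤ.* + 3
    eq = solve-ℤ

  mod3 : ∀ x → ¬ 3∣ x → (∃ λ q → x ≡ + 1 ℤ.+ q ℤ.* + 3) ⊎ (∃ λ q → x ≡ + 2 ℤ.+ q ℤ.* + 3)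
  mod3 x 3∤x with x %ℕ 3 | ℤ.n%ℕd<d x 3 | ℤ.a≡a%ℕn+[a/ℕn]*n x 3
  ... | 0 | _ | eq = ⊥-elim (3∤x (Signed.divides (x /ℕ 3) (trans eq (ℤ.+-identityˡ _))))
  ... | 1 | _ | eq = inj₁ (x /ℕ 3 , eq)
  ... | 2 | _ | eq = inj₂ (x /ℕ 3 , eq)
  ... | suc (suc (suc _)) | s≤s (s≤s (s≤s ())) | _

  opposite : ∀ {x y} → ¬ 3∣ x → ¬ 3∣ y → ¬ 3∣ y ℤ.- x → 3∣ y ℤ.+ x
  opposite {x} {y} 3∤x 3∤y ≢ = cases (mod3 x 3∤x) (mod3 y 3∤y) ≢
    where
    e₁ : ∀ p q → + 1 ℤ.+ q ℤ.* + 3 ℤ.- (+ 1 ℤ.+ p ℤ.* + 3)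
      ≡ (q ℤ.- p) ℤ.* + 3
    e₁ = solve-ℤ

    e₂ : ∀ p q → + 2 ℤ.+ q ℤ.* + 3 ℤ.+ (+ 1 ℤ.+ p ℤ.* + 3)
      ≡ (q ℤ.+ p ℤ.+ 1ℤ) ℤ.* + 3
    e₂ = solve-ℤ

    e₃ : ∀ p q → + 1 ℤ.+ q ℤ.* + 3 ℤ.+ (+ 2 ℤ.+ p ℤ.* + 3)
      ≡ (q ℤ.+ p ℤ.+ 1ℤ) ℤ.* + 3
    e₃ = solve-ℤ

    e₄ : ∀ p q → + 2 ℤ.+ q ℤ.* + 3 ℤ.- (+ 2 ℤ.+ p ℤ.* + 3)
      ≡ (q ℤ.- p) ℤ.* + 3
    e₄ = solve-ℤ

    cases : ∀ {x y} → (∃ λ q → x ≡ + 1 ℤ.+ q ℤ.* + 3) ⊎ (∃ λ q → x ≡ + 2 ℤ.+ q ℤ.* + 3) →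
            (∃ λ q → y ≡ + 1 ℤ.+ q ℤ.* + 3) ⊎ (∃ λ q → y ≡ + 2 ℤ.+ q ℤ.* + 3) → ¬ 3∣ y ℤ.- x → 3∣ y ℤ.+ x
    cases (inj₁ (p , refl)) (inj₁ (q , refl)) ≢ = ⊥-elim (≢ (Signed.divides (q ℤ.- p) (e₁ p q)))
    cases (inj₁ (p , refl)) (inj₂ (q , refl)) _ = Signed.divides (q ℤ.+ p ℤ.+ 1ℤ) (e₂ p q)
    cases (inj₂ (p , refl)) (inj₁ (q , refl)) _ = Signed.divides (q ℤ.+ p ℤ.+ 1ℤ) (e₃ p q)
    cases (inj₂ (p , refl)) (inj₂ (q , refl)) ≢ = ⊥-elim (≢ (Signed.divides (q ℤ.- p) (e₄ p q)))

  positive⁺ : ∀ r {δ} → 0≤ δ → 0≤ + suc r ℤ.+ δ ℤ.* + 3 ℤ.- 1ℤ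
  positive⁺ r {δ} 0≤δ = subst 0≤_ (sym (eq (+ r) δ)) (0≤-+ {+ r} (ℤ.+≤+ z≤n) (0≤-+ 0≤δ (0≤-+ 0≤δ 0≤δ)))
    where
    eq : ∀ r δ → 1ℤ ℤ.+ r ℤ.+ δ ℤ.* + 3 ℤ.- 1ℤ
      ≡ r ℤ.+ (δ ℤ.+ (δ ℤ.+ δ))
    eq = solve-ℤ

  positive⁻ : ∀ {r δ} → r < 3 → 0≤ + suc r ℤ.+ δ ℤ.* + 3 ℤ.- 1ℤ → 0≤ δ
  positive⁻ {r} {δ} r<3 0< with 0ℤ ℤ.≤? δ
  ... | yes 0≤δ = 0≤δ
  ... | no 0≰δ = ⊥-elim (absurd r<3 (subst 0≤_ (eq (+ r) δ) (0≤-+ 0< (0≤-+ (0≰⇒ 0≰δ) (0≤-+ (0≰⇒ 0≰δ) (0≰⇒ 0≰δ))))))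
    where
    absurd : ∀ {r} → r < 3 → ¬ 0≤ + r ℤ.- + 3
    absurd {0} _ ()
    absurd {1} _ ()
    absurd {2} _ ()
    absurd {suc (suc (suc _))} (s≤s (s≤s (s≤s ())))
    eq : ∀ r δ → 1ℤ ℤ.+ r ℤ.+ δ ℤ.* + 3 ℤ.- 1ℤ ℤ.+ ((-[1+ 0 ] ℤ.- δ) ℤ.+ ((-[1+ 0 ] ℤ.- δ) ℤ.+ (-[1+ 0 ] ℤ.- δ)))
      ≡ r ℤ.- + 3
    eq = solve-ℤ

  T≅ : ∀ r → r < 2 → ¬ 3∣ + suc r → T (suc r) ≅ Residue 3 U (suc r)
  T≅ r r<2 3∤r = bijection id id
    (λ {(δ , _)} ((0≤δ , 0<G , 3∤) , eq) → (positive⁺ r 0≤δ , 0<G , ∤-residue (suc r) δ 3∤r , 3∤) , eq)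
    (λ ((0<D , 0<G , _ , 3∤) , eq) → (positive⁻ (ℕ.<-trans r<2 (s≤s (s≤s (s≤s z≤n)))) 0<D , 0<G , 3∤) , eq)
    (λ _ → refl) (λ _ → refl)

  3∤1 : ¬ 3∣ + 1
  3∤1 = from-no (+ 3 Signed.∣? + 1)

  3∤2 : ¬ 3∣ + 2
  3∤2 = from-no (+ 3 Signed.∣? + 2)

  -- `Ahead` accounts for D ≡ 1 and `Behind` for D ≡ 2 (mod 3), the class D ≡ 0 being excluded from
  -- `U`; the solutions on neither side cancel by `level`.
  parity-S : (F : Finite S) → parity F ≡ parity finite-U
  parity-S F = trans (parity-split Ahead? F) (trans (cong₂ _xor_
      (trans (parity-≅ ahead (restrict Ahead? F) (restrict Near? F₁)) (trans (sym (parity-T F₁)) (parity-≅ (T≅ 0 (s≤s z≤n) 3∤1) F₁ R₁)))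
      (trans (parity-split Behind? (restrict (∁? Ahead?) F)) (trans (cong₂ _xor_
        (trans (parity-⊆ (λ ((s , _) , b) → s , b) (λ {x} (s , b) → (s , not-both x b) , b) (restrict Behind? (restrict (∁? Ahead?) F)) (restrict Behind? F))
        (trans (parity-≅ behind (restrict Behind? F) (restrict Near? F₂)) (trans (sym (parity-T F₂)) (parity-≅ (T≅ 1 (s≤s (s≤s z≤n)) 3∤2) F₂ R₂))))
        (level (restrict (∁? Behind?) (restrict (∁? Ahead?) F)))) (xor-identityʳ _))))
    (sym (trans (parity-mod3 finite-U) (cong (_xor (parity R₁ xor parity R₂)) (parity-∅ R₀
      (λ (δ , _) ((_ , _ , 3∤ , _) , _) → 3∤ (Signed.divides δ (ℤ.+-identityˡ _))))))))
    where
    R₀ = residue 3 U finite-U {0} (s≤s z≤n)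
    R₁ = residue 3 U finite-U {1} (s≤s (s≤s z≤n))
    R₂ = residue 3 U finite-U {2} (s≤s (s≤s (s≤s z≤n)))
    F₁ = transport (≅-sym (T≅ 0 (s≤s z≤n) 3∤1)) R₁
    F₂ = transport (≅-sym (T≅ 1 (s≤s (s≤s z≤n)) 3∤2)) R₂
    not-both : ∀ x → Behind x → ¬ Ahead x
    not-both (ξ , (δ , ε)) b a = -2≱0 (subst 0≤_ (eq ξ δ ε) (0≤-+ a b))
      where
      -2≱0 : ¬ 0≤ -[1+ 1 ]
      -2≱0 ()
      eq : ∀ ξ δ ε → ε ℤ.+ + 2 ℤ.* ξ ℤ.- δ ℤ.+ (δ ℤ.- + 2 ℤ.* ξ ℤ.- ε ℤ.- + 2)
        ≡ -[1+ 1 ]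
      eq = solve-ℤ

  -- The diagonal D = G of `U`, where the ternary form degenerates to D² + 3X².
  V : ℤ × ℤ → Set
  V (D , X) = (0≤ D ℤ.- 1ℤ × ¬ 3∣ D × ¬ 3∣ D ℤ.+ X) × + 3 ℤ.* (X ℤ.* X) ℤ.+ D ℤ.* D ≡ N ℤ.+ 1ℤ

  private
    Multiple Congruent : ℤ × (ℤ × ℤ) → Set
    Multiple  (D , (X , G)) = 3∣ G
    Congruent (D , (X , G)) = 3∣ G ℤ.- D

    multiple? : Decidable Multiple
    multiple? (D , (X , G)) = + 3 Signed.∣? G

    congruent? : Decidable Congruent
    congruent? (D , (X , G)) = + 3 Signed.∣? G ℤ.- D

    r₁ : ∀ G X → G ℤ.+ G ℤ.- (G ℤ.+ ℤ.- X)
      ≡ G ℤ.+ X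
    r₁ = solve-ℤ

    r₂ : ∀ D X G → + 3 ℤ.* ((ℤ.- X) ℤ.* (ℤ.- X)) ℤ.+ D ℤ.* G
      ≡ + 3 ℤ.* (X ℤ.* X) ℤ.+ D ℤ.* G
    r₂ = solve-ℤ

    r₃ : ∀ D X G → G ℤ.- D ℤ.+ (D ℤ.+ X)
      ≡ G ℤ.+ X
    r₃ = solve-ℤ

    r₄ : ∀ D G → G ℤ.- D ℤ.- (G ℤ.- D ℤ.+ (G ℤ.- D))
      ≡ D ℤ.- G
    r₄ = solve-ℤ

    r₅ : ∀ D X G → + 3 ℤ.* (X ℤ.* X) ℤ.+ G ℤ.* D
      ≡ + 3 ℤ.* (X ℤ.* X) ℤ.+ D ℤ.* G
    r₅ = solve-ℤ

    r₆ : ∀ D G → G ℤ.- D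
      ≡ ℤ.- (D ℤ.- G)
    r₆ = solve-ℤ

    r₇ : ∀ D X G → G ℤ.+ D ℤ.- (D ℤ.+ ℤ.- X)
      ≡ G ℤ.+ X
    r₇ = solve-ℤ

    r₈ : ∀ D X G → + 3 ℤ.* ((ℤ.- X) ℤ.* (ℤ.- X)) ℤ.+ G ℤ.* D
      ≡ + 3 ℤ.* (X ℤ.* X) ℤ.+ D ℤ.* G
    r₈ = solve-ℤ

    mirror : Involution (U ∩ Multiple)
    mirror = involution (λ (D , (X , G)) → D , (ℤ.- X , G)) (λ (D , (X , G)) → X)
      (λ {(D , (X , G))} (((0<D , 0<G , 3∤D , 3∤) , eq) , 3∣G) →
        ((0<D , 0<G , 3∤D , λ d → 3∤ (subst 3∣_ (r₁ G X) (Signed.∣m∣n⇒∣m-n (Signed.∣m∣n⇒∣m+n 3∣G 3∣G) d))) , trans (r₂ D X G) eq) , 3∣G)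
      (λ {(D , (X , G))} _ → cong (λ X → D , (X , G)) (ℤ.neg-involutive X)) (λ _ → refl)

    exchange : Involution ((U ∩ ∁ Multiple) ∩ Congruent)
    exchange = involution (λ (D , (X , G)) → G , (X , D)) (λ (D , (X , G)) → D ℤ.- G)
      (λ {(D , (X , G))} ((((0<D , 0<G , 3∤D , 3∤) , eq) , 3∤G) , c) →
        (((0<G , 0<D , 3∤G , λ d → 3∤ (subst 3∣_ (r₃ D X G) (Signed.∣m∣n⇒∣m+n c d))) , trans (r₅ D X G) eq) , 3∤D) ,
        subst 3∣_ (r₄ D G) (Signed.∣m∣n⇒∣m-n c (Signed.∣m∣n⇒∣m+n c c)))
      (λ _ → refl) (λ (D , (X , G)) → r₆ D G)

    twist : Involution ((U ∩ ∁ Multiple) ∩ ∁ Congruent)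
    twist = involution (λ (D , (X , G)) → G , (ℤ.- X , D)) (λ (D , (X , G)) → D ℤ.- G)
      (λ {(D , (X , G))} ((((0<D , 0<G , 3∤D , 3∤) , eq) , 3∤G) , c) →
        (((0<G , 0<D , 3∤G , λ d → 3∤ (subst 3∣_ (r₇ D X G) (Signed.∣m∣n⇒∣m-n (opposite 3∤D 3∤G c) d))) , trans (r₈ D X G) eq) , 3∤D) ,
        λ c′ → c (subst 3∣_ (r₄ G D) (Signed.∣m∣n⇒∣m-n c′ (Signed.∣m∣n⇒∣m+n c′ c′))))
      (λ {(D , (X , G))} _ → cong (λ X → D , (X , G)) (ℤ.neg-involutive X)) (λ (D , (X , G)) → r₆ D G)

    3∣0 : ∀ {x} → x ≡ 0ℤ → 3∣ x
    3∣0 eq = Signed.divides 0ℤ eq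

    diagonal : (((U ∩ ∁ Multiple) ∩ Congruent) ∩ λ (D , (X , G)) → D ℤ.- G ≡ 0ℤ) ≅ V
    diagonal = bijection (λ (D , (X , _)) → D , X) (λ (D , X) → D , (X , D))
      (λ {(D , (X , G))} (((((0<D , _ , 3∤D , 3∤) , eq) , _) , _) , key) →
        let G≡D = sym (ℤ.i-j≡0⇒i≡j D G key) in
        (0<D , 3∤D , subst (λ G → ¬ 3∣ G ℤ.+ X) G≡D 3∤) , subst (λ G → + 3 ℤ.* (X ℤ.* X) ℤ.+ D ℤ.* G ≡ N ℤ.+ 1ℤ) G≡D eq)
      (λ {(D , X)} ((0<D , 3∤D , 3∤) , eq) →
        ((((0<D , 0<D , 3∤D , 3∤) , eq) , 3∤D) , 3∣0 (ℤ.+-inverseʳ D)) , ℤ.+-inverseʳ D)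
      (λ {(D , (X , G))} (_ , key) → cong (λ G → D , (X , G)) (ℤ.i-j≡0⇒i≡j D G key)) (λ _ → refl)

  finite-V : Finite V
  finite-V = transport diagonal (restrict (λ (D , (X , G)) → D ℤ.- G ℤ.≟ 0ℤ)
    (restrict congruent? (restrict (∁? multiple?) finite-U)))

  -- Three involutions: X ↦ -X if 3 divides G, the exchange of D and G if G ≡ D, and both at once if
  -- G ≡ -D (mod 3). The signs are dictated by 3 ∤ G + X. That condition also excludes X = 0 in the
  -- first case, and D = G contradicts the third, so only the second has fixed points.
  parity-U : parity finite-U ≡ parity finite-V
  parity-U = trans (parity-split multiple? finite-U) (trans (cong₂ _xor_
      (parity-free (restrict multiple? finite-U) mirror
        (λ { {(D , (X , G))} (((_ , _ , _ , 3∤) , _) , 3∣G) refl → 3∤ (subst 3∣_ (sym (ℤ.+-identityʳ G)) 3∣G) }))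
      (parity-split congruent? (restrict (∁? multiple?) finite-U)))
    (trans (cong₂ _xor_
      (trans (parity-involution F exchange) (parity-≅ diagonal (restrict (λ (D , (X , G)) → D ℤ.- G ℤ.≟ 0ℤ) F) finite-V))
      (parity-free (restrict (∁? congruent?) (restrict (∁? multiple?) finite-U)) twist
        (λ {(D , (X , G))} (_ , c) key → c (3∣0 (trans (r₆ D G) (cong ℤ.-_ key))))))
    (xor-identityʳ (parity finite-V))))
    where F = restrict congruent? (restrict (∁? multiple?) finite-U)

  -- Positivity of D is traded for D = 2 + 3i of either sign: D ≡ 1 is replaced by -D, and for D ≡ 2
  -- the sign of X is changed, so that 3 ∤ D + X becomes 3 ∤ X + 1 in both cases.
  W : ℤ × ℤ → Set
  W (X , i) = ¬ 3∣ X ℤ.+ 1ℤ × + 3 ℤ.* (X ℤ.* X) ℤ.+ (+ 2 ℤ.+ i ℤ.* + 3) ℤ.* (+ 2 ℤ.+ i ℤ.* + 3) ≡ N ℤ.+ 1ℤ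

  private
    NonNegative : ℤ × ℤ → Set
    NonNegative (X , i) = 0≤ i

    nonNegative? : Decidable NonNegative
    nonNegative? (X , i) = 0ℤ ℤ.≤? i

    s₁ : ∀ X δ → + 2 ℤ.+ δ ℤ.* + 3 ℤ.+ X
      ≡ (ℤ.- X ℤ.+ 1ℤ) ℤ.* -[1+ 0 ] ℤ.+ (δ ℤ.+ 1ℤ) ℤ.* + 3
    s₁ = solve-ℤ

    s₂ : ∀ X δ → + 3 ℤ.* ((ℤ.- X) ℤ.* (ℤ.- X)) ℤ.+ (+ 2 ℤ.+ δ ℤ.* + 3) ℤ.* (+ 2 ℤ.+ δ ℤ.* + 3)
      ≡ + 3 ℤ.* (X ℤ.* X) ℤ.+ (+ 2 ℤ.+ δ ℤ.* + 3) ℤ.* (+ 2 ℤ.+ δ ℤ.* + 3)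
    s₂ = solve-ℤ

    s₃ : ∀ X i → X ℤ.+ 1ℤ
      ≡ (+ 2 ℤ.+ i ℤ.* + 3 ℤ.+ ℤ.- X) ℤ.* -[1+ 0 ] ℤ.+ (i ℤ.+ 1ℤ) ℤ.* + 3
    s₃ = solve-ℤ

    s₄ : ∀ X i → + 3 ℤ.* ((ℤ.- X) ℤ.* (ℤ.- X)) ℤ.+ (+ 2 ℤ.+ i ℤ.* + 3) ℤ.* (+ 2 ℤ.+ i ℤ.* + 3)
      ≡ + 3 ℤ.* (X ℤ.* X) ℤ.+ (+ 2 ℤ.+ i ℤ.* + 3) ℤ.* (+ 2 ℤ.+ i ℤ.* + 3)
    s₄ = solve-ℤ

    s₅ : ∀ X δ → + 1 ℤ.+ δ ℤ.* + 3 ℤ.+ X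
      ≡ (X ℤ.+ 1ℤ) ℤ.* 1ℤ ℤ.+ δ ℤ.* + 3
    s₅ = solve-ℤ

    s₆ : ∀ X δ → + 3 ℤ.* (X ℤ.* X) ℤ.+ (+ 2 ℤ.+ (-[1+ 0 ] ℤ.- δ) ℤ.* + 3) ℤ.* (+ 2 ℤ.+ (-[1+ 0 ] ℤ.- δ) ℤ.* + 3)
      ≡ + 3 ℤ.* (X ℤ.* X) ℤ.+ (+ 1 ℤ.+ δ ℤ.* + 3) ℤ.* (+ 1 ℤ.+ δ ℤ.* + 3)
    s₆ = solve-ℤ

    s₇ : ∀ X i → X ℤ.+ 1ℤ
      ≡ (+ 1 ℤ.+ (-[1+ 0 ] ℤ.- i) ℤ.* + 3 ℤ.+ X) ℤ.* 1ℤ ℤ.+ (i ℤ.+ 1ℤ) ℤ.* + 3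
    s₇ = solve-ℤ

    s₈ : ∀ X i → + 3 ℤ.* (X ℤ.* X) ℤ.+ (+ 1 ℤ.+ (-[1+ 0 ] ℤ.- i) ℤ.* + 3) ℤ.* (+ 1 ℤ.+ (-[1+ 0 ] ℤ.- i) ℤ.* + 3)
      ≡ + 3 ℤ.* (X ℤ.* X) ℤ.+ (+ 2 ℤ.+ i ℤ.* + 3) ℤ.* (+ 2 ℤ.+ i ℤ.* + 3)
    s₈ = solve-ℤ

    s₉ : ∀ i → -[1+ 0 ] ℤ.- (-[1+ 0 ] ℤ.- i)
      ≡ i
    s₉ = solve-ℤ

    V₂≅ : Residue 3 V 2 ≅ (W ∩ NonNegative)
    V₂≅ = bijection (λ (δ , X) → ℤ.- X , δ) (λ (X , i) → i , ℤ.- X)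
      (λ {(δ , X)} ((0<D , _ , 3∤) , eq) → (∤-transfer -[1+ 0 ] (δ ℤ.+ 1ℤ) (s₁ X δ) 3∤ , trans (s₂ X δ) eq) , positive⁻ {1} (s≤s (s≤s z≤n)) 0<D)
      (λ {(X , i)} ((3∤ , eq) , 0≤i) → (positive⁺ 1 0≤i , ∤-residue 2 i 3∤2 , ∤-transfer -[1+ 0 ] (i ℤ.+ 1ℤ) (s₃ X i) 3∤) , trans (s₄ X i) eq)
      (λ {(δ , X)} _ → cong (δ ,_) (ℤ.neg-involutive X)) (λ {(X , i)} _ → cong (_, i) (ℤ.neg-involutive X))

    V₁≅ : Residue 3 V 1 ≅ (W ∩ ∁ NonNegative)
    V₁≅ = bijection (λ (δ , X) → X , -[1+ 0 ] ℤ.- δ) (λ (X , i) → -[1+ 0 ] ℤ.- i , X)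
      (λ {(δ , X)} ((0<D , _ , 3∤) , eq) → (∤-transfer 1ℤ δ (s₅ X δ) 3∤ , trans (s₆ X δ) eq) , 0≤⇒0≰ (positive⁻ {0} {δ} (s≤s z≤n) 0<D))
      (λ {(X , i)} ((3∤ , eq) , 0≰i) → (positive⁺ 0 (0≰⇒ 0≰i) , ∤-residue 1 (-[1+ 0 ] ℤ.- i) 3∤1 , ∤-transfer 1ℤ (i ℤ.+ 1ℤ) (s₇ X i) 3∤) , trans (s₈ X i) eq)
      (λ {(δ , X)} _ → cong (_, X) (s₉ δ)) (λ {(X , i)} _ → cong (X ,_) (s₉ i))

    V₁ = residue 3 V finite-V {1} (s≤s (s≤s z≤n))
    V₂ = residue 3 V finite-V {2} (s≤s (s≤s (s≤s z≤n)))

  finite-W : Finite W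
  finite-W = transport (bijection id id (λ {x} → [ proj₁ , proj₁ ]) (λ {x} → decide {x}) (λ _ → refl) (λ _ → refl))
    (finite-∪ (transport V₂≅ V₂) (transport V₁≅ V₁) (λ (_ , p) (_ , ¬p) → ¬p p))
    where
    decide : ∀ {x} → W x → (W ∩ NonNegative) x ⊎ (W ∩ ∁ NonNegative) x
    decide {x} p with nonNegative? x
    ... | yes q = inj₁ (p , q)
    ... | no ¬q = inj₂ (p , ¬q)

  parity-V : parity finite-V ≡ parity finite-W
  parity-V = trans (parity-mod3 finite-V) (trans (cong (_xor (parity V₁ xor parity V₂))
      (parity-∅ (residue 3 V finite-V {0} (s≤s z≤n)) (λ (δ , _) ((_ , 3∤D , _) , _) → 3∤D (Signed.divides δ (ℤ.+-identityˡ _)))))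
    (trans (xor-comm (parity V₁) (parity V₂))
      (sym (trans (parity-split nonNegative? finite-W)
        (cong₂ _xor_ (sym (parity-≅ V₂≅ V₂ (restrict nonNegative? finite-W)))
                     (sym (parity-≅ V₁≅ V₁ (restrict (∁? nonNegative?) finite-W))))))))

  private
    -- `A₀` and `A₁` are the classes X = 3j and X = 3j + 1 of `W`, sheared by c = i + j so that the
    -- parity of c decides that of D + X. With k = c + l, a = 6k - 1 and b = 6l - 1, the equation of
    -- `C` is a² + 3b² = 4(n + 1).
    A₀ A₁ C : ℤ × ℤ → Set
    A₀ (c , j) = + 3 ℤ.* ((+ 0 ℤ.+ j ℤ.* + 3) ℤ.* (+ 0 ℤ.+ j ℤ.* + 3)) ℤ.+ (+ 2 ℤ.+ (c ℤ.- j) ℤ.* + 3) ℤ.* (+ 2 ℤ.+ (c ℤ.- j) ℤ.* + 3) ≡ N ℤ.+ 1ℤ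
    A₁ (c , j) = + 3 ℤ.* ((+ 1 ℤ.+ j ℤ.* + 3) ℤ.* (+ 1 ℤ.+ j ℤ.* + 3)) ℤ.+ (+ 2 ℤ.+ (c ℤ.- j) ℤ.* + 3) ℤ.* (+ 2 ℤ.+ (c ℤ.- j) ℤ.* + 3) ≡ N ℤ.+ 1ℤ
    C (c , l) = + 9 ℤ.* ((c ℤ.+ l) ℤ.* (c ℤ.+ l)) ℤ.- + 3 ℤ.* (c ℤ.+ l) ℤ.+ (+ 27 ℤ.* (l ℤ.* l) ℤ.- + 9 ℤ.* l) ≡ N

    f₁ : ∀ j → + 1
      ≡ (+ 0 ℤ.+ j ℤ.* + 3 ℤ.+ 1ℤ) ℤ.* 1ℤ ℤ.+ (ℤ.- j) ℤ.* + 3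
    f₁ = solve-ℤ

    f₂ : ∀ j → + 2
      ≡ (+ 1 ℤ.+ j ℤ.* + 3 ℤ.+ 1ℤ) ℤ.* 1ℤ ℤ.+ (ℤ.- j) ℤ.* + 3
    f₂ = solve-ℤ

    f₃ : ∀ i j → i ℤ.+ j ℤ.- j
      ≡ i
    f₃ = solve-ℤ

    f₄ : ∀ c j → c ℤ.- j ℤ.+ j
      ≡ c
    f₄ = solve-ℤ

    shear₀ : Residue 3 W 0 ≅ A₀
    shear₀ = bijection (λ (j , i) → i ℤ.+ j , j) (λ (c , j) → j , c ℤ.- j)
      (λ {(j , i)} (_ , eq) → trans (cong (λ i → + 3 ℤ.* ((+ 0 ℤ.+ j ℤ.* + 3) ℤ.* (+ 0 ℤ.+ j ℤ.* + 3)) ℤ.+ (+ 2 ℤ.+ i ℤ.* + 3) ℤ.* (+ 2 ℤ.+ i ℤ.* + 3)) (f₃ i j)) eq)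
      (λ {(c , j)} eq → ∤-transfer 1ℤ (ℤ.- j) (f₁ j) 3∤1 , eq)
      (λ {(j , i)} _ → cong (j ,_) (f₃ i j)) (λ {(c , j)} _ → cong (_, j) (f₄ c j))

    shear₁ : Residue 3 W 1 ≅ A₁
    shear₁ = bijection (λ (j , i) → i ℤ.+ j , j) (λ (c , j) → j , c ℤ.- j)
      (λ {(j , i)} (_ , eq) → trans (cong (λ i → + 3 ℤ.* ((+ 1 ℤ.+ j ℤ.* + 3) ℤ.* (+ 1 ℤ.+ j ℤ.* + 3)) ℤ.+ (+ 2 ℤ.+ i ℤ.* + 3) ℤ.* (+ 2 ℤ.+ i ℤ.* + 3)) (f₃ i j)) eq)
      (λ {(c , j)} eq → ∤-transfer 1ℤ (ℤ.- j) (f₂ j) 3∤2 , eq)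
      (λ {(j , i)} _ → cong (j ,_) (f₃ i j)) (λ {(c , j)} _ → cong (_, j) (f₄ c j))

    g₁ : ∀ t j → + 3 ℤ.* ((+ 1 ℤ.+ t ℤ.* + 3) ℤ.* (+ 1 ℤ.+ t ℤ.* + 3)) ℤ.+ (+ 2 ℤ.+ ((+ 1 ℤ.+ (j ℤ.- 1ℤ) ℤ.* + 2) ℤ.- t) ℤ.* + 3) ℤ.* (+ 2 ℤ.+ ((+ 1 ℤ.+ (j ℤ.- 1ℤ) ℤ.* + 2) ℤ.- t) ℤ.* + 3)
      ≡ + 3 ℤ.* ((+ 0 ℤ.+ j ℤ.* + 3) ℤ.* (+ 0 ℤ.+ j ℤ.* + 3)) ℤ.+ (+ 2 ℤ.+ ((+ 0 ℤ.+ t ℤ.* + 2) ℤ.- j) ℤ.* + 3) ℤ.* (+ 2 ℤ.+ ((+ 0 ℤ.+ t ℤ.* + 2) ℤ.- j) ℤ.* + 3)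
    g₁ = solve-ℤ

    g₂ : ∀ u j → + 3 ℤ.* ((+ 0 ℤ.+ (u ℤ.+ 1ℤ) ℤ.* + 3) ℤ.* (+ 0 ℤ.+ (u ℤ.+ 1ℤ) ℤ.* + 3)) ℤ.+ (+ 2 ℤ.+ ((+ 0 ℤ.+ j ℤ.* + 2) ℤ.- (u ℤ.+ 1ℤ)) ℤ.* + 3) ℤ.* (+ 2 ℤ.+ ((+ 0 ℤ.+ j ℤ.* + 2) ℤ.- (u ℤ.+ 1ℤ)) ℤ.* + 3)
      ≡ + 3 ℤ.* ((+ 1 ℤ.+ j ℤ.* + 3) ℤ.* (+ 1 ℤ.+ j ℤ.* + 3)) ℤ.+ (+ 2 ℤ.+ ((+ 1 ℤ.+ u ℤ.* + 2) ℤ.- j) ℤ.* + 3) ℤ.* (+ 2 ℤ.+ ((+ 1 ℤ.+ u ℤ.* + 2) ℤ.- j) ℤ.* + 3)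
    g₂ = solve-ℤ

    g₃ : ∀ j → j ℤ.- 1ℤ ℤ.+ 1ℤ
      ≡ j
    g₃ = solve-ℤ

    g₄ : ∀ j → j ℤ.+ 1ℤ ℤ.- 1ℤ
      ≡ j
    g₄ = solve-ℤ

    g₅ : ∀ t j → + 9 ℤ.* ((+ 0 ℤ.+ (ℤ.- j) ℤ.* + 2 ℤ.+ (t ℤ.+ 1ℤ)) ℤ.* (+ 0 ℤ.+ (ℤ.- j) ℤ.* + 2 ℤ.+ (t ℤ.+ 1ℤ))) ℤ.- + 3 ℤ.* (+ 0 ℤ.+ (ℤ.- j) ℤ.* + 2 ℤ.+ (t ℤ.+ 1ℤ)) ℤ.+ (+ 27 ℤ.* ((t ℤ.+ 1ℤ) ℤ.* (t ℤ.+ 1ℤ)) ℤ.- + 9 ℤ.* (t ℤ.+ 1ℤ)) ℤ.+ 1ℤ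
      ≡ + 3 ℤ.* ((+ 0 ℤ.+ j ℤ.* + 3) ℤ.* (+ 0 ℤ.+ j ℤ.* + 3)) ℤ.+ (+ 2 ℤ.+ ((+ 1 ℤ.+ t ℤ.* + 2) ℤ.- j) ℤ.* + 3) ℤ.* (+ 2 ℤ.+ ((+ 1 ℤ.+ t ℤ.* + 2) ℤ.- j) ℤ.* + 3)
    g₅ = solve-ℤ

    g₆ : ∀ c l → + 3 ℤ.* ((+ 0 ℤ.+ (ℤ.- c) ℤ.* + 3) ℤ.* (+ 0 ℤ.+ (ℤ.- c) ℤ.* + 3)) ℤ.+ (+ 2 ℤ.+ ((+ 1 ℤ.+ (l ℤ.- 1ℤ) ℤ.* + 2) ℤ.- (ℤ.- c)) ℤ.* + 3) ℤ.* (+ 2 ℤ.+ ((+ 1 ℤ.+ (l ℤ.- 1ℤ) ℤ.* + 2) ℤ.- (ℤ.- c)) ℤ.* + 3)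
      ≡ + 9 ℤ.* ((+ 0 ℤ.+ c ℤ.* + 2 ℤ.+ l) ℤ.* (+ 0 ℤ.+ c ℤ.* + 2 ℤ.+ l)) ℤ.- + 3 ℤ.* (+ 0 ℤ.+ c ℤ.* + 2 ℤ.+ l) ℤ.+ (+ 27 ℤ.* (l ℤ.* l) ℤ.- + 9 ℤ.* l) ℤ.+ 1ℤ
    g₆ = solve-ℤ

    g₇ : ∀ u j → + 9 ℤ.* ((+ 1 ℤ.+ u ℤ.* + 2 ℤ.+ (j ℤ.- u)) ℤ.* (+ 1 ℤ.+ u ℤ.* + 2 ℤ.+ (j ℤ.- u))) ℤ.- + 3 ℤ.* (+ 1 ℤ.+ u ℤ.* + 2 ℤ.+ (j ℤ.- u)) ℤ.+ (+ 27 ℤ.* ((j ℤ.- u) ℤ.* (j ℤ.- u)) ℤ.- + 9 ℤ.* (j ℤ.- u)) ℤ.+ 1ℤ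
      ≡ + 3 ℤ.* ((+ 1 ℤ.+ j ℤ.* + 3) ℤ.* (+ 1 ℤ.+ j ℤ.* + 3)) ℤ.+ (+ 2 ℤ.+ ((+ 0 ℤ.+ u ℤ.* + 2) ℤ.- j) ℤ.* + 3) ℤ.* (+ 2 ℤ.+ ((+ 0 ℤ.+ u ℤ.* + 2) ℤ.- j) ℤ.* + 3)
    g₇ = solve-ℤ

    g₈ : ∀ c l → + 3 ℤ.* ((+ 1 ℤ.+ (l ℤ.+ c) ℤ.* + 3) ℤ.* (+ 1 ℤ.+ (l ℤ.+ c) ℤ.* + 3)) ℤ.+ (+ 2 ℤ.+ ((+ 0 ℤ.+ c ℤ.* + 2) ℤ.- (l ℤ.+ c)) ℤ.* + 3) ℤ.* (+ 2 ℤ.+ ((+ 0 ℤ.+ c ℤ.* + 2) ℤ.- (l ℤ.+ c)) ℤ.* + 3)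
      ≡ + 9 ℤ.* ((+ 1 ℤ.+ c ℤ.* + 2 ℤ.+ l) ℤ.* (+ 1 ℤ.+ c ℤ.* + 2 ℤ.+ l)) ℤ.- + 3 ℤ.* (+ 1 ℤ.+ c ℤ.* + 2 ℤ.+ l) ℤ.+ (+ 27 ℤ.* (l ℤ.* l) ℤ.- + 9 ℤ.* l) ℤ.+ 1ℤ
    g₈ = solve-ℤ

    -- The norm form d² + 3X² = 4(s² − sX + X²), d = 2s − X, is symmetric in s and X.
    turn : Residue 2 A₀ 0 ≅ Residue 2 A₁ 1
    turn = bijection (λ (t , j) → j ℤ.- 1ℤ , t) (λ (u , j) → j , u ℤ.+ 1ℤ)
      (λ {(t , j)} eq → trans (g₁ t j) eq) (λ {(u , j)} eq → trans (g₂ u j) eq)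
      (λ {(t , j)} _ → cong (t ,_) (g₃ j)) (λ {(u , j)} _ → cong (_, j) (g₄ u))

    -- For k - l even, D = (a + 3b)/4 and X = (b - a)/4. In `uneven`, where k - l is odd, D = (a -
    -- 3b)/4 and X = (a + b)/4.
    even : Residue 2 A₀ 1 ≅ Residue 2 C 0
    even = bijection (λ (t , j) → ℤ.- j , t ℤ.+ 1ℤ) (λ (c , l) → l ℤ.- 1ℤ , ℤ.- c)
      (λ {(t , j)} eq → ∙-cancelʳ 1ℤ _ N (trans (g₅ t j) eq)) (λ {(c , l)} eq → trans (g₆ c l) (cong (ℤ._+ 1ℤ) eq))
      (λ {(t , j)} _ → cong₂ _,_ (g₄ t) (ℤ.neg-involutive j)) (λ {(c , l)} _ → cong₂ _,_ (ℤ.neg-involutive c) (g₃ l))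

    uneven : Residue 2 A₁ 0 ≅ Residue 2 C 1
    uneven = bijection (λ (u , j) → u , j ℤ.- u) (λ (c , l) → c , l ℤ.+ c)
      (λ {(u , j)} eq → ∙-cancelʳ 1ℤ _ N (trans (g₇ u j) eq)) (λ {(c , l)} eq → trans (g₈ c l) (cong (ℤ._+ 1ℤ) eq))
      (λ {(u , j)} _ → cong (u ,_) (f₄ j u)) (λ {(c , l)} _ → cong (c ,_) (f₃ l c))

    xor-telescope : ∀ a b c → (a xor b) xor (c xor a) ≡ b xor c
    xor-telescope true  true  true  = refl
    xor-telescope true  true  false = refl
    xor-telescope true  false true  = refl
    xor-telescope true  false false = refl
    xor-telescope false b c = cong (b xor_) (xor-identityʳ c)

  -- D + X is even for c even in `A₀` and for c odd in `A₁`; `turn` matches these two sets, which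
  -- therefore cancel. The points with D + X odd make up `C`.
  parity-W : (F : Finite C) → parity finite-W ≡ parity F
  parity-W F = trans (parity-mod3 finite-W) (trans
    (cong₂ _xor_ (trans (parity-≅ shear₀ W₀ F₀) (parity-mod2 F₀))
      (trans (cong (parity W₁ xor_) (parity-∅ W₂ (λ (j , _) (3∤ , _) → 3∤ (Signed.divides (j ℤ.+ 1ℤ) (h j)))))
        (trans (xor-identityʳ (parity W₁)) (trans (parity-≅ shear₁ W₁ F₁) (parity-mod2 F₁)))))
    (trans (cong (λ b → (parity F₀₀ xor parity F₀₁) xor (parity F₁₀ xor b)) (sym (parity-≅ turn F₀₀ F₁₁)))
    (trans (xor-telescope (parity F₀₀) (parity F₀₁) (parity F₁₀))
    (trans (cong₂ _xor_ (parity-≅ even F₀₁ C₀) (parity-≅ uneven F₁₀ C₁)) (sym (parity-mod2 F))))))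
    where
    W₀ = residue 3 W finite-W {0} (s≤s z≤n)
    W₁ = residue 3 W finite-W {1} (s≤s (s≤s z≤n))
    W₂ = residue 3 W finite-W {2} (s≤s (s≤s (s≤s z≤n)))
    F₀ = transport shear₀ W₀
    F₁ = transport shear₁ W₁
    F₀₀ = residue 2 A₀ F₀ {0} (s≤s z≤n)
    F₀₁ = residue 2 A₀ F₀ {1} (s≤s (s≤s z≤n))
    F₁₀ = residue 2 A₁ F₁ {0} (s≤s z≤n)
    F₁₁ = residue 2 A₁ F₁ {1} (s≤s (s≤s z≤n))
    C₀ = residue 2 C F {0} (s≤s z≤n)
    C₁ = residue 2 C F {1} (s≤s (s≤s z≤n))
    h : ∀ j → + 2 ℤ.+ j ℤ.* + 3 ℤ.+ 1ℤ
      ≡ (j ℤ.+ 1ℤ) ℤ.* + 3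
    h = solve-ℤ

  private
    degree-θ₁₅ : ∀ k → + θ-exponent 1 5 k ≡ + 3 ℤ.* (k ℤ.* k) ℤ.- + 2 ℤ.* k
    degree-θ₁₅ k = halve (trans (θ-quadratic 1 5 k) (eq k))
      where
      eq : ∀ k → (+ 1 ℤ.+ + 5) ℤ.* (k ℤ.* k) ℤ.+ (+ 1 ℤ.- + 5) ℤ.* k
        ≡ + 2 ℤ.* (+ 3 ℤ.* (k ℤ.* k) ℤ.- + 2 ℤ.* k)
      eq = solve-ℤ

    degree-𝓛 : ∀ a b → + (3 * (a * b) + 2 * a + b) ≡ + 3 ℤ.* (+ a ℤ.* + b) ℤ.+ + 2 ℤ.* + a ℤ.+ + b
    degree-𝓛 a b = trans (ℤ.pos-+ (3 * (a * b) + 2 * a) b) (cong (ℤ._+ + b)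
      (trans (ℤ.pos-+ (3 * (a * b)) (2 * a)) (cong₂ ℤ._+_
        (trans (ℤ.pos-* 3 (a * b)) (cong (λ z → + 3 ℤ.* z) (ℤ.pos-* a b))) (ℤ.pos-* 2 a))))

    degree-pair : ∀ a b k → + (3 * (a * b) + 2 * a + b + θ-exponent 1 5 k) ≡
      + 3 ℤ.* ((ℤ.- k) ℤ.* (ℤ.- k)) ℤ.+ + 2 ℤ.* (ℤ.- k) ℤ.+ + 3 ℤ.* ((+ a) ℤ.* (+ b)) ℤ.+ + 2 ℤ.* (+ a) ℤ.+ (+ b)
    degree-pair a b k = trans (ℤ.pos-+ (3 * (a * b) + 2 * a + b) (θ-exponent 1 5 k))
      (trans (cong₂ ℤ._+_ (degree-𝓛 a b) (degree-θ₁₅ k)) (eq (+ a) (+ b) k))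
      where
      eq : ∀ a b k → + 3 ℤ.* (a ℤ.* b) ℤ.+ + 2 ℤ.* a ℤ.+ b ℤ.+ (+ 3 ℤ.* (k ℤ.* k) ℤ.- + 2 ℤ.* k)
        ≡ + 3 ℤ.* ((ℤ.- k) ℤ.* (ℤ.- k)) ℤ.+ + 2 ℤ.* (ℤ.- k) ℤ.+ + 3 ℤ.* (a ℤ.* b) ℤ.+ + 2 ℤ.* a ℤ.+ b
      eq = solve-ℤ

  -- With ξ = -k, that is x = 1 - 3k, the theta exponent k(3k - 2) is (x² - 1)/3.
  pair≅S : Pair 𝓛 (θ 1 5) n ≅ S
  pair≅S = bijection
    (λ ((a , b) , k) → ℤ.- k , (+ a , + b)) (λ (ξ , (δ , ε)) → (ℤ.∣ δ ∣ , ℤ.∣ ε ∣) , ℤ.- ξ)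
    (λ {((a , b) , k)} ((3∤ , _) , eq) → (ℤ.+≤+ z≤n , ℤ.+≤+ z≤n , 3∤) , trans (sym (degree-pair a b k)) (cong +_ eq))
    (λ { {(ξ , (+ a , + b))} ((_ , _ , 3∤) , eq) → (3∤ , tt) , ℤ.+-injective (trans (degree-pair a b (ℤ.- ξ))
           (trans (cong (λ ξ → + 3 ℤ.* (ξ ℤ.* ξ) ℤ.+ + 2 ℤ.* ξ ℤ.+ + 3 ℤ.* ((+ a) ℤ.* (+ b)) ℤ.+ + 2 ℤ.* (+ a) ℤ.+ (+ b)) (ℤ.neg-involutive ξ)) eq))
       ; {(ξ , (-[1+ _ ] , _))} ((() , _) , _)
       ; {(ξ , (+ _ , -[1+ _ ]))} ((_ , () , _) , _) })
    (λ {((a , b) , k)} _ → cong ((a , b) ,_) (ℤ.neg-involutive k))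
    (λ { {(ξ , (+ a , + b))} _ → cong (_, (+ a , + b)) (ℤ.neg-involutive ξ)
       ; {(ξ , (-[1+ _ ] , _))} ((() , _) , _)
       ; {(ξ , (+ _ , -[1+ _ ]))} ((_ , () , _) , _) })

  pair≅C : Pair (θ 6 12) (θ 18 36) n ≅ C
  pair≅C = bijection (λ (k , l) → k ℤ.- l , l) (λ (c , l) → c ℤ.+ l , l)
    (λ {(k , l)} (_ , eq) → trans (cong (λ k → + 9 ℤ.* (k ℤ.* k) ℤ.- + 3 ℤ.* k ℤ.+ (+ 27 ℤ.* (l ℤ.* l) ℤ.- + 9 ℤ.* l)) (f₄ k l)) (trans (sym (energy k l)) (cong +_ eq)))
    (λ {(c , l)} eq → (tt , tt) , ℤ.+-injective (trans (energy (c ℤ.+ l) l) eq))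
    (λ {(k , l)} _ → cong (_, l) (f₄ k l)) (λ {(c , l)} _ → cong (_, l) (f₃ c l))
    where
    degree₆ : ∀ k → + θ-exponent 6 12 k ≡ + 9 ℤ.* (k ℤ.* k) ℤ.- + 3 ℤ.* k
    degree₆ k = halve (trans (θ-pentagonal 6 k) (eq k))
      where
      eq : ∀ k → + 6 ℤ.* (+ 3 ℤ.* (k ℤ.* k) ℤ.- k)
        ≡ + 2 ℤ.* (+ 9 ℤ.* (k ℤ.* k) ℤ.- + 3 ℤ.* k)
      eq = solve-ℤ

    degree₁₈ : ∀ k → + θ-exponent 18 36 k ≡ + 27 ℤ.* (k ℤ.* k) ℤ.- + 9 ℤ.* k
    degree₁₈ k = halve (trans (θ-pentagonal 18 k) (eq k))
      where
      eq : ∀ k → + 18 ℤ.* (+ 3 ℤ.* (k ℤ.* k) ℤ.- k)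
        ≡ + 2 ℤ.* (+ 27 ℤ.* (k ℤ.* k) ℤ.- + 9 ℤ.* k)
      eq = solve-ℤ

    energy : ∀ k l → + (θ-exponent 6 12 k + θ-exponent 18 36 l) ≡ + 9 ℤ.* (k ℤ.* k) ℤ.- + 3 ℤ.* k ℤ.+ (+ 27 ℤ.* (l ℤ.* l) ℤ.- + 9 ℤ.* l)
    energy k l = trans (ℤ.pos-+ (θ-exponent 6 12 k) (θ-exponent 18 36 l)) (cong₂ ℤ._+_ (degree₆ k) (degree₁₈ l))

ternary-identity : generate 𝓛 · generate (θ 1 5) ≈ generate (θ 6 12) · generate (θ 18 36)
ternary-identity = pointwise λ n → let open Ternary n
                                       P = finite-pair 𝓛 (θ 1 5) n; K = finite-pair (θ 6 12) (θ 18 36) n in begin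
  (generate 𝓛 · generate (θ 1 5)) n             ≡⟨ generate-· 𝓛 (θ 1 5) P ⟩
  parity P                                      ≡⟨ parity-≅ pair≅S P (transport pair≅S P) ⟩
  parity (transport pair≅S P)                   ≡⟨ parity-S (transport pair≅S P) ⟩
  parity finite-U                               ≡⟨ parity-U ⟩
  parity finite-V                               ≡⟨ parity-V ⟩
  parity finite-W                               ≡⟨ parity-W (transport pair≅C K) ⟩
  parity (transport pair≅C K)                   ≡⟨ parity-≅ pair≅C K (transport pair≅C K) ⟨
  parity K                                      ≡⟨ generate-· (θ 6 12) (θ 18 36) K ⟨
  (generate (θ 6 12) · generate (θ 18 36)) n    ∎
  where open ≡-Reasoning

-- Odd parts

private
  f g h L : Series
  f = ∏ 1 1
  g = ∏ 3 3
  h = ∏ 9 9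
  L = generate 𝓛

  q : Series
  q = mono 1

fourth : Series → Series
fourth x = x · x · (x · x)

-- The factor g · g completes the left side to L g³, to which `three-core` and then the ternary
-- identity apply; the resulting f₆f₁₈ ≡ g²h² gives the factor back.
𝓛-product : L · g ≈ f · (h · h)
𝓛-product = cancel (g · g) refl (begin
  g · g · (L · g)             ≈⟨ solve 2 (λ l g → g :* g :* (l :* g) := l :* (g :* (g :* g))) R.refl L g ⟩
  L · cube g                  ≈⟨ R.*-congˡ three-core ⟨
  L · (generate (θ 1 5) · f)  ≈⟨ R.sym (R.*-assoc L (generate (θ 1 5)) f) ⟩
  L · generate (θ 1 5) · f    ≈⟨ R.*-congʳ ternary-identity ⟩
  generate (θ 6 12) · generate (θ 18 36) · f
    ≈⟨ R.*-congʳ (R.*-cong (R.trans (pentagonal 6) (∏-square 3 3)) (R.trans (pentagonal 18) (∏-square 9 9))) ⟩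
  g · g · (h · h) · f         ≈⟨ solve 3 (λ f g h → g :* g :* (h :* h) :* f := g :* g :* (f :* (h :* h))) R.refl f g h ⟩
  g · g · (f · (h · h))       ∎)
  where open ≈-Reasoning

cube-f : cube f ≈ g ⊕ q · cube h
cube-f = R.trans (R.sym (triangular 1)) (R.trans triangular-dissection
  (R.+-cong (pentagonal 3) (R.*-congˡ (triangular 9))))

cube-gh : cube g · cube h ≈ cube (fourth g) ⊕ mono 3 · cube (fourth h)
cube-gh = R.trans (R.sym (R.*-cong (triangular 3) (triangular 9))) (R.trans triangular-product
  (R.+-cong (R.trans (triangular 12) (cube-cong (R.trans (∏-square 6 6) (R.*-cong (∏-square 3 3) (∏-square 3 3)))))
            (R.*-congˡ (R.trans (triangular 36) (cube-cong (R.trans (∏-square 18 18) (R.*-cong (∏-square 9 9) (∏-square 9 9))))))))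
  where
  cube-cong : ∀ {x y} → x ≈ y → cube x ≈ cube y
  cube-cong e = R.*-cong e (R.*-cong e e)

D-mono : ∀ s → odd s ≡ true → D (mono s) ≈ mono s
D-mono s odd-s = pointwise go
  where
  go : ∀ n → odd n ∧ mono s n ≡ mono s n
  go n with s ℕ.≟ n
  ... | yes refl = trans (cong (_∧ mono s s) odd-s) refl

  ... | no s≢n rewrite mono-≢ s≢n = ∧-zeroʳ (odd n)

D-mono-square : ∀ s x → odd s ≡ true → D (mono s · (x · x)) ≈ mono s · (x · x)
D-mono-square s x odd-s = R.trans (D-cong (R.*-comm (mono s) (x · x)))
  (R.trans (D-square-· x (mono s)) (R.trans (R.*-congˡ (D-mono s odd-s)) (R.*-comm (x · x) (mono s))))

-- (gh)³ is the square (gh)² times gh, so `D` acts on the last factor alone. On the other side of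
-- `cube-gh` the first term is a square and disappears, while the second is q³ times a square and is
-- left unchanged.
D-gh : g · h · (g · h) · D (g · h) ≈ mono 3 · cube (fourth h)
D-gh = begin
  g · h · (g · h) · D (g · h)             ≈⟨ D-square-· (g · h) (g · h) ⟨
  D (g · h · (g · h) · (g · h))           ≈⟨ D-cong (solve 2 (λ g h → g :* h :* (g :* h) :* (g :* h) := g :* (g :* g) :* (h :* (h :* h))) R.refl g h) ⟩
  D (cube g · cube h)                     ≈⟨ D-cong cube-gh ⟩
  D (cube (fourth g) ⊕ mono 3 · cube (fourth h))
    ≈⟨ D-⊕ (cube (fourth g)) (mono 3 · cube (fourth h)) ⟩
  D (cube (fourth g)) ⊕ D (mono 3 · cube (fourth h))
    ≈⟨ R.+-cong (R.trans (D-cong (square g)) (D-square (cube (g · g)))) (D-cong (R.*-congˡ (square h))) ⟩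
  𝟘 ⊕ D (mono 3 · (cube (h · h) · cube (h · h)))
    ≈⟨ R.trans (R.+-identityˡ _) (D-mono-square 3 (cube (h · h)) refl) ⟩
  mono 3 · (cube (h · h) · cube (h · h))  ≈⟨ R.*-congˡ (square h) ⟨
  mono 3 · cube (fourth h)                ∎
  where
  open ≈-Reasoning
  square : ∀ x → cube (fourth x) ≈ cube (x · x) · cube (x · x)
  square = solve 1 (λ x → (x :* x :* (x :* x)) :* ((x :* x :* (x :* x)) :* (x :* x :* (x :* x)))
    := (x :* x :* (x :* x :* (x :* x))) :* (x :* x :* (x :* x :* (x :* x)))) R.refl

-- As f⁴ is a square, f⁴ · D b₉ is the odd part of f³ · b₉f = gh + qh⁴. Multiplied by g²h², it
-- becomes q³h¹² + qg²h⁶ = qh⁶(g + qh³)² = qh⁶f⁶, and h⁴f² = (Lg)² identifies the result.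
D-b₉ : D b₉ ≈ q · (L · L)
D-b₉ = cancel (g · g) refl (cancel (fourth f · (h · h)) refl (begin
  fourth f · (h · h) · (g · g · D b₉)
    ≈⟨ solve 4 (λ f g h d → f :* (h :* h) :* (g :* g :* d) := g :* h :* (g :* h) :* (f :* d)) R.refl (fourth f) g h (D b₉) ⟩
  s · (fourth f · D b₉)             ≈⟨ R.*-congˡ (R.sym (D-square-· (f · f) b₉)) ⟩
  s · D (fourth f · b₉)             ≈⟨ R.*-congˡ (D-cong odd-source) ⟩
  s · D (g · h ⊕ q · fourth h)      ≈⟨ R.*-congˡ (R.trans (D-⊕ (g · h) (q · fourth h)) (R.+-congˡ {D (g · h)} (D-mono-square 1 (h · h) refl))) ⟩
  s · (D (g · h) ⊕ q · fourth h)    ≈⟨ R.distribˡ s (D (g · h)) (q · fourth h) ⟩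
  s · D (g · h) ⊕ s · (q · fourth h)
    ≈⟨ R.+-congʳ {s · (q · fourth h)} (R.trans D-gh (R.*-congʳ {cube (fourth h)} (R.trans (R.sym (mono-· 2 1)) (R.*-congʳ {q} (R.sym (mono-· 1 1)))))) ⟩
  q · q · q · cube (fourth h) ⊕ s · (q · fourth h)
    ≈⟨ solve 3 (λ q g h → q :* q :* q :* ((h :* h :* (h :* h)) :* ((h :* h :* (h :* h)) :* (h :* h :* (h :* h)))) :+ g :* h :* (g :* h) :* (q :* (h :* h :* (h :* h)))
         := q :* (h :* h :* (h :* h)) :* (h :* h) :* ((g :+ q :* (h :* (h :* h))) :* (g :+ q :* (h :* (h :* h))))) R.refl q g h ⟩
  q · fourth h · (h · h) · ((g ⊕ q · cube h) · (g ⊕ q · cube h))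
    ≈⟨ R.*-congˡ (R.*-cong (R.sym cube-f) (R.sym cube-f)) ⟩
  q · fourth h · (h · h) · (cube f · cube f)
    ≈⟨ solve 3 (λ q f h → q :* (h :* h :* (h :* h)) :* (h :* h) :* (f :* (f :* f) :* (f :* (f :* f)))
         := f :* f :* (f :* f) :* (h :* h) :* (q :* (f :* (h :* h) :* (f :* (h :* h))))) R.refl q f h ⟩
  fourth f · (h · h) · (q · (f · (h · h) · (f · (h · h))))
    ≈⟨ R.*-congˡ (R.*-congˡ (R.*-cong (R.sym 𝓛-product) (R.sym 𝓛-product))) ⟩
  fourth f · (h · h) · (q · (L · g · (L · g)))
    ≈⟨ R.*-congˡ {fourth f · (h · h)} (solve 3 (λ q l g → q :* (l :* g :* (l :* g)) := g :* g :* (q :* (l :* l))) R.refl q L g) ⟩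
  fourth f · (h · h) · (g · g · (q · (L · L))) ∎))
  where
  open ≈-Reasoning
  s = g · h · (g · h)
  odd-source : fourth f · b₉ ≈ g · h ⊕ q · fourth h
  odd-source = begin
    fourth f · b₉             ≈⟨ solve 2 (λ f b → f :* f :* (f :* f) :* b := f :* (f :* f) :* (b :* f)) R.refl f b₉ ⟩
    cube f · (b₉ · f)         ≈⟨ R.*-cong cube-f b₉-product ⟩
    (g ⊕ q · cube h) · h      ≈⟨ solve 3 (λ q g h → (g :+ q :* (h :* (h :* h))) :* h := g :* h :+ q :* (h :* h :* (h :* h))) R.refl q g h ⟩
    g · h ⊕ q · fourth h      ∎

b₉-odd : ∀ n → b₉ (suc (n + n)) ≡ generate 𝓛 n
b₉-odd n = begin
  b₉ (suc (n + n))               ≡⟨ cong (_∧ b₉ (suc (n + n))) (odd-suc-double n) ⟨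
  D b₉ (suc (n + n))             ≡⟨ coeff D-b₉ (suc (n + n)) ⟩
  (q · (L · L)) (suc (n + n))    ≡⟨ mono-+ 1 (L · L) (n + n) ⟩
  (L · L) (n + n)                ≡⟨ square-even L n ⟩
  L n                              ∎
  where
  open ≡-Reasoning
  odd-suc-double : ∀ n → odd (suc (n + n)) ≡ true
  odd-suc-double n = cong not (trans (odd-+ n n) (xor-same (odd n)))

-- Factorisations and primes congruent to ±1 modulo 9

Factorisation : ℕ → ℕ × ℕ → Set
Factorisation M (d , e) = d * e ≡ M × d % 3 ≡ 1 × e % 3 ≡ 2 × ¬ 9 ∣ d + e

decompose : ∀ x {r} → x % 3 ≡ r → x ≡ r + x / 3 * 3
decompose x eq = trans (ℕ.m≡m%n+[m/n]*n x 3) (cong (ℕ._+ x / 3 * 3) eq)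

-- d = 3a + 1 and e = 3b + 2 give d + e = 3(a + b + 1), which relates divisibility by 9 to
-- divisibility by 3.
factorisations : ∀ n → (λ i → ¬ 3∣ (let a , b = i in + a ℤ.+ + b ℤ.+ 1ℤ) × (let a , b = i in 3 * (a * b) + 2 * a + b) ≡ n)
                       ≅ Factorisation (2 + n * 3)
factorisations n = bijection (λ (a , b) → 1 + a * 3 , 2 + b * 3) (λ (d , e) → d / 3 , e / 3)
  (λ {(a , b)} (3∤ , eq) → trans (product a b) (cong (λ n → 2 + n * 3) eq) ,
    ℕ.[m+kn]%n≡m%n 1 a 3 , ℕ.[m+kn]%n≡m%n 2 b 3 ,
    λ d → 3∤ (Signed.∣ᵤ⇒∣ (*-cancelˡ-∣ 3 (subst (9 ∣_) (total a b) d))))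
  (λ {(d , e)} (eq , d%3 , e%3 , 9∤) →
    (λ t → 9∤ (subst (9 ∣_) (trans (sym (total (d / 3) (e / 3))) (cong₂ ℕ._+_ (sym (decompose d d%3)) (sym (decompose e e%3))))
                            (*-monoʳ-∣ 3 (Signed.∣⇒∣ᵤ t)))) ,
    ℕ.*-cancelʳ-≡ _ n 3 (ℕ.+-cancelˡ-≡ 2 _ _ (trans (sym (product (d / 3) (e / 3)))
      (trans (cong₂ ℕ._*_ (sym (decompose d d%3)) (sym (decompose e e%3))) eq))))
  (λ {(a , b)} _ → cong₂ _,_ (quotient 1 a (s≤s (s≤s z≤n))) (quotient 2 b (s≤s (s≤s (s≤s z≤n)))))
  (λ {(d , e)} (_ , d%3 , e%3 , _) → cong₂ _,_ (sym (decompose d d%3)) (sym (decompose e e%3)))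
  where
  product : ∀ a b → (1 + a * 3) * (2 + b * 3) ≡ 2 + (3 * (a * b) + 2 * a + b) * 3
  product = solve-ℕ
  total : ∀ a b → 1 + a * 3 + (2 + b * 3) ≡ 3 * (a + b + 1)
  total = solve-ℕ
  quotient : ∀ r a → r < 3 → (r + a * 3) / 3 ≡ a
  quotient r a r<3 = trans (ℕ.+-distrib-/-∣ʳ r (n∣m*n a)) (cong₂ ℕ._+_ (ℕ.m<n⇒m/n≡0 r<3) (ℕ.m*n/n≡m a 3))

finite-factorisations : ∀ n → Finite (Factorisation (2 + n * 3))
finite-factorisations n = transport (factorisations n) (Family.finite 𝓛 n)

generate-𝓛 : ∀ n → generate 𝓛 n ≡ parity (finite-factorisations n)
generate-𝓛 n = parity-≅ (factorisations n) (Family.finite 𝓛 n) (finite-factorisations n)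

%3-* : ∀ x y → (x * y) % 3 ≡ ((x % 3) * (y % 3)) % 3
%3-* x y = ℕ.%-distribˡ-* x y 3

%2-odd : ∀ x → x % 2 ≡ (if odd x then 1 else 0)
%2-odd zero = refl
%2-odd (suc zero) = refl
%2-odd (suc (suc x)) = trans (cong (_% 2) (ℕ.+-comm 2 x)) (trans (ℕ.[m+n]%n≡m%n x 2)
  (trans (%2-odd x) (cong (λ b → if b then 1 else 0) (sym (not-involutive (odd x))))))

sum-zero : ∀ (φ : ℕ → ℕ) f K → (∀ j → φ (f j) ≡ 0) → sum (map φ (applyUpTo f K)) ≡ 0
sum-zero φ f zero _ = refl
sum-zero φ f (suc K) z = cong₂ ℕ._+_ (z 0) (sum-zero φ (f ∘ suc) K (z ∘ suc))

sum-single : ∀ (φ : ℕ → ℕ) f K m → m < K → (∀ j → j ≢ m → φ (f j) ≡ 0) → sum (map φ (applyUpTo f K)) ≡ φ (f m)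
sum-single φ f (suc K) zero _ z = trans (cong (φ (f 0) ℕ.+_) (sum-zero φ (f ∘ suc) K (λ j → z (suc j) λ ()))) (ℕ.+-identityʳ _)
sum-single φ f (suc K) (suc m) (s≤s m<K) z = trans (cong (ℕ._+ sum (map φ (applyUpTo (f ∘ suc) K))) (z 0 λ ()))
  (sum-single φ (f ∘ suc) K m m<K (λ j j≢m → z (suc j) (j≢m ∘ ℕ.suc-injective)))

module Hecke (p : ℕ) (prime : Prime p) where

  private
    instance
      p≢0 : NonZero p
      p≢0 = prime⇒nonZero prime

  OverFirst OverSecond OverBoth : ℕ → ℕ × ℕ → Set
  OverFirst  M (d , e) = Factorisation M (d * p , e)
  OverSecond M (d , e) = Factorisation M (d , e * p)
  OverBoth   M (d , e) = Factorisation M (d * p , e * p)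

  private
    First Second : ℕ × ℕ → Set
    First  (d , e) = p ∣ d
    Second (d , e) = p ∣ e

    first? : Decidable First
    first? (d , e) = p ∣? d

    second? : Decidable Second
    second? (d , e) = p ∣? e

    m/p*p : ∀ {m} → p ∣ m → m / p * p ≡ m
    m/p*p = ℕ.m/n*n≡m

    first : ∀ {M} → (Factorisation M ∩ First) ≅ OverFirst M
    first {M} = bijection (λ (d , e) → d / p , e) (λ (d , e) → d * p , e)
      (λ {(d , e)} (φ , p∣d) → subst (λ d → Factorisation M (d , e)) (sym (m/p*p p∣d)) φ)
      (λ {(d , e)} φ → φ , divides-refl d)
      (λ {(d , e)} (_ , p∣d) → cong (_, e) (m/p*p p∣d)) (λ {(d , e)} _ → cong (_, e) (ℕ.m*n/n≡m d p))

    second : ∀ {M} → (Factorisation M ∩ Second) ≅ OverSecond M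
    second {M} = bijection (λ (d , e) → d , e / p) (λ (d , e) → d , e * p)
      (λ {(d , e)} (φ , p∣e) → subst (λ e → Factorisation M (d , e)) (sym (m/p*p p∣e)) φ)
      (λ {(d , e)} φ → φ , divides-refl e)
      (λ {(d , e)} (_ , p∣e) → cong (d ,_) (m/p*p p∣e)) (λ {(d , e)} _ → cong (d ,_) (ℕ.m*n/n≡m e p))

    both : ∀ {M} → ((Factorisation M ∩ Second) ∩ First) ≅ OverBoth M
    both {M} = bijection (λ (d , e) → d / p , e / p) (λ (d , e) → d * p , e * p)
      (λ {(d , e)} ((φ , p∣e) , p∣d) → subst₂ (λ d e → Factorisation M (d , e)) (sym (m/p*p p∣d)) (sym (m/p*p p∣e)) φ)
      (λ {(d , e)} φ → (φ , divides-refl e) , divides-refl d)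
      (λ {(d , e)} ((_ , p∣e) , p∣d) → cong₂ _,_ (m/p*p p∣d) (m/p*p p∣e))
      (λ {(d , e)} _ → cong₂ _,_ (ℕ.m*n/n≡m d p) (ℕ.m*n/n≡m e p))

  finite-first : ∀ {M} → Finite (Factorisation M) → Finite (OverFirst M)
  finite-first F = transport first (restrict first? F)

  finite-second : ∀ {M} → Finite (Factorisation M) → Finite (OverSecond M)
  finite-second F = transport second (restrict second? F)

  finite-both : ∀ {M} → Finite (Factorisation M) → Finite (OverBoth M)
  finite-both F = transport both (restrict first? (restrict second? F))

  -- Inclusion and exclusion: Euclid's lemma puts p into d or e, so the count is that over d plus
  -- that over e minus that over both, and the first two cancel modulo 2.
  parity-over : ∀ k (F : Finite (Factorisation (k * p))) →
    parity (finite-first F) ≡ parity (finite-second F) → parity F ≡ parity (finite-both F)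
  parity-over k F eq = begin
    parity F
      ≡⟨ parity-split first? F ⟩
    parity (restrict first? F) xor x
      ≡⟨ cong (_xor x) (trans (parity-≅ first (restrict first? F) (finite-first F)) eq) ⟩
    parity (finite-second F) xor x
      ≡⟨ cong (_xor x) (trans (sym (parity-≅ second (restrict second? F) (finite-second F))) (parity-split first? (restrict second? F))) ⟩
    (parity (restrict first? (restrict second? F)) xor parity (restrict (∁? first?) (restrict second? F))) xor x
      ≡⟨ cong₂ (λ y z → (y xor z) xor x) (parity-≅ both (restrict first? (restrict second? F)) (finite-both F))
           (parity-⊆ (λ ((φ , _) , p∤d) → φ , p∤d) (λ {x} (φ , p∤d) → (φ , euclid x φ p∤d) , p∤d)
             (restrict (∁? first?) (restrict second? F)) (restrict (∁? first?) F)) ⟩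
    (parity (finite-both F) xor x) xor x
      ≡⟨ cancel-xor (parity (finite-both F)) x ⟩
    parity (finite-both F) ∎
    where
    open ≡-Reasoning
    x = parity (restrict (∁? first?) F)
    cancel-xor : ∀ x y → (x xor y) xor y ≡ x
    cancel-xor true  true  = refl
    cancel-xor true  false = refl
    cancel-xor false true  = refl
    cancel-xor false false = refl
    euclid : ∀ ((d , e) : ℕ × ℕ) → Factorisation (k * p) (d , e) → ¬ p ∣ d → p ∣ e
    euclid (d , e) (eq , _) p∤d with euclidsLemma d e prime (divides k eq)
    ... | inj₁ p∣d = ⊥-elim (p∤d p∣d)
    ... | inj₂ p∣e = p∣e

  -- Modulo 2, kp has as many factorisations as k/p: the Hecke operator T_p annihilates the series.
  Annihilates : Set
  Annihilates = ∀ k (F : Finite (Factorisation (k * p))) →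
    (∀ m → k ≡ (2 + m * 3) * p → parity F ≡ parity (finite-factorisations m)) ×
    ((∀ m → k ≢ (2 + m * 3) * p) → parity F ≡ false)

  private
    quotient-eq : ∀ {d e k} → d * p * (e * p) ≡ k * p → d * e * p ≡ k
    quotient-eq {d} {e} {k} eq = ℕ.*-cancelʳ-≡ _ k p (trans (lemma d e p) eq)
      where lemma : ∀ d e p → d * e * p * p ≡ d * p * (e * p)
            lemma = solve-ℕ

    product≡2 : ∀ d e → d % 3 ≡ 1 → e % 3 ≡ 2 → ∃ λ m → d * e ≡ 2 + m * 3
    product≡2 d e d%3 e%3 = d * e / 3 , decompose (d * e) (trans (%3-* d e) (cong₂ (λ x y → (x * y) % 3) d%3 e%3))

    annihilates : (∀ {M} (F : Finite (Factorisation M)) → parity (finite-first F) ≡ parity (finite-second F)) →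
      (∀ {k} → OverBoth (k * p * p) ≅ Factorisation k) → Annihilates
    annihilates balanced descend k F =
      (λ { m refl → trans (parity-over k F (balanced F)) (parity-≅ descend (finite-both F) (finite-factorisations m)) }) ,
      -- A factorisation (dp)(ep) = kp forces k = dep, and `descend` yields factors of de with
      -- residues 1 and 2; so k = (3m + 2)p, against the assumption.
      (λ k≢ → trans (parity-over k F (balanced F)) (parity-∅ (finite-both F) λ (d , e) φ →
        let k≡ = quotient-eq {d} {e} (proj₁ φ)
            (d′ , e′) = _≅_.to (descend {d * e}) (d , e)
            (eq , d%3 , e%3 , _) = _≅_.to-∈ (descend {d * e}) {d , e} (trans (proj₁ φ) (cong (ℕ._* p) (sym k≡)) , proj₂ φ)
            m , product = product≡2 d′ e′ d%3 e%3
        in k≢ m (trans (sym k≡) (cong (ℕ._* p) (trans (sym eq) product)))))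

  module _ (t : ℕ) (p≡ : p ≡ 1 + t * 9) where

    private
      stay : ∀ x r → x % 3 ≡ r → (x * p) % 3 ≡ r
      stay x r eq = trans (trans (cong (_% 3) (trans (cong (x ℕ.*_) p≡) (lemma x t))) (ℕ.[m+kn]%n≡m%n x (x * t * 3) 3)) eq
        where lemma : ∀ x t → x * (1 + t * 9) ≡ x + x * t * 3 * 3
              lemma = solve-ℕ

      back : ∀ x r → (x * p) % 3 ≡ r → x % 3 ≡ r
      back x r eq = trans (sym (stay x (x % 3) refl)) eq

      sum₁ : ∀ d e → d * p + e ≡ d * t * 9 + (d + e)
      sum₁ d e = trans (cong (λ p → d * p + e) p≡) (lemma d e t)
        where lemma : ∀ d e t → d * (1 + t * 9) + e ≡ d * t * 9 + (d + e)
              lemma = solve-ℕ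

      sum₂ : ∀ d e → d + e * p ≡ e * t * 9 + (d + e)
      sum₂ d e = trans (cong (λ p → d + e * p) p≡) (lemma d e t)
        where lemma : ∀ d e t → d + e * (1 + t * 9) ≡ e * t * 9 + (d + e)
              lemma = solve-ℕ

      ∣-drop : ∀ {x y} k → x ≡ k * 9 + y → 9 ∣ x → 9 ∣ y
      ∣-drop k refl d = ∣m+n∣m⇒∣n d (divides-refl k)

      ∣-add : ∀ {x y} k → x ≡ k * 9 + y → 9 ∣ y → 9 ∣ x
      ∣-add k refl d = ∣m∣n⇒∣m+n (divides-refl k) d

      product-swap : ∀ d e p → d * p * e ≡ d * (e * p)
      product-swap = solve-ℕ

    -- For p ≡ 1 (mod 9) a factor p moves freely: dp + e ≡ d + e ≡ d + ep (mod 9), and residues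
    -- modulo 3 do not change.
    annihilates⁺ : Annihilates
    annihilates⁺ = annihilates
      (λ F → parity-⊆
        (λ {(d , e)} (eq , d%3 , e%3 , 9∤) → trans (sym (product-swap d e p)) eq , back d 1 d%3 , stay e 2 e%3 ,
          9∤ ∘ ∣-add (d * t) (sum₁ d e) ∘ ∣-drop (e * t) (sum₂ d e))
        (λ {(d , e)} (eq , d%3 , e%3 , 9∤) → trans (product-swap d e p) eq , stay d 1 d%3 , back e 2 e%3 ,
          9∤ ∘ ∣-add (e * t) (sum₂ d e) ∘ ∣-drop (d * t) (sum₁ d e))
        (finite-first F) (finite-second F))
      (λ {k} → bijection id id
        (λ {(d , e)} (eq , d%3 , e%3 , 9∤) → ℕ.*-cancelʳ-≡ _ k p (quotient-eq {d} {e} eq) , back d 1 d%3 , back e 2 e%3 ,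
          9∤ ∘ ∣-add (d * t) (sum₁ d (e * p)) ∘ ∣-add (e * t) (sum₂ d e))
        (λ {(d , e)} (eq , d%3 , e%3 , 9∤) → trans (lemma d e p) (cong (λ k → k * p * p) eq) , stay d 1 d%3 , stay e 2 e%3 ,
          9∤ ∘ ∣-drop (e * t) (sum₂ d e) ∘ ∣-drop (d * t) (sum₁ d (e * p)))
        (λ _ → refl) (λ _ → refl))
      where lemma : ∀ d e p → d * p * (e * p) ≡ d * e * p * p
            lemma = solve-ℕ

  module _ (t : ℕ) (p≡ : p ≡ 8 + t * 9) where

    private
      times : ∀ x → (x * p) % 3 ≡ ((x % 3) * 2) % 3
      times x = trans (%3-* x p) (cong (λ r → ((x % 3) * r) % 3) p%3)
        where
        lemma : ∀ t → 8 + t * 9 ≡ 8 + t * 3 * 3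
        lemma = solve-ℕ
        p%3 : p % 3 ≡ 2
        p%3 = trans (cong (_% 3) (trans p≡ (lemma t))) (ℕ.[m+kn]%n≡m%n 8 (t * 3) 3)

      flip₁ : ∀ x → x % 3 ≡ 1 → (x * p) % 3 ≡ 2
      flip₁ x eq = trans (times x) (cong (λ r → (r * 2) % 3) eq)

      flip₂ : ∀ x → x % 3 ≡ 2 → (x * p) % 3 ≡ 1
      flip₂ x eq = trans (times x) (cong (λ r → (r * 2) % 3) eq)

      flip₁⁻ : ∀ x → (x * p) % 3 ≡ 1 → x % 3 ≡ 2
      flip₁⁻ x eq with x % 3 | ℕ.m%n<n x 3 | trans (sym (times x)) eq
      ... | 2 | _ | _ = refl
      ... | suc (suc (suc _)) | s≤s (s≤s (s≤s ())) | _

      flip₂⁻ : ∀ x → (x * p) % 3 ≡ 2 → x % 3 ≡ 1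
      flip₂⁻ x eq with x % 3 | ℕ.m%n<n x 3 | trans (sym (times x)) eq
      ... | 1 | _ | _ = refl
      ... | suc (suc (suc _)) | s≤s (s≤s (s≤s ())) | _

      p+1 : ∀ x → x * p + x ≡ x * (1 + t) * 9
      p+1 x = trans (cong (λ p → x * p + x) p≡) (lemma x t)
        where lemma : ∀ x t → x * (8 + t * 9) + x ≡ x * (1 + t) * 9
              lemma = solve-ℕ

      ∣-complement : ∀ {x y} z → x + y ≡ z * p + z → 9 ∣ x → 9 ∣ y
      ∣-complement z eq = ∣m+n∣m⇒∣n (subst (9 ∣_) (sym (trans eq (p+1 z))) (divides-refl (z * (1 + t))))

      exchange₁ : ∀ d e p → (e * p + d) + (d * p + e) ≡ (d + e) * p + (d + e)
      exchange₁ = solve-ℕ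

      exchange₂ : ∀ d e p → (e + d * p) + (d + e * p) ≡ (d + e) * p + (d + e)
      exchange₂ = solve-ℕ

      exchange₃ : ∀ d e p → (e + d) + (d * p + e * p) ≡ (d + e) * p + (d + e)
      exchange₃ = solve-ℕ

      exchange₄ : ∀ d e p → (e * p + d * p) + (d + e) ≡ (d + e) * p + (d + e)
      exchange₄ = solve-ℕ

      key : ℕ × ℕ → ℤ
      key (d , e) = + d ℤ.- + e

      negate : ∀ x y → y ℤ.- x ≡ ℤ.- (x ℤ.- y)
      negate = solve-ℤ

      key≡0 : ∀ d e → key (d , e) ≡ 0ℤ → d ≡ e
      key≡0 d e eq = ℤ.+-injective (ℤ.i-j≡0⇒i≡j (+ d) (+ e) eq)

      -- For p ≡ -1 (mod 9), exchanging the cofactors replaces dp + e by ep + d ≡ -(dp + e) (mod 9)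
      -- and swaps the residues modulo 3 back into place. A fixed point d = e would make the sum d(p
      -- + 1), a multiple of 9.
      first-free : ∀ {M} (F : Finite (OverFirst M)) → parity F ≡ false
      first-free F = parity-free F
        (involution (λ (d , e) → e , d) key
          (λ {(d , e)} (eq , d%3 , e%3 , 9∤) → trans (lemma d e p) eq , flip₂ e e%3 , flip₁⁻ d d%3 ,
            9∤ ∘ ∣-complement (d + e) (exchange₁ d e p))
          (λ _ → refl) (λ (d , e) → negate (+ d) (+ e)))
        (λ {(d , e)} (_ , _ , _ , 9∤) eq → 9∤ (subst (λ e → 9 ∣ d * p + e) (key≡0 d e eq) (divides (d * (1 + t)) (p+1 d))))
        where lemma : ∀ d e p → e * p * d ≡ d * p * e
              lemma = solve-ℕ

      second-free : ∀ {M} (F : Finite (OverSecond M)) → parity F ≡ false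
      second-free F = parity-free F
        (involution (λ (d , e) → e , d) key
          (λ {(d , e)} (eq , d%3 , e%3 , 9∤) → trans (lemma d e p) eq , flip₂⁻ e e%3 , flip₁ d d%3 ,
            9∤ ∘ ∣-complement (d + e) (exchange₂ d e p))
          (λ _ → refl) (λ (d , e) → negate (+ d) (+ e)))
        (λ {(d , e)} (_ , _ , _ , 9∤) eq → 9∤ (subst (λ e → 9 ∣ d + e * p) (key≡0 d e eq)
          (divides (d * (1 + t)) (trans (ℕ.+-comm d (d * p)) (p+1 d)))))
        where lemma : ∀ d e p → e * (d * p) ≡ d * (e * p)
              lemma = solve-ℕ

    -- The factorisations with p over d, and likewise those with p over e, cancel among themselves.
    -- Dividing both factors by p ≡ 2 (mod 3) interchanges the residues 1 and 2, so the descent also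
    -- exchanges d and e.
    annihilates⁻ : Annihilates
    annihilates⁻ = annihilates
      (λ F → trans (first-free (finite-first F)) (sym (second-free (finite-second F))))
      (λ {k} → bijection (λ (d , e) → e , d) (λ (d , e) → e , d)
        (λ {(d , e)} (eq , d%3 , e%3 , 9∤) → trans (ℕ.*-comm e d) (ℕ.*-cancelʳ-≡ _ k p (quotient-eq {d} {e} eq)) ,
          flip₂⁻ e e%3 , flip₁⁻ d d%3 , 9∤ ∘ ∣-complement (d + e) (exchange₃ d e p))
        (λ {(d , e)} (eq , d%3 , e%3 , 9∤) → trans (lemma d e p) (cong (λ k → k * p * p) eq) , flip₂ e e%3 , flip₁ d d%3 ,
          9∤ ∘ ∣-complement (d + e) (exchange₄ d e p))
        (λ _ → refl) (λ _ → refl))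
      where lemma : ∀ d e p → e * p * (d * p) ≡ d * e * p * p
            lemma = solve-ℕ

  -- From factorisations back to the coefficients of the congruence

  module _ (β : ℕ) (a : ℕ → ℕ) where

    shiftDilate-hit : ∀ m → shiftDilate p β a (β + p * m) ≡ a m
    shiftDilate-hit m = trans (sum-single _ id _ m
        -- m ≤ β + pm, so the cutoff in `shiftDilate` retains the term with index m.
        (s≤s (ℕ.≤-trans (ℕ.m≤n*m m p) (ℕ.m≤n+m (p * m) β)))
        (λ j j≢m → cong (λ b → if b then a j else 0) (mono-≢ {β + p * j} (j≢m ∘ ℕ.*-cancelˡ-≡ j m p ∘ ℕ.+-cancelˡ-≡ β _ _))))
      (cong (λ b → if b then a m else 0) (mono-≡ (β + p * m)))

    shiftDilate-miss : ∀ n → (∀ m → n ≢ β + p * m) → shiftDilate p β a n ≡ 0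
    shiftDilate-miss n ≢ = sum-zero _ id (suc n)
      (λ j → cong (λ b → if b then a j else 0) (mono-≢ {β + p * j} {n} (≢ j ∘ sym)))

  -- 3 α′ + 2 = p κ and 3 β + κ = 2 p encode α = 2 α′ + 1 ≡ −1/3 (mod 2p) and β = ⌊2p/3⌋.
  congruence : Annihilates → ∀ α α′ β κ → α ≡ α′ + α′ + 1 → 3 * α′ + 2 ≡ κ * p → 3 * β + κ ≡ 2 * p → ∀ n →
    b 9 (2 * p * n + α) % 2 ≡ shiftDilate p β (λ m → b 9 (2 * m + 1)) n % 2
  congruence annihilated α α′ β κ α-odd α-eq β-eq n = trans (%2-odd (b 9 (2 * p * n + α)))
      (trans (cong (λ b → if b then 1 else 0) parities) (sym (%2-odd (shiftDilate p β a n))))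
    where
    -- 2pn + α = 2i + 1 and 3i + 2 = kp, so the left-hand coefficient counts factorisations of kp.
    i = p * n + α′
    k = 3 * n + κ
    index : 2 * p * n + α ≡ suc (i + i)
    index = trans (cong (2 * p * n ℕ.+_) α-odd) (lemma p n α′)
      where lemma : ∀ p n α → 2 * p * n + (α + α + 1) ≡ suc (p * n + α + (p * n + α))
            lemma = solve-ℕ
    k*p : 2 + i * 3 ≡ k * p
    k*p = trans (lemma p n α′) (trans (cong (3 * n * p ℕ.+_) α-eq) (sym (ℕ.*-distribʳ-+ p (3 * n) κ)))
      where lemma : ∀ p n α → 2 + (p * n + α) * 3 ≡ 3 * n * p + (3 * α + 2)
            lemma = solve-ℕ
    lhs : odd (b 9 (2 * p * n + α)) ≡ parity (finite-factorisations i)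
    lhs = trans (cong b₉ index) (trans (b₉-odd i) (generate-𝓛 i))
    F : Finite (Factorisation (k * p))
    F = subst (λ M → Finite (Factorisation M)) k*p (finite-factorisations i)
    parity-F : parity (finite-factorisations i) ≡ parity F
    parity-F = parity-⊆ (λ {x} → subst (λ M → Factorisation M x) k*p) (λ {x} → subst (λ M → Factorisation M x) (sym k*p)) (finite-factorisations i) F
    hit : ∀ m → k ≡ (2 + m * 3) * p → n ≡ β + p * m
    hit m eq = ℕ.*-cancelˡ-≡ n _ 3 (ℕ.+-cancelʳ-≡ κ _ _ (trans eq
      (trans (lemma₁ m p) (trans (cong (ℕ._+ 3 * (p * m)) (sym β-eq)) (lemma₂ β κ p m)))))
      where lemma₁ : ∀ m p → (2 + m * 3) * p ≡ 2 * p + 3 * (p * m)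
            lemma₁ = solve-ℕ
            lemma₂ : ∀ β κ p m → 3 * β + κ + 3 * (p * m) ≡ 3 * (β + p * m) + κ
            lemma₂ = solve-ℕ
    hit⁻ : ∀ m → n ≡ β + p * m → k ≡ (2 + m * 3) * p
    hit⁻ m eq = trans (cong (λ n → 3 * n + κ) eq) (trans (lemma₁ β κ p m) (trans (cong (ℕ._+ 3 * (p * m)) β-eq) (lemma₂ m p)))
      where lemma₁ : ∀ β κ p m → 3 * (β + p * m) + κ ≡ 3 * β + κ + 3 * (p * m)
            lemma₁ = solve-ℕ
            lemma₂ : ∀ m p → 2 * p + 3 * (p * m) ≡ (2 + m * 3) * p
            lemma₂ = solve-ℕ
    a : ℕ → ℕ
    a m = b 9 (2 * m + 1)
    double : ∀ m → suc (m + m) ≡ 2 * m + 1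
    double = solve-ℕ
    found? : Dec (∃ λ m → n ≡ β + p * m)
    found? with β ℕ.≤? n | p ∣? n ∸ β
    ... | no β≰n | _ = no λ (m , eq) → β≰n (subst (β ≤_) (sym eq) (ℕ.m≤m+n β (p * m)))
    ... | yes β≤n | yes (divides m eq) = yes (m , trans (sym (ℕ.m+[n∸m]≡n β≤n)) (cong (β ℕ.+_) (trans eq (ℕ.*-comm m p))))
    ... | yes β≤n | no p∤ = no λ (m , eq) → p∤ (divides m (trans (cong (_∸ β) eq) (trans (ℕ.m+n∸m≡n β (p * m)) (ℕ.*-comm p m))))
    parities : odd (b 9 (2 * p * n + α)) ≡ odd (shiftDilate p β a n)
    parities with found?
    ... | yes (m , eq) = trans lhs (trans parity-F (trans (proj₁ (annihilated k F) m (hit⁻ m eq))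
          (trans (sym (generate-𝓛 m)) (trans (sym (b₉-odd m)) (trans (cong b₉ (double m))
            (cong odd (sym (trans (cong (shiftDilate p β a) eq) (shiftDilate-hit β a m)))))))))
    ... | no ¬found = trans lhs (trans parity-F (trans (proj₂ (annihilated k F) (λ m eq → ¬found (m , hit m eq)))
          (cong odd (sym (shiftDilate-miss β a n (λ m eq → ¬found (m , eq)))))))

theorem1p2 : (p : ℕ) → (p ≡ 53 ⊎ p ≡ 71 ⊎ p ≡ 73 ⊎ p ≡ 89) →
    (α : ℕ) → 0 < α → α < 2 * p → (2 * p) ∣ (3 * α + 1) →
    (n : ℕ) →
    b 9 (2 * p * n + α) % 2 ≡ shiftDilate p ((2 * p) / 3) (λ m → b 9 (2 * m + 1)) n % 2
theorem1p2 p p∈ α _ α<2p 2p∣3α+1 n = cases p p∈ α<2p 2p∣3α+1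
  where
  -- The value of α is certified by an exhaustive search below 2p.
  residue-unique : ∀ M α₀ → Dec (∀ {α} → α < M → M ∣ 3 * α + 1 → α ≡ α₀)
  residue-unique M α₀ = ℕ.allUpTo? (λ α → (M ∣? 3 * α + 1) →-dec (α ℕ.≟ α₀)) M
  cases : ∀ p → (p ≡ 53 ⊎ p ≡ 71 ⊎ p ≡ 73 ⊎ p ≡ 89) → α < 2 * p → 2 * p ∣ 3 * α + 1 →
    b 9 (2 * p * n + α) % 2 ≡ shiftDilate p ((2 * p) / 3) (λ m → b 9 (2 * m + 1)) n % 2
  -- In each case: t from p = 8 + 9t or p = 1 + 9t, then α′ = (α - 1)/2, the quotient β, and κ = 2p
  -- mod 3, which is 2 for p = 73 and 1 for the other three primes.
  cases _ (inj₁ refl) l d =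
    congruence (annihilates⁻ 5 refl) α 17 ((2 * 53) / 3) 1 (from-yes (residue-unique 106 35) l d) refl refl n
    where open Hecke 53 (from-yes (prime? 53))
  cases _ (inj₂ (inj₁ refl)) l d =
    congruence (annihilates⁻ 7 refl) α 23 ((2 * 71) / 3) 1 (from-yes (residue-unique 142 47) l d) refl refl n
    where open Hecke 71 (from-yes (prime? 71))
  cases _ (inj₂ (inj₂ (inj₁ refl))) l d =
    congruence (annihilates⁺ 8 refl) α 48 ((2 * 73) / 3) 2 (from-yes (residue-unique 146 97) l d) refl refl n
    where open Hecke 73 (from-yes (prime? 73))
  cases _ (inj₂ (inj₂ (inj₂ refl))) l d =
    congruence (annihilates⁻ 9 refl) α 29 ((2 * 89) / 3) 1 (from-yes (residue-unique 178 59) l d) refl refl n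
    where open Hecke 89 (from-yes (prime? 89))
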